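{- Let $n\ge 2$. For the $\mathfrak{S}_{n}$-representations $E_n^{(j)}$ ($1\le j\le n$), the $\mathfrak{S}_{n-1}$-representations $E_{n-1}^{(j)}$ ($1\le j\le n-1$) and the $\mathfrak{S}_n$-representations $F_n^{(j)}$ ($1\le j\le n-1$), the system of identities of virtual $\mathfrak{S}_n$-representations $$F^{(j)}_n = \sum_{i=1}^j \left( E^{(i)}_{n-1} \uparrow^{\mathfrak{S}_n}_{\mathfrak{S}_{n-1}} - E_n^{(i)} \right),\qquad j=1,2,\ldots,n-1,$$ is equivalent to the following relation in $R(\mathfrak{S}_n)[[t]]$: $$\sum_{j=1}^n E^{(j)}_n\, t^{n-j} = \left( 1 + t \, V^{(n-1,1)} \right) \sum_{j=1}^{n-1} F^{(j)}_n\, t^{n-1-j}.$$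
   Context: $\mathfrak{S}_n$ is the symmetric group, and $\mathfrak{S}_{n-1}\subset\mathfrak{S}_n$ is the subgroup of permutations fixing $n$; $\uparrow^{\mathfrak{S}_n}_{\mathfrak{S}_{n-1}}$ denotes induction. All representations are over $\mathbb{Q}$. $R(\mathfrak{S}_n)$ is the Grothendieck (representation) ring of finite-dimensional $\mathbb{Q}\mathfrak{S}_n$-modules (product given by tensor product, $1$ the trivial representation), and $R(\mathfrak{S}_n)[[t]]$ is the Grothendieck ring of graded $\mathbb{Q}\mathfrak{S}_n$-modules, where $V\cdot t^k$ is the class of $V$ placed in degree $k$. $V^\lambda$ is the irreducible $\mathfrak{S}_n$-representation indexed by the partition $\lambda$ of $n$; in particular $V^{(n-1,1)}$ is the irreducible $(n-1)$-dimensional reflection representation. Eulerian representations: for $1\le i\le n-1$ let $s_{i,n-i}=\sum_w \mathrm{sgn}(w)\,w\in\mathbb{Q}\mathfrak{S}_n$, the sum over all $w=(w_1,\ldots,w_n)\in\mathfrak{S}_n$ with $w_1<\cdots<w_i$ and $w_{i+1}<\cdots<w_n$. Let $s_n=\sum_{i=1}^{n-1}s_{i,n-i}$. It acts semisimply on $\mathbb{Q}\mathfrak{S}_n$ by left multiplication with eigenvalues $2^j-2$, $j=1,\ldots,n$. The $j$-th Eulerian idempotent $e_n^{(j)}$ is the polynomial in $s_n$ that projects onto the $(2^j-2)$-eigenspace, and $E_n^{(j)}:=e_n^{(j)}\mathbb{Q}\mathfrak{S}_n$, a right $\mathfrak{S}_n$-representation. Whitehouse's lifts: let $c=(1,2,\ldots,n)$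 be the $n$-cycle and $\Lambda_n=\sum_{i=0}^{n-1}\mathrm{sgn}(c)^i c^i\in\mathbb{Q}\mathfrak{S}_n$. The element $\Lambda_n$ commutes with all $e_{n-1}^{(j)}$ (viewed in $\mathbb{Q}\mathfrak{S}_n$ via $\mathfrak{S}_{n-1}\subset\mathfrak{S}_n$), and $F_n^{(j)}:=\Lambda_n e_{n-1}^{(j)}\mathbb{Q}\mathfrak{S}_n=e_{n-1}^{(j)}\Lambda_n\mathbb{Q}\mathfrak{S}_n$ for $j=1,\ldots,n-1$, a right $\mathfrak{S}_n$-representation. (Whitehouse proved that the first displayed system of identities holds for these representations.) -}

module Defs where

open import Algebra.Bundles using (RawMonoid; RawRing; Ring; CommutativeRing)
open import Algebra.Module.Bundles using (LeftModule)
open import Algebra.Module.Construct.TensorUnit using () renaming (leftModule to ⟨ring⟩)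
import Algebra.Definitions.RawMonoid as RawMonoidDefs
import Algebra.Definitions.RawSemiring as RawSemiringDefs
import Algebra.Module.Morphism.Structures as ModuleMorphisms
import Algebra.Properties.Semiring.Sum as SemiringSum
open import Data.Bool.Base using (if_then_else_)
open import Data.Empty using (⊥)
open import Data.Fin.Base as Fin using (Fin; zero; suc; toℕ; fromℕ)
import Data.Fin.Properties as Finₚ
open import Data.Fin.Permutation as Perm
  using (Permutation′; _⟨$⟩ʳ_; _∘ₚ_; insert; remove; insert-remove)
open import Data.List.Base as List
  using (List; []; _∷_; map; foldr; length; filter; allFin; cartesianProduct; cartesianProductWith)
import Data.List.Membership.Propositional.Properties as ∈ₚ
open import Data.List.Relation.Unary.Any as Any using (Any; here)
import Data.List.Relation.Unary.Any.Properties as Anyₚ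
open import Data.Nat.Base as ℕ using (ℕ; zero; suc; _∸_; _≤_; _<_)
import Data.Nat.Properties as ℕₚ
open import Data.Product.Base using (Σ; ∃-syntax; _×_; _,_; proj₁; proj₂)
open import Data.Rational.Base as ℚ using (ℚ; 0ℚ; 1ℚ)
import Data.Rational.Properties as ℚₚ
open import Function.Definitions using (Injective; StrictlySurjective)
open import Level using (0ℓ) renaming (suc to lsuc)
open import Relation.Binary.PropositionalEquality as ≡ using (_≡_)
open import Relation.Nullary using (Dec; yes; no; does)
open import Relation.Nullary.Decidable using (_×-dec_; _→-dec_)

open RawSemiringDefs ℚ.+-*-rawSemiring using () renaming (_^_ to _^ℚ_) public

2ℚ : ℚ
2ℚ = 1ℚ ℚ.+ 1ℚ

-- f 1 + f 2 + ⋯ + f n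
∑₁ : ∀ {a ℓ} (M : RawMonoid a ℓ) → ℕ → (ℕ → RawMonoid.Carrier M) → RawMonoid.Carrier M
∑₁ M n f = RawMonoidDefs.sum M {n} (λ k → f (suc (toℕ k)))

VectorSpace : Set₁
VectorSpace = LeftModule ℚₚ.+-*-ring 0ℓ 0ℓ

module _ (V : VectorSpace) where
  open LeftModule V

  data Span (B : List Carrierᴹ) : Carrierᴹ → Set where
    member : ∀ {v} → Any (v ≈ᴹ_) B → Span B v
    zero   : Span B 0ᴹ
    add    : ∀ {v w} → Span B v → Span B w → Span B (v +ᴹ w)
    scale  : ∀ {v} q → Span B v → Span B (q *ₗ v)
    resp   : ∀ {v w} → v ≈ᴹ w → Span B v → Span B w

  FiniteDimensional : Set
  FiniteDimensional = ∃[ B ] ∀ v → Span B v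

module _ (V : VectorSpace) where
  open LeftModule V

  record IsSubspace (P : Carrierᴹ → Set) : Set where
    field
      has-0 : P 0ᴹ
      has-+ : ∀ {v w} → P v → P w → P (v +ᴹ w)
      has-- : ∀ {v} → P v → P (-ᴹ v)
      has-* : ∀ q {v} → P v → P (q *ₗ v)

  subspace : {P : Carrierᴹ → Set} → IsSubspace P → VectorSpace
  subspace {P} isSub = record
    { Carrierᴹ = Σ Carrierᴹ P
    ; _≈ᴹ_ = λ v w → proj₁ v ≈ᴹ proj₁ w
    ; _+ᴹ_ = λ v w → proj₁ v +ᴹ proj₁ w , has-+ (proj₂ v) (proj₂ w)
    ; _*ₗ_ = λ q v → q *ₗ proj₁ v , has-* q (proj₂ v)
    ; 0ᴹ = 0ᴹ , has-0
    ; -ᴹ_ = λ v → -ᴹ proj₁ v , has-- (proj₂ v)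
    ; isLeftModule = record
      { isLeftSemimodule = record
        { +ᴹ-isCommutativeMonoid = record
          { isMonoid = record
            { isSemigroup = record
              { isMagma = record
                { isEquivalence = record { refl = ≈ᴹ-refl ; sym = ≈ᴹ-sym ; trans = ≈ᴹ-trans }
                ; ∙-cong = +ᴹ-cong }
              ; assoc = λ _ _ _ → +ᴹ-assoc _ _ _ }
            ; identity = (λ _ → +ᴹ-identityˡ _) , (λ _ → +ᴹ-identityʳ _) }
          ; comm = λ _ _ → +ᴹ-comm _ _ }
        ; isPreleftSemimodule = record
          { *ₗ-cong = *ₗ-cong
          ; *ₗ-zeroˡ = λ _ → *ₗ-zeroˡ _
          ; *ₗ-distribʳ = λ _ _ _ → *ₗ-distribʳ _ _ _
          ; *ₗ-identityˡ = λ _ → *ₗ-identityˡ _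
          ; *ₗ-assoc = λ _ _ _ → *ₗ-assoc _ _ _
          ; *ₗ-zeroʳ = λ _ → *ₗ-zeroʳ _
          ; *ₗ-distribˡ = λ _ _ _ → *ₗ-distribˡ _ _ _ } }
      ; -ᴹ‿cong = -ᴹ‿cong
      ; -ᴹ‿inverse = (λ _ → -ᴹ‿inverseˡ _) , (λ _ → -ᴹ‿inverseʳ _) } }
    where open IsSubspace isSub

infixl 6 _+ᴱ_
infixr 7 _*ᴱ_
infixr 8 -ᴱ_

data Expr (G : Set) : Set where
  gen  : G → Expr G
  0ᴱ   : Expr G
  _+ᴱ_ : Expr G → Expr G → Expr G
  -ᴱ_  : Expr G → Expr G
  _*ᴱ_ : ℚ → Expr G → Expr G

-- The least relation containing R for which Expr G is a vector space.
data Eq {G : Set} (R : Expr G → Expr G → Set) : Expr G → Expr G → Set where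
  rel        : ∀ {x y} → R x y → Eq R x y
  refl       : ∀ {x} → Eq R x x
  sym        : ∀ {x y} → Eq R x y → Eq R y x
  trans      : ∀ {x y z} → Eq R x y → Eq R y z → Eq R x z
  +-cong     : ∀ {x x′ y y′} → Eq R x x′ → Eq R y y′ → Eq R (x +ᴱ y) (x′ +ᴱ y′)
  neg-cong   : ∀ {x x′} → Eq R x x′ → Eq R (-ᴱ x) (-ᴱ x′)
  *-cong     : ∀ q {x x′} → Eq R x x′ → Eq R (q *ᴱ x) (q *ᴱ x′)
  +-assoc    : ∀ x y z → Eq R ((x +ᴱ y) +ᴱ z) (x +ᴱ (y +ᴱ z))
  +-comm     : ∀ x y → Eq R (x +ᴱ y) (y +ᴱ x)
  +-identity : ∀ x → Eq R (0ᴱ +ᴱ x) x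
  +-inverse  : ∀ x → Eq R ((-ᴱ x) +ᴱ x) 0ᴱ
  *-zeroˡ    : ∀ x → Eq R (0ℚ *ᴱ x) 0ᴱ
  *-zeroʳ    : ∀ q → Eq R (q *ᴱ 0ᴱ) 0ᴱ
  *-distribˡ : ∀ q x y → Eq R (q *ᴱ (x +ᴱ y)) (q *ᴱ x +ᴱ q *ᴱ y)
  *-distribʳ : ∀ x p q → Eq R ((p ℚ.+ q) *ᴱ x) (p *ᴱ x +ᴱ q *ᴱ x)
  *-assoc    : ∀ p q x → Eq R ((p ℚ.* q) *ᴱ x) (p *ᴱ (q *ᴱ x))
  *-identity : ∀ x → Eq R (1ℚ *ᴱ x) x

presented : (G : Set) → (Expr G → Expr G → Set) → VectorSpace
presented G R = record
  { Carrierᴹ = Expr G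
  ; _≈ᴹ_ = Eq R
  ; _+ᴹ_ = _+ᴱ_
  ; _*ₗ_ = _*ᴱ_
  ; 0ᴹ = 0ᴱ
  ; -ᴹ_ = -ᴱ_
  ; isLeftModule = record
    { isLeftSemimodule = record
      { +ᴹ-isCommutativeMonoid = record
        { isMonoid = record
          { isSemigroup = record
            { isMagma = record
              { isEquivalence = record { refl = refl ; sym = sym ; trans = trans }
              ; ∙-cong = +-cong }
            ; assoc = +-assoc }
          ; identity = +-identity , (λ x → trans (+-comm _ _) (+-identity x)) }
        ; comm = +-comm }
      ; isPreleftSemimodule = record
        { *ₗ-cong = λ { ≡.refl x≈y → *-cong _ x≈y }
        ; *ₗ-zeroˡ = *-zeroˡ
        ; *ₗ-distribʳ = *-distribʳ
        ; *ₗ-identityˡ = *-identity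
        ; *ₗ-assoc = *-assoc
        ; *ₗ-zeroʳ = *-zeroʳ
        ; *ₗ-distribˡ = *-distribˡ } }
    ; -ᴹ‿cong = neg-cong
    ; -ᴹ‿inverse = +-inverse , (λ x → trans (+-comm _ _) (+-inverse x)) } }

extend : ∀ {G H : Set} → (G → Expr H) → Expr G → Expr H
extend f (gen g)  = f g
extend f 0ᴱ       = 0ᴱ
extend f (x +ᴱ y) = extend f x +ᴱ extend f y
extend f (-ᴱ x)   = -ᴱ extend f x
extend f (q *ᴱ x) = q *ᴱ extend f x

module _ {G H : Set} {R : Expr G → Expr G → Set} {S : Expr H → Expr H → Set} where

  extend-cong : {f : G → Expr H} →
                (∀ {x y} → R x y → Eq S (extend f x) (extend f y)) →
                ∀ {x y} → Eq R x y → Eq S (extend f x) (extend f y)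
  extend-cong r (rel p) = r p
  extend-cong r refl = refl
  extend-cong r (sym p) = sym (extend-cong r p)
  extend-cong r (trans p q) = trans (extend-cong r p) (extend-cong r q)
  extend-cong r (+-cong p q) = +-cong (extend-cong r p) (extend-cong r q)
  extend-cong r (neg-cong p) = neg-cong (extend-cong r p)
  extend-cong r (*-cong q p) = *-cong q (extend-cong r p)
  extend-cong r (+-assoc x y z) = +-assoc _ _ _
  extend-cong r (+-comm x y) = +-comm _ _
  extend-cong r (+-identity x) = +-identity _
  extend-cong r (+-inverse x) = +-inverse _
  extend-cong r (*-zeroˡ x) = *-zeroˡ _
  extend-cong r (*-zeroʳ q) = *-zeroʳ q
  extend-cong r (*-distribˡ q x y) = *-distribˡ q _ _
  extend-cong r (*-distribʳ x p q) = *-distribʳ _ p q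
  extend-cong r (*-assoc p q x) = *-assoc p q _
  extend-cong r (*-identity x) = *-identity _

module _ {G H : Set} {S : Expr H → Expr H → Set} where

  extend-ext : {f g : G → Expr H} → (∀ a → Eq S (f a) (g a)) →
               ∀ x → Eq S (extend f x) (extend g x)
  extend-ext p (gen a)  = p a
  extend-ext p 0ᴱ       = refl
  extend-ext p (x +ᴱ y) = +-cong (extend-ext p x) (extend-ext p y)
  extend-ext p (-ᴱ x)   = neg-cong (extend-ext p x)
  extend-ext p (q *ᴱ x) = *-cong q (extend-ext p x)

extend-gen : ∀ {G : Set} (x : Expr G) → extend gen x ≡ x
extend-gen (gen g)  = ≡.refl
extend-gen 0ᴱ       = ≡.refl
extend-gen (x +ᴱ y) = ≡.cong₂ _+ᴱ_ (extend-gen x) (extend-gen y)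
extend-gen (-ᴱ x)   = ≡.cong -ᴱ_ (extend-gen x)
extend-gen (q *ᴱ x) = ≡.cong (q *ᴱ_) (extend-gen x)

extend-extend : ∀ {G H K : Set} {f : G → Expr H} {g : H → Expr K} (x : Expr G) →
                extend g (extend f x) ≡ extend (λ a → extend g (f a)) x
extend-extend (gen a)  = ≡.refl
extend-extend 0ᴱ       = ≡.refl
extend-extend (x +ᴱ y) = ≡.cong₂ _+ᴱ_ (extend-extend x) (extend-extend y)
extend-extend (-ᴱ x)   = ≡.cong -ᴱ_ (extend-extend x)
extend-extend (q *ᴱ x) = ≡.cong (q *ᴱ_) (extend-extend x)

module _ (V : VectorSpace) where
  open LeftModule V

  neg-one : ∀ v → (ℚ.- 1ℚ) *ₗ v ≈ᴹ -ᴹ v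
  neg-one v = uniqueˡ
    where
    open import Algebra.Properties.Group +ᴹ-group using (inverseˡ-unique)
    uniqueˡ : (ℚ.- 1ℚ) *ₗ v ≈ᴹ -ᴹ v
    uniqueˡ = inverseˡ-unique _ _ (≈ᴹ-trans (+ᴹ-cong ≈ᴹ-refl (≈ᴹ-sym (*ₗ-identityˡ v)))
      (≈ᴹ-trans (≈ᴹ-sym (*ₗ-distribʳ v (ℚ.- 1ℚ) 1ℚ)) (*ₗ-zeroˡ v)))

  span-neg : ∀ {B v} → Span V B v → Span V B (-ᴹ v)
  span-neg s = resp (neg-one _) (scale (ℚ.- 1ℚ) s)

  combination : ∀ {n} → (Fin n → ℚ) → (Fin n → Carrierᴹ) → Carrierᴹ
  combination c b = RawMonoidDefs.sum +ᴹ-rawMonoid (λ i → c i *ₗ b i)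

  span-combination : ∀ {n} c (b : Fin n → Carrierᴹ) → Span V (map b (allFin n)) (combination c b)
  span-combination {n} c b = go c b (λ i → member (Anyₚ.map⁺ (Any.map at (∈ₚ.∈-allFin i))))
    where
    at : ∀ {i k : Fin n} → i ≡ k → b i ≈ᴹ b k
    at ≡.refl = ≈ᴹ-refl

    go : ∀ {B n} c (b : Fin n → Carrierᴹ) → (∀ i → Span V B (b i)) → Span V B (combination c b)
    go {n = zero}  c b s = zero
    go {n = suc n} c b s = add (scale (c zero) (s zero))
      (go (λ i → c (suc i)) (λ i → b (suc i)) (λ i → s (suc i)))

presented-finDim : ∀ {G R} (B : List (Expr G)) → (∀ g → Span (presented G R) B (gen g)) →
                   FiniteDimensional (presented G R)
presented-finDim {G} {R} B s = B , go
  where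
  go : ∀ x → Span (presented G R) B x
  go (gen g)  = s g
  go 0ᴱ       = zero
  go (x +ᴱ y) = add (go x) (go y)
  go (-ᴱ x)   = span-neg (presented G R) (go x)
  go (q *ᴱ x) = scale q (go x)

-- A ⊗ B over ℚ, with  α i a ⊗ b = a ⊗ β i b  imposed for every i.
module Tensor (A B : VectorSpace) {I : Set}
  (α : I → LeftModule.Carrierᴹ A → LeftModule.Carrierᴹ A)
  (β : I → LeftModule.Carrierᴹ B → LeftModule.Carrierᴹ B) where

  private
    module A = LeftModule A
    module B = LeftModule B

  infix 8 _⊗_

  _⊗_ : A.Carrierᴹ → B.Carrierᴹ → Expr (A.Carrierᴹ × B.Carrierᴹ)
  a ⊗ b = gen (a , b)

  data Relation : Expr (A.Carrierᴹ × B.Carrierᴹ) → Expr (A.Carrierᴹ × B.Carrierᴹ) → Set where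
    ⊗-cong   : ∀ {a a′ b b′} → a A.≈ᴹ a′ → b B.≈ᴹ b′ → Relation (a ⊗ b) (a′ ⊗ b′)
    +ˡ       : ∀ a a′ b → Relation ((a A.+ᴹ a′) ⊗ b) (a ⊗ b +ᴱ a′ ⊗ b)
    +ʳ       : ∀ a b b′ → Relation (a ⊗ (b B.+ᴹ b′)) (a ⊗ b +ᴱ a ⊗ b′)
    *ˡ       : ∀ q a b → Relation ((q A.*ₗ a) ⊗ b) (q *ᴱ a ⊗ b)
    *ʳ       : ∀ q a b → Relation (a ⊗ (q B.*ₗ b)) (q *ᴱ a ⊗ b)
    balanced : ∀ i a b → Relation (α i a ⊗ b) (a ⊗ β i b)

  space : VectorSpace
  space = presented (A.Carrierᴹ × B.Carrierᴹ) Relation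

  0⊗ : ∀ b → Eq Relation (A.0ᴹ ⊗ b) 0ᴱ
  0⊗ b = trans (rel (⊗-cong (A.≈ᴹ-sym (A.*ₗ-zeroˡ A.0ᴹ)) B.≈ᴹ-refl))
               (trans (rel (*ˡ 0ℚ A.0ᴹ b)) (*-zeroˡ _))

  ⊗0 : ∀ a → Eq Relation (a ⊗ B.0ᴹ) 0ᴱ
  ⊗0 a = trans (rel (⊗-cong A.≈ᴹ-refl (B.≈ᴹ-sym (B.*ₗ-zeroˡ B.0ᴹ))))
               (trans (rel (*ʳ 0ℚ a B.0ᴹ)) (*-zeroˡ _))

  finDim : FiniteDimensional A → FiniteDimensional B → FiniteDimensional space
  finDim (as , spanA) (bs , spanB) =
    presented-finDim (cartesianProductWith _⊗_ as bs) λ (a , b) → go (spanA a) (spanB b)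
    where
    Sp : Expr (A.Carrierᴹ × B.Carrierᴹ) → Set
    Sp = Span space (cartesianProductWith _⊗_ as bs)

    go : ∀ {a b} → Span A as a → Span B bs b → Sp (a ⊗ b)
    go (member p) (member q) = member
      (Anyₚ.cartesianProductWith⁺ _⊗_ (λ a≈ b≈ → rel (⊗-cong a≈ b≈)) p q)
    go {a} s zero = resp (sym (⊗0 a)) zero
    go s (add t u) = resp (sym (rel (+ʳ _ _ _))) (add (go s t) (go s u))
    go s (scale q t) = resp (sym (rel (*ʳ q _ _))) (scale q (go s t))
    go s (resp e t) = resp (rel (⊗-cong A.≈ᴹ-refl e)) (go s t)
    go {b = b} zero t@(member _) = resp (sym (0⊗ b)) zero
    go (add s u) t@(member _) = resp (sym (rel (+ˡ _ _ _))) (add (go s t) (go u t))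
    go (scale q s) t@(member _) = resp (sym (rel (*ˡ q _ _))) (scale q (go s t))
    go (resp e s) t@(member _) = resp (rel (⊗-cong e B.≈ᴹ-refl)) (go s t)

Perm : ℕ → Set
Perm = Permutation′

infixl 7 _∙_

-- (u ∙ w)(i) = u(w(i))
_∙_ : ∀ {n} → Perm n → Perm n → Perm n
u ∙ w = w ∘ₚ u

_^ₚ_ : ∀ {n} → Perm n → ℕ → Perm n
w ^ₚ zero  = Perm.id
w ^ₚ suc k = w ∙ (w ^ₚ k)

allPerms : ∀ n → List (Perm n)
allPerms zero    = Perm.id ∷ []
allPerms (suc n) = cartesianProductWith (insert zero) (allFin (suc n)) (allPerms n)

insert-cong : ∀ {n} (i j : Fin (suc n)) {u w : Perm n} → u Perm.≈ w → insert i j u Perm.≈ insert i j w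
insert-cong i j p k with i Finₚ.≟ k
... | yes _ = ≡.refl
... | no _  = ≡.cong (Fin.punchIn j) (p _)

allPerms-complete : ∀ {n} (w : Perm n) → Any (w Perm.≈_) (allPerms n)
allPerms-complete {zero}  w = here λ ()
allPerms-complete {suc n} w = Anyₚ.cartesianProductWith⁺ (insert zero)
  (λ { ≡.refl q i → ≡.trans (≡.sym (insert-remove zero w i)) (insert-cong zero _ q i) })
  (∈ₚ.∈-allFin (w ⟨$⟩ʳ zero)) (allPerms-complete (remove zero w))

inversions : ∀ {n} → Perm n → List (Fin n × Fin n)
inversions {n} w =
  filter (λ (i , j) → (i Finₚ.<? j) ×-dec ((w ⟨$⟩ʳ j) Finₚ.<? (w ⟨$⟩ʳ i)))
         (cartesianProduct (allFin n) (allFin n))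

sgn : ∀ {n} → Perm n → ℚ
sgn w = (ℚ.- 1ℚ) ^ℚ length (inversions w)

-- 𝔖ₘ as the subgroup of 𝔖ₘ₊₁ fixing the last point.
ι : ∀ {m} → Perm m → Perm (suc m)
ι {m} w = insert (fromℕ m) (fromℕ m) w

-- The cycle (1,2,…,m+1): the last point goes to the first, every other i to i+1.
cycle : ∀ m → Perm (suc m)
cycle m = insert (fromℕ m) zero Perm.id

data SamePerm {n : ℕ} : Expr (Perm n) → Expr (Perm n) → Set where
  same : ∀ u w → u Perm.≈ w → SamePerm (gen u) (gen w)

ℚ𝔖 : ℕ → VectorSpace
ℚ𝔖 n = presented (Perm n) SamePerm

ℚ[𝔖_] : ℕ → Set
ℚ[𝔖 n ] = Expr (Perm n)

infix 4 _≈ₐ_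
infixl 7 _*ₐ_ _·ₐ_

_≈ₐ_ : ∀ {n} → ℚ[𝔖 n ] → ℚ[𝔖 n ] → Set
_≈ₐ_ = Eq SamePerm

_·ₐ_ : ∀ {n} → ℚ[𝔖 n ] → Perm n → ℚ[𝔖 n ]
x ·ₐ w = extend (λ u → gen (u ∙ w)) x

_*ₐ_ : ∀ {n} → ℚ[𝔖 n ] → ℚ[𝔖 n ] → ℚ[𝔖 n ]
x *ₐ y = extend (λ w → x ·ₐ w) y

ιₐ : ∀ {m} → ℚ[𝔖 m ] → ℚ[𝔖 suc m ]
ιₐ = extend (λ w → gen (ι w))

·ₐ-cong : ∀ {n} (w : Perm n) {x y} → x ≈ₐ y → x ·ₐ w ≈ₐ y ·ₐ w
·ₐ-cong w = extend-cong λ { (same u v p) → rel (same (u ∙ w) (v ∙ w) (λ i → p (w ⟨$⟩ʳ i))) }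

·ₐ-congʳ : ∀ {n} x (u w : Perm n) → u Perm.≈ w → x ·ₐ u ≈ₐ x ·ₐ w
·ₐ-congʳ x u w p =
  extend-ext (λ v → rel (same (v ∙ u) (v ∙ w) (λ i → ≡.cong (v ⟨$⟩ʳ_) (p i)))) x

·ₐ-id : ∀ {n} (x : ℚ[𝔖 n ]) → x ·ₐ Perm.id ≈ₐ x
·ₐ-id x = ≡.subst (x ·ₐ Perm.id ≈ₐ_) (extend-gen x) (extend-ext (λ u → rel (same (u ∙ Perm.id) u λ _ → ≡.refl)) x)

·ₐ-∙ : ∀ {n} (x : ℚ[𝔖 n ]) u w → x ·ₐ (u ∙ w) ≈ₐ (x ·ₐ u) ·ₐ w
·ₐ-∙ x u w = ≡.subst (x ·ₐ (u ∙ w) ≈ₐ_) (≡.sym (extend-extend x))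
  (extend-ext (λ v → rel (same (v ∙ (u ∙ w)) ((v ∙ u) ∙ w) λ _ → ≡.refl)) x)

*ₐ-·ₐ : ∀ {n} (x y : ℚ[𝔖 n ]) w → x *ₐ (y ·ₐ w) ≈ₐ (x *ₐ y) ·ₐ w
*ₐ-·ₐ x y w = ≡.subst₂ _≈ₐ_ (≡.sym (extend-extend y)) (≡.sym (extend-extend y))
  (extend-ext (λ u → ·ₐ-∙ x u w) y)

record Rep (n : ℕ) : Set₁ where
  field
    space : VectorSpace
  open LeftModule space public
  infixl 7 _·_
  field
    _·_     : Carrierᴹ → Perm n → Carrierᴹ
    ·-congˡ : ∀ {v v′} w → v ≈ᴹ v′ → v · w ≈ᴹ v′ · w
    ·-congʳ : ∀ v u w → u Perm.≈ w → v · u ≈ᴹ v · w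
    ·-+     : ∀ v v′ w → (v +ᴹ v′) · w ≈ᴹ v · w +ᴹ v′ · w
    ·-*     : ∀ q v w → (q *ₗ v) · w ≈ᴹ q *ₗ (v · w)
    ·-id    : ∀ v → v · Perm.id ≈ᴹ v
    ·-∙     : ∀ v u w → v · (u ∙ w) ≈ᴹ (v · u) · w
    finDim  : FiniteDimensional space

-- a ℚ𝔖ₙ with right multiplication
rightIdeal : ∀ {n} → ℚ[𝔖 n ] → Rep n
rightIdeal {n} a = record
  { space = space
  ; _·_ = λ (x , y , p) w → x ·ₐ w , y ·ₐ w , trans (·ₐ-cong w p) (sym (*ₐ-·ₐ a y w))
  ; ·-congˡ = λ w → ·ₐ-cong w
  ; ·-congʳ = λ (x , _) → ·ₐ-congʳ x
  ; ·-+ = λ _ _ _ → refl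
  ; ·-* = λ _ _ _ → refl
  ; ·-id = λ (x , _) → ·ₐ-id x
  ; ·-∙ = λ (x , _) → ·ₐ-∙ x
  ; finDim = basis , λ (x , y , p) → resp (sym p) (spans y)
  }
  where
  isSub : IsSubspace (ℚ𝔖 n) (λ x → ∃[ y ] x ≈ₐ a *ₐ y)
  isSub = record
    { has-0 = 0ᴱ , refl
    ; has-+ = λ (y , p) (z , q) → y +ᴱ z , +-cong p q
    ; has-- = λ (y , p) → -ᴱ y , neg-cong p
    ; has-* = λ q (y , p) → q *ᴱ y , *-cong q p
    }

  space : VectorSpace
  space = subspace (ℚ𝔖 n) isSub

  multiple : ℚ[𝔖 n ] → LeftModule.Carrierᴹ space
  multiple y = a *ₐ y , y , refl

  basis : List (LeftModule.Carrierᴹ space)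
  basis = map (λ w → multiple (gen w)) (allPerms n)

  spans : ∀ y → Span space basis (multiple y)
  spans (gen w)  = member (Anyₚ.map⁺ (Any.map (λ {u} → ·ₐ-congʳ a w u) (allPerms-complete w)))
  spans 0ᴱ       = resp refl zero
  spans (y +ᴱ z) = resp refl (add (spans y) (spans z))
  spans (-ᴱ y)   = resp refl (span-neg space (spans y))
  spans (q *ᴱ y) = resp refl (scale q (spans y))

trivial : ∀ n → Rep n
trivial n = record
  { space = ⟨ring⟩
  ; _·_ = λ v _ → v
  ; ·-congˡ = λ _ p → p
  ; ·-congʳ = λ _ _ _ _ → ≡.refl
  ; ·-+ = λ _ _ _ → ≡.refl
  ; ·-* = λ _ _ _ → ≡.refl
  ; ·-id = λ _ → ≡.refl
  ; ·-∙ = λ _ _ _ → ≡.refl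
  ; finDim = (1ℚ ∷ []) , λ q → resp (ℚₚ.*-identityʳ q) (scale q (member (here ≡.refl)))
  }

infixr 7 _⊗ᴿ_

_⊗ᴿ_ : ∀ {n} → Rep n → Rep n → Rep n
_⊗ᴿ_ {n} V W = record
  { space = T.space
  ; _·_ = λ x w → extend (act w) x
  ; ·-congˡ = λ w → extend-cong (resp-act w)
  ; ·-congʳ = λ x u w p →
      extend-ext (λ (a , b) → rel (T.⊗-cong (V.·-congʳ a u w p) (W.·-congʳ b u w p))) x
  ; ·-+ = λ _ _ _ → refl
  ; ·-* = λ _ _ _ → refl
  ; ·-id = λ x → ≡.subst (Eq T.Relation _) (extend-gen x)
      (extend-ext (λ (a , b) → rel (T.⊗-cong (V.·-id a) (W.·-id b))) x)
  ; ·-∙ = λ x u w → ≡.subst (Eq T.Relation _) (≡.sym (extend-extend x))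
      (extend-ext (λ (a , b) → rel (T.⊗-cong (V.·-∙ a u w) (W.·-∙ b u w))) x)
  ; finDim = T.finDim V.finDim W.finDim
  }
  where
  module V = Rep V
  module W = Rep W
  module T = Tensor V.space W.space {⊥} (λ ()) (λ ())
  open T using (_⊗_)

  act : Perm n → V.Carrierᴹ × W.Carrierᴹ → Expr (V.Carrierᴹ × W.Carrierᴹ)
  act w (a , b) = (a V.· w) ⊗ (b W.· w)

  resp-act : ∀ w {x y} → T.Relation x y → Eq T.Relation (extend (act w) x) (extend (act w) y)
  resp-act w (T.⊗-cong p q) = rel (T.⊗-cong (V.·-congˡ w p) (W.·-congˡ w q))
  resp-act w (T.+ˡ a a′ b) = trans (rel (T.⊗-cong (V.·-+ a a′ w) W.≈ᴹ-refl)) (rel (T.+ˡ _ _ _))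
  resp-act w (T.+ʳ a b b′) = trans (rel (T.⊗-cong V.≈ᴹ-refl (W.·-+ b b′ w))) (rel (T.+ʳ _ _ _))
  resp-act w (T.*ˡ q a b) = trans (rel (T.⊗-cong (V.·-* q a w) W.≈ᴹ-refl)) (rel (T.*ˡ _ _ _))
  resp-act w (T.*ʳ q a b) = trans (rel (T.⊗-cong V.≈ᴹ-refl (W.·-* q b w))) (rel (T.*ʳ _ _ _))

-- V ⊗ ℚ𝔖ₘ₊₁ over ℚ𝔖ₘ
induced : ∀ {m} → Rep m → Rep (suc m)
induced {m} V = record
  { space = T.space
  ; _·_ = λ x w → extend (act w) x
  ; ·-congˡ = λ w → extend-cong (resp-act w)
  ; ·-congʳ = λ x u w p → extend-ext (λ (a , b) → rel (T.⊗-cong V.≈ᴹ-refl (·ₐ-congʳ b u w p))) x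
  ; ·-+ = λ _ _ _ → refl
  ; ·-* = λ _ _ _ → refl
  ; ·-id = λ x → ≡.subst (Eq T.Relation _) (extend-gen x)
      (extend-ext (λ (a , b) → rel (T.⊗-cong V.≈ᴹ-refl (·ₐ-id b))) x)
  ; ·-∙ = λ x u w → ≡.subst (Eq T.Relation _) (≡.sym (extend-extend x))
      (extend-ext (λ (a , b) → rel (T.⊗-cong V.≈ᴹ-refl (·ₐ-∙ b u w))) x)
  ; finDim = T.finDim V.finDim
      (presented-finDim (map gen (allPerms (suc m)))
        λ w → member (Anyₚ.map⁺ (Any.map (λ {u} p → rel (same w u p)) (allPerms-complete w))))
  }
  where
  module V = Rep V
  module T = Tensor V.space (ℚ𝔖 (suc m)) {Perm m} (λ h v → v V.· h) (λ h x → gen (ι h) *ₐ x)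
  open T using (_⊗_)

  act : Perm (suc m) → V.Carrierᴹ × ℚ[𝔖 suc m ] → Expr (V.Carrierᴹ × ℚ[𝔖 suc m ])
  act w (a , b) = a ⊗ (b ·ₐ w)

  resp-act : ∀ w {x y} → T.Relation x y → Eq T.Relation (extend (act w) x) (extend (act w) y)
  resp-act w (T.⊗-cong p q) = rel (T.⊗-cong p (·ₐ-cong w q))
  resp-act w (T.+ˡ a a′ b) = rel (T.+ˡ _ _ _)
  resp-act w (T.+ʳ a b b′) = rel (T.+ʳ _ _ _)
  resp-act w (T.*ˡ q a b) = rel (T.*ˡ _ _ _)
  resp-act w (T.*ʳ q a b) = rel (T.*ʳ _ _ _)
  resp-act w (T.balanced h a b) =
    trans (rel (T.balanced h a (b ·ₐ w))) (rel (T.⊗-cong V.≈ᴹ-refl (*ₐ-·ₐ (gen (ι h)) b w)))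

open SemiringSum (Ring.semiring ℚₚ.+-*-ring) using (sum; sum-cong-≗; ∑-distrib-+; *-distribˡ-sum; *-distribʳ-sum; sum-permute)

coordinates : ℕ → VectorSpace
coordinates n = record
  { Carrierᴹ = Fin n → ℚ
  ; _≈ᴹ_ = λ v w → ∀ i → v i ≡ w i
  ; _+ᴹ_ = λ v w i → v i ℚ.+ w i
  ; _*ₗ_ = λ q v i → q ℚ.* v i
  ; 0ᴹ = λ _ → 0ℚ
  ; -ᴹ_ = λ v i → ℚ.- v i
  ; isLeftModule = record
    { isLeftSemimodule = record
      { +ᴹ-isCommutativeMonoid = record
        { isMonoid = record
          { isSemigroup = record
            { isMagma = record
              { isEquivalence = record
                { refl = λ _ → ≡.refl
                ; sym = λ p i → ≡.sym (p i)
                ; trans = λ p q i → ≡.trans (p i) (q i) }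
              ; ∙-cong = λ p q i → ≡.cong₂ ℚ._+_ (p i) (q i) }
            ; assoc = λ u v w i → ℚₚ.+-assoc (u i) (v i) (w i) }
          ; identity = (λ v i → ℚₚ.+-identityˡ (v i)) , (λ v i → ℚₚ.+-identityʳ (v i)) }
        ; comm = λ v w i → ℚₚ.+-comm (v i) (w i) }
      ; isPreleftSemimodule = record
        { *ₗ-cong = λ p q i → ≡.cong₂ ℚ._*_ p (q i)
        ; *ₗ-zeroˡ = λ v i → ℚₚ.*-zeroˡ (v i)
        ; *ₗ-distribʳ = λ v p q i → ℚₚ.*-distribʳ-+ (v i) p q
        ; *ₗ-identityˡ = λ v i → ℚₚ.*-identityˡ (v i)
        ; *ₗ-assoc = λ p q v i → ℚₚ.*-assoc p q (v i)
        ; *ₗ-zeroʳ = λ q _ → ℚₚ.*-zeroʳ q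
        ; *ₗ-distribˡ = λ q v w i → ℚₚ.*-distribˡ-+ q (v i) (w i) } }
    ; -ᴹ‿cong = λ p i → ≡.cong ℚ.-_ (p i)
    ; -ᴹ‿inverse = (λ v i → ℚₚ.+-inverseˡ (v i)) , (λ v i → ℚₚ.+-inverseʳ (v i)) } }

δ : ∀ {n} → Fin n → Fin n → ℚ
δ zero    zero    = 1ℚ
δ zero    (suc k) = 0ℚ
δ (suc i) zero    = 0ℚ
δ (suc i) (suc k) = δ i k

sum-zero : ∀ {n} (v : Fin n → ℚ) → sum (λ i → v i ℚ.* 0ℚ) ≡ 0ℚ
sum-zero {zero}  v = ≡.refl
sum-zero {suc n} v = ≡.cong₂ ℚ._+_ (ℚₚ.*-zeroʳ (v zero)) (sum-zero (λ i → v (suc i)))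

sum-δ : ∀ {n} (v : Fin n → ℚ) k → sum (λ i → v i ℚ.* δ i k) ≡ v k
sum-δ v zero = ≡.trans
  (≡.cong₂ ℚ._+_ (ℚₚ.*-identityʳ (v zero)) (sum-zero (λ i → v (suc i))))
  (ℚₚ.+-identityʳ (v zero))
sum-δ v (suc k) = ≡.trans
  (≡.cong₂ ℚ._+_ (ℚₚ.*-zeroʳ (v zero)) (sum-δ (λ i → v (suc i)) k))
  (ℚₚ.+-identityˡ (v (suc k)))

sum-δ-row : ∀ {n} (i : Fin n) → sum (δ i) ≡ 1ℚ
sum-δ-row {suc n} zero    = ≡.cong (1ℚ ℚ.+_) (sum-zero {n} (λ _ → 0ℚ))
sum-δ-row {suc n} (suc i) = ≡.trans (ℚₚ.+-identityˡ (sum (δ i))) (sum-δ-row i)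

sum-neg : ∀ {n} (v : Fin n → ℚ) → sum (λ i → ℚ.- v i) ≡ ℚ.- sum v
sum-neg {zero}  v = ≡.refl
sum-neg {suc n} v = ≡.trans (≡.cong ((ℚ.- v zero) ℚ.+_) (sum-neg (λ i → v (suc i))))
                            (≡.sym (ℚₚ.neg-distrib-+ (v zero) (sum (λ i → v (suc i)))))

-- V^(n-1,1) for n = m+1: the vectors in ℚⁿ with coordinate sum zero, permuted by 𝔖ₙ.
reflection : ∀ m → Rep (suc m)
reflection m = record
  { space = space
  ; _·_ = λ (v , p) w → (λ i → v (w ⟨$⟩ʳ i)) , ≡.trans (≡.sym (sum-permute v w)) p
  ; ·-congˡ = λ w p i → p (w ⟨$⟩ʳ i)
  ; ·-congʳ = λ (v , _) u w p i → ≡.cong v (p i)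
  ; ·-+ = λ _ _ _ _ → ≡.refl
  ; ·-* = λ _ _ _ _ → ≡.refl
  ; ·-id = λ _ _ → ≡.refl
  ; ·-∙ = λ _ _ _ _ → ≡.refl
  ; finDim = map b (allFin (suc m)) , spans
  }
  where
  isSub : IsSubspace (coordinates (suc m)) (λ v → sum v ≡ 0ℚ)
  isSub = record
    { has-0 = sum-zero {suc m} (λ _ → 0ℚ)
    ; has-+ = λ {v} {w} p q → ≡.trans (∑-distrib-+ v w) (≡.cong₂ ℚ._+_ p q)
    ; has-- = λ {v} p → ≡.trans (sum-neg v) (≡.cong ℚ.-_ p)
    ; has-* = λ q {v} p → ≡.trans (≡.sym (*-distribˡ-sum q v)) (≡.trans (≡.cong (q ℚ.*_) p) (ℚₚ.*-zeroʳ q))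
    }

  space : VectorSpace
  space = subspace (coordinates (suc m)) isSub

  open LeftModule space using (Carrierᴹ; _≈ᴹ_)

  b : Fin (suc m) → Carrierᴹ
  b i = (λ k → δ i k ℚ.- δ zero k)
      , ≡.trans (∑-distrib-+ (δ i) (λ k → ℚ.- δ zero k))
          (≡.cong₂ ℚ._+_ (sum-δ-row i) (≡.trans (sum-neg (δ {suc m} zero)) (≡.cong ℚ.-_ (sum-δ-row {suc m} zero))))

  coordinate : ∀ {n} c (f : Fin n → Carrierᴹ) k →
               proj₁ (combination space c f) k ≡ sum (λ i → c i ℚ.* proj₁ (f i) k)
  coordinate {zero}  c f k = ≡.refl
  coordinate {suc n} c f k = ≡.cong ((c zero ℚ.* proj₁ (f zero) k) ℚ.+_)
    (coordinate (λ i → c (suc i)) (λ i → f (suc i)) k)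

  expansion : ∀ v → combination space (proj₁ v) b ≈ᴹ v
  expansion (v , p) k = begin
    proj₁ (combination space v b) k
      ≡⟨ coordinate v b k ⟩
    sum (λ i → v i ℚ.* (δ i k ℚ.- c))
      ≡⟨ sum-cong-≗ (λ i → ℚₚ.*-distribˡ-+ (v i) (δ i k) (ℚ.- c)) ⟩
    sum (λ i → v i ℚ.* δ i k ℚ.+ v i ℚ.* (ℚ.- c))
      ≡⟨ ∑-distrib-+ (λ i → v i ℚ.* δ i k) (λ i → v i ℚ.* (ℚ.- c)) ⟩
    sum (λ i → v i ℚ.* δ i k) ℚ.+ sum (λ i → v i ℚ.* (ℚ.- c))
      ≡⟨ ≡.cong₂ ℚ._+_ (sum-δ v k) (≡.sym (*-distribʳ-sum (ℚ.- c) v)) ⟩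
    v k ℚ.+ sum v ℚ.* (ℚ.- c)
      ≡⟨ ≡.cong (λ s → v k ℚ.+ s ℚ.* (ℚ.- c)) p ⟩
    v k ℚ.+ 0ℚ ℚ.* (ℚ.- c)
      ≡⟨ ≡.cong (v k ℚ.+_) (ℚₚ.*-zeroˡ (ℚ.- c)) ⟩
    v k ℚ.+ 0ℚ
      ≡⟨ ℚₚ.+-identityʳ (v k) ⟩
    v k ∎
    where
    open ≡.≡-Reasoning
    c : ℚ
    c = δ zero k

  spans : ∀ v → Span space (map b (allFin (suc m))) v
  spans v = resp (expansion v) (span-combination space (proj₁ v) b)

record ShortExact {n} (A B C : Rep n) : Set where
  private
    module A = Rep A
    module B = Rep B
    module C = Rep C
  open ModuleMorphisms.LeftModuleMorphisms
  field
    f             : A.Carrierᴹ → B.Carrierᴹ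
    g             : B.Carrierᴹ → C.Carrierᴹ
    f-linear      : IsLeftModuleHomomorphism A.rawLeftModule B.rawLeftModule f
    g-linear      : IsLeftModuleHomomorphism B.rawLeftModule C.rawLeftModule g
    f-equivariant : ∀ a w → f (a A.· w) B.≈ᴹ f a B.· w
    g-equivariant : ∀ b w → g (b B.· w) C.≈ᴹ g b C.· w
    f-injective   : Injective A._≈ᴹ_ B._≈ᴹ_ f
    g-surjective  : StrictlySurjective C._≈ᴹ_ g
    im⊆ker        : ∀ a → g (f a) C.≈ᴹ C.0ᴹ
    ker⊆im        : ∀ b → g b C.≈ᴹ C.0ᴹ → ∃[ a ] f a B.≈ᴹ b

infix 4 _~_
infixl 6 _⊕_
infixl 7 _⊛_
infix 8 ⊝_

data Virtual (n : ℕ) : Set₁ where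
  [_]     : Rep n → Virtual n
  _⊕_ _⊛_ : Virtual n → Virtual n → Virtual n
  ⊝_      : Virtual n → Virtual n
  𝟘 𝟙     : Virtual n

-- The least commutative-ring congruence with [B] = [A] + [C] for short exact
-- sequences, [V][W] = [V ⊗ W] and 1 = [trivial].  The last two make every
-- element additively generated by classes of modules, so this is the
-- Grothendieck group with its tensor product.
data _~_ {n : ℕ} : Virtual n → Virtual n → Set₁ where
  exact      : ∀ {A B C} → ShortExact A B C → [ B ] ~ [ A ] ⊕ [ C ]
  tensor     : ∀ V W → [ V ] ⊛ [ W ] ~ [ V ⊗ᴿ W ]
  unit       : 𝟙 ~ [ trivial n ]
  refl       : ∀ {x} → x ~ x
  sym        : ∀ {x y} → x ~ y → y ~ x
  trans      : ∀ {x y z} → x ~ y → y ~ z → x ~ z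
  ⊕-cong     : ∀ {x x′ y y′} → x ~ x′ → y ~ y′ → x ⊕ y ~ x′ ⊕ y′
  ⊛-cong     : ∀ {x x′ y y′} → x ~ x′ → y ~ y′ → x ⊛ y ~ x′ ⊛ y′
  ⊝-cong     : ∀ {x x′} → x ~ x′ → ⊝ x ~ ⊝ x′
  ⊕-assoc    : ∀ x y z → (x ⊕ y) ⊕ z ~ x ⊕ (y ⊕ z)
  ⊕-comm     : ∀ x y → x ⊕ y ~ y ⊕ x
  ⊕-identity : ∀ x → 𝟘 ⊕ x ~ x
  ⊕-inverse  : ∀ x → ⊝ x ⊕ x ~ 𝟘
  ⊛-assoc    : ∀ x y z → (x ⊛ y) ⊛ z ~ x ⊛ (y ⊛ z)
  ⊛-comm     : ∀ x y → x ⊛ y ~ y ⊛ x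
  ⊛-identity : ∀ x → 𝟙 ⊛ x ~ x
  distrib    : ∀ x y z → x ⊛ (y ⊕ z) ~ x ⊛ y ⊕ x ⊛ z

R[𝔖_] : ℕ → CommutativeRing (lsuc 0ℓ) (lsuc 0ℓ)
R[𝔖 n ] = record
  { Carrier = Virtual n
  ; _≈_ = _~_
  ; _+_ = _⊕_
  ; _*_ = _⊛_
  ; -_ = ⊝_
  ; 0# = 𝟘
  ; 1# = 𝟙
  ; isCommutativeRing = record
    { isRing = record
      { +-isAbelianGroup = record
        { isGroup = record
          { isMonoid = record
            { isSemigroup = record
              { isMagma = record
                { isEquivalence = record { refl = refl ; sym = sym ; trans = trans }
                ; ∙-cong = ⊕-cong }
              ; assoc = ⊕-assoc }
            ; identity = ⊕-identity , (λ x → trans (⊕-comm _ _) (⊕-identity x)) }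
          ; inverse = ⊕-inverse , (λ x → trans (⊕-comm _ _) (⊕-inverse x))
          ; ⁻¹-cong = ⊝-cong }
        ; comm = ⊕-comm }
      ; *-cong = ⊛-cong
      ; *-assoc = ⊛-assoc
      ; *-identity = ⊛-identity , (λ x → trans (⊛-comm _ _) (⊛-identity x))
      ; distrib = distrib , λ x y z → trans (⊛-comm _ _)
          (trans (distrib x y z) (⊕-cong (⊛-comm _ _) (⊛-comm _ _))) }
    ; *-comm = ⊛-comm } }

module _ {a ℓ} (R : CommutativeRing a ℓ) where
  open CommutativeRing R
  open RawMonoidDefs +-rawMonoid using () renaming (sum to ∑)

  infix 8 monomial

  monomial : Carrier → ℕ → ℕ → Carrier
  monomial x k i = if does (i ℕₚ.≟ k) then x else 0#

  syntax monomial R x k = x t^[ R ] k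

  _⟦t⟧ : RawRing a ℓ
  _⟦t⟧ = record
    { Carrier = ℕ → Carrier
    ; _≈_ = λ f g → ∀ k → f k ≈ g k
    ; _+_ = λ f g k → f k + g k
    ; _*_ = λ f g k → ∑ {suc k} (λ i → f (toℕ i) * g (k ∸ toℕ i))
    ; -_ = λ f k → - f k
    ; 0# = λ _ → 0#
    ; 1# = monomial 1# 0
    }

-- w₁ < ⋯ < wᵢ and wᵢ₊₁ < ⋯ < wₙ; the k-th position is the element k−1 of Fin n.
IsShuffle : ∀ {n} → ℕ → Perm n → Set
IsShuffle i w =
  (∀ p q → p Fin.< q → toℕ q < i → (w ⟨$⟩ʳ p) Fin.< (w ⟨$⟩ʳ q)) ×
  (∀ p q → p Fin.< q → i ≤ toℕ p → (w ⟨$⟩ʳ p) Fin.< (w ⟨$⟩ʳ q))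

isShuffle? : ∀ {n} i (w : Perm n) → Dec (IsShuffle i w)
isShuffle? i w =
  Finₚ.all? (λ p → Finₚ.all? λ q → (p Finₚ.<? q) →-dec ((toℕ q ℕₚ.<? i) →-dec ((w ⟨$⟩ʳ p) Finₚ.<? (w ⟨$⟩ʳ q))))
  ×-dec
  Finₚ.all? (λ p → Finₚ.all? λ q → (p Finₚ.<? q) →-dec ((i ℕₚ.≤? toℕ p) →-dec ((w ⟨$⟩ʳ p) Finₚ.<? (w ⟨$⟩ʳ q))))

-- s_{i,n-i}
signedShuffles : ∀ n → ℕ → ℚ[𝔖 n ]
signedShuffles n i =
  foldr _+ᴱ_ 0ᴱ (map (λ w → sgn w *ᴱ gen w) (filter (isShuffle? i) (allPerms n)))

s : ∀ n → ℚ[𝔖 n ]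
s n = ∑₁ (LeftModule.+ᴹ-rawMonoid (ℚ𝔖 n)) (n ∸ 1) (signedShuffles n)

-- p(x), coefficients listed from the constant term.
evaluate : ∀ {n} → List ℚ → ℚ[𝔖 n ] → ℚ[𝔖 n ]
evaluate []      x = 0ᴱ
evaluate (a ∷ p) x = a *ᴱ gen Perm.id +ᴱ x *ₐ evaluate p x

eigenvalue : ℕ → ℚ
eigenvalue j = (2ℚ ^ℚ j) ℚ.- 2ℚ

InEigenspace : ∀ n → ℕ → ℚ[𝔖 n ] → Set
InEigenspace n j x = s n *ₐ x ≈ₐ eigenvalue j *ᴱ x

-- e is a polynomial in sₙ, and left multiplication by e is a projection onto the
-- (2ʲ − 2)-eigenspace of left multiplication by sₙ.  As sₙ is semisimple, this
-- determines e.
record IsEulerianIdempotent (n j : ℕ) (e : ℚ[𝔖 n ]) : Set where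
  field
    polynomial : ∃[ p ] e ≈ₐ evaluate p (s n)
    into       : ∀ x → InEigenspace n j (e *ₐ x)
    fixes      : ∀ x → InEigenspace n j x → e *ₐ x ≈ₐ x

Λ : ∀ m → ℚ[𝔖 suc m ]
Λ m = RawMonoidDefs.sum (LeftModule.+ᴹ-rawMonoid (ℚ𝔖 (suc m))) {suc m}
  (λ i → (sgn (cycle m) ^ℚ toℕ i) *ᴱ gen (cycle m ^ₚ toℕ i))

E : ∀ {n} → ℚ[𝔖 n ] → Rep n
E e = rightIdeal e

F : ∀ {m} → ℚ[𝔖 m ] → Rep (suc m)
F {m} e = rightIdeal (Λ m *ₐ ιₐ e)

{-# OPTIONS --safe #-}
-- Comparing coefficients of t^(n−j), and using the class identity [ind E′ⱼ] = (1 + V)[Fⱼ], the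
-- series identity becomes Eⱼ = Fⱼ₋₁ + ind E′ⱼ − Fⱼ for 1 ≤ j ≤ n−1 (with F₀ = 0), which
-- telescopes to the partial sums, together with Eₙ = Fₙ₋₁.  Both class identities hold
-- unconditionally.
--
-- * Untwisted by the sign, sₙ₋₁ has coefficients depending only on the number of descents.  In 𝔖ₙ
--   this is one less than the number of cyclic descents, which is invariant under multiplication by
--   the cycle c on either side; as 𝔖ₙ = ⟨c⟩𝔖ₙ₋₁ = 𝔖ₙ₋₁⟨c⟩, Λ commutes with sₙ₋₁ and hence with e′ⱼ.
--   Therefore Fⱼ = Λ e′ⱼ ℚ𝔖ₙ₋₁ restricts to E′ⱼ, and ind E′ⱼ = ind res Fⱼ = Fⱼ ⊗ (1 + V).
-- * Untwisted by the sign, sₙ has nonnegative coefficients of total 2ⁿ − 2, so by the maximum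
--   principle its (2ⁿ − 2)-eigenspace is spanned by ε = Σ sgn(w) w.  Both Eₙ and Fₙ₋₁ equal ℚε.

module Submission where

open import Defs
open import Algebra.Bundles using (CommutativeMonoid; CommutativeRing; RawRing; Ring)
open import Algebra.Module.Bundles using (LeftModule)
open import Algebra.Module.Construct.TensorUnit using () renaming (leftModule to ⟨ring⟩)
import Algebra.Definitions.RawMonoid as RawMonoidDefs
import Algebra.Module.Morphism.Structures as ModuleMorphisms
import Algebra.Properties.AbelianGroup as AbelianGroupProperties
import Algebra.Properties.CommutativeMonoid.Sum as MonoidSum
import Algebra.Properties.CommutativeSemigroup as CommutativeSemigroupProperties
import Algebra.Properties.Semiring.Sum as SemiringSum
open import Data.Bool.Base using (true; false; if_then_else_)
open import Data.Empty using (⊥)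
open import Data.Fin.Base as Fin using (Fin; zero; suc; toℕ; fromℕ; inject₁; punchIn)
import Data.Fin.Properties as Finₚ
open import Data.Fin.Permutation as Perm
  using (_⟨$⟩ʳ_; _⟨$⟩ˡ_; insert; remove; insert-remove; insert-punchIn; remove-insert; lift₀)
open import Data.List.Base
  using (List; []; _∷_; map; foldr; length; filter; allFin; tabulate; cartesianProduct; cartesianProductWith; _++_)
open import Data.List.Relation.Unary.All as All using (All)
open import Data.List.Relation.Unary.Any as Any using (Any; here; there)
open import Data.Nat using (ℕ; zero; suc; _∸_; _≤_; _<_; z≤n; s≤s)
import Data.Nat.Base as ℕ
import Data.Nat.Properties as ℕₚ
open import Data.Product.Base using (∃-syntax; _×_; _,_; proj₁; proj₂)
open import Data.Rational.Base as ℚ using (ℚ; 0ℚ; 1ℚ)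
import Data.Rational.Properties as ℚₚ
open import Data.Sum.Base using (_⊎_; inj₁; inj₂)
open import Function.Base using (_∘_)
open import Function.Bundles using (_⇔_; mk⇔)
open import Level using (0ℓ)
import Relation.Binary.Reasoning.Setoid as SetoidReasoning
open import Relation.Binary.Bundles using (DecTotalOrder)
open import Relation.Binary.PropositionalEquality as ≡ using (_≡_; _≢_)
open import Relation.Binary.Definitions using (Tri; tri<; tri≈; tri>)
open import Relation.Nullary using (Dec; yes; no; does; ¬_)
open import Relation.Nullary.Decidable using (_×-dec_; _→-dec_; dec-true; dec-false)
open import Relation.Nullary.Negation using (contradiction)

-- Linear maps and finite sums

-- Equality in ℚ𝔖ₙ, in tensor products and in the representation ring is a generated congruence, so
-- nothing can be cancelled or told apart by inspection. In ℚ𝔖ₙ this is overcome by the functionals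
-- `coeff u`, which respect the congruence and separate elements. In the induced module and in V ⊗ F
-- the same role is played by explicit component maps into copies of F, together with maps that
-- reassemble an element from its components; injectivity and the kernel condition are read off from
-- these. The ring knows modules through short exact sequences. Hence ind E′ = (1 + V) F is proved
-- as an exact sequence V ⊗ F → ind E′ → F, and equal right ideals get equal classes through a
-- sequence ending in the zero module. The idempotents are known by their defining properties alone.
-- Commutation with Λ comes from `polynomial`; the description of the top eigenspace from `into` and
-- `fixes`. The scalar between a top idempotent and ε is never evaluated: `fixes` already shows that
-- it is invertible.

module ListSum {a ℓ} (M : CommutativeMonoid a ℓ) where
  open CommutativeMonoid M renaming (_∙_ to _+_; ε to 0#; refl to ≈-refl; sym to ≈-sym; trans to ≈-trans)
  open MonoidSum M using (sum)
  open CommutativeSemigroupProperties commutativeSemigroup using (interchange)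

  ∑ᴸ : ∀ {b} {B : Set b} → List B → (B → Carrier) → Carrier
  ∑ᴸ xs f = foldr (λ x s → f x + s) 0# xs

  module _ {b} {B : Set b} where

    ∑ᴸ-cong : ∀ (xs : List B) {f g : B → Carrier} → (∀ x → f x ≈ g x) → ∑ᴸ xs f ≈ ∑ᴸ xs g
    ∑ᴸ-cong []       p = ≈-refl
    ∑ᴸ-cong (x ∷ xs) p = ∙-cong (p x) (∑ᴸ-cong xs p)

    ∑ᴸ-zero : ∀ (xs : List B) → ∑ᴸ xs (λ _ → 0#) ≈ 0#
    ∑ᴸ-zero []       = ≈-refl
    ∑ᴸ-zero (x ∷ xs) = ≈-trans (identityˡ _) (∑ᴸ-zero xs)

    ∑ᴸ-+ : ∀ (xs : List B) (f g : B → Carrier) → ∑ᴸ xs (λ x → f x + g x) ≈ ∑ᴸ xs f + ∑ᴸ xs g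
    ∑ᴸ-+ []       f g = ≈-sym (identityˡ _)
    ∑ᴸ-+ (x ∷ xs) f g = ≈-trans (∙-congˡ (∑ᴸ-+ xs f g)) (interchange _ _ _ _)

    ∑ᴸ-++ : ∀ (xs ys : List B) (f : B → Carrier) → ∑ᴸ (xs ++ ys) f ≈ ∑ᴸ xs f + ∑ᴸ ys f
    ∑ᴸ-++ []       ys f = ≈-sym (identityˡ _)
    ∑ᴸ-++ (x ∷ xs) ys f = ≈-trans (∙-congˡ (∑ᴸ-++ xs ys f)) (≈-sym (assoc _ _ _))

    ∑ᴸ-sum : ∀ (xs : List B) {n} (f : B → Fin n → Carrier) →
             ∑ᴸ xs (λ x → sum (f x)) ≈ sum (λ i → ∑ᴸ xs (λ x → f x i))
    ∑ᴸ-sum xs {zero}  f = ∑ᴸ-zero xs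
    ∑ᴸ-sum xs {suc n} f = ≈-trans (∑ᴸ-+ xs _ _) (∙-congˡ (∑ᴸ-sum xs (λ x i → f x (suc i))))

  ∑ᴸ-map : ∀ {b c} {B : Set b} {C : Set c} (g : B → C) xs (f : C → Carrier) →
           ∑ᴸ (map g xs) f ≡ ∑ᴸ xs (f ∘ g)
  ∑ᴸ-map g []       f = ≡.refl
  ∑ᴸ-map g (x ∷ xs) f = ≡.cong (f (g x) +_) (∑ᴸ-map g xs f)

  ∑ᴸ-tabulate : ∀ {b} {B : Set b} {n} (g : Fin n → B) (f : B → Carrier) →
                ∑ᴸ (tabulate g) f ≡ sum (λ i → f (g i))
  ∑ᴸ-tabulate {n = zero}  g f = ≡.refl
  ∑ᴸ-tabulate {n = suc n} g f = ≡.cong (f (g zero) +_) (∑ᴸ-tabulate (g ∘ suc) f)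

  ∑ᴸ-product : ∀ {b c d} {B : Set b} {C : Set c} {D : Set d} (g : B → C → D) xs ys (f : D → Carrier) →
               ∑ᴸ (cartesianProductWith g xs ys) f ≈ ∑ᴸ xs (λ x → ∑ᴸ ys (λ y → f (g x y)))
  ∑ᴸ-product g []       ys f = ≈-refl
  ∑ᴸ-product g (x ∷ xs) ys f =
    ≈-trans (∑ᴸ-++ (map (g x) ys) _ f)
          (∙-cong (reflexive (∑ᴸ-map (g x) ys f)) (∑ᴸ-product g xs ys f))

  ∑ᴸ-allPerms : ∀ n (f : Perm (suc n) → Carrier) →
                ∑ᴸ (allPerms (suc n)) f ≈ sum (λ j → ∑ᴸ (allPerms n) (λ w → f (insert zero j w)))
  ∑ᴸ-allPerms n f = ≈-trans (∑ᴸ-product (insert zero) (allFin (suc n)) (allPerms n) f)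
    (reflexive (∑ᴸ-tabulate {n = suc n} (λ j → j) (λ j → ∑ᴸ (allPerms n) (λ w → f (insert zero j w)))))

ℚ-ring : Ring 0ℓ 0ℓ
ℚ-ring = ℚₚ.+-*-ring

ℚᵥ : VectorSpace
ℚᵥ = ⟨ring⟩

open SemiringSum (Ring.semiring ℚ-ring)
  using (sum; sum-cong-≗; ∑-distrib-+; *-distribˡ-sum; *-distribʳ-sum; sum-permute; sum-replicate-zero; sum-init-last)
module ℚ∑ = ListSum (Ring.+-commutativeMonoid ℚ-ring)
open ℚ∑ using (∑ᴸ; ∑ᴸ-cong; ∑ᴸ-+; ∑ᴸ-sum; ∑ᴸ-allPerms)

indicator : ∀ {p} {P : Set p} → Dec P → ℚ
indicator P? = if does P? then 1ℚ else 0ℚ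

module _ {p} {P : Set p} where

  indicator-yes : (P? : Dec P) → P → indicator P? ≡ 1ℚ
  indicator-yes P? x = ≡.cong (if_then 1ℚ else 0ℚ) (dec-true P? x)

  indicator-no : (P? : Dec P) → ¬ P → indicator P? ≡ 0ℚ
  indicator-no P? x = ≡.cong (if_then 1ℚ else 0ℚ) (dec-false P? x)

  indicator-⇔ : ∀ {q} {Q : Set q} (P? : Dec P) (Q? : Dec Q) → (P → Q) → (Q → P) →
                indicator P? ≡ indicator Q?
  indicator-⇔ P? (yes q) f g = indicator-yes P? (g q)
  indicator-⇔ P? (no ¬q) f g = indicator-no P? (λ p → ¬q (f p))

  indicator-× : ∀ {q} {Q : Set q} (P? : Dec P) (Q? : Dec Q) →
                indicator (P? ×-dec Q?) ≡ indicator P? ℚ.* indicator Q?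
  indicator-× (yes _) (yes _) = ≡.refl
  indicator-× (yes _) (no _)  = ≡.refl
  indicator-× (no _)  Q?      = ≡.sym (ℚₚ.*-zeroˡ (indicator Q?))

  indicator-*-cong : ∀ (P? : Dec P) {a b} → (P → a ≡ b) → indicator P? ℚ.* a ≡ indicator P? ℚ.* b
  indicator-*-cong (yes x) e = ≡.cong (1ℚ ℚ.*_) (e x)
  indicator-*-cong (no _) {a} {b} e = ≡.trans (ℚₚ.*-zeroˡ a) (≡.sym (ℚₚ.*-zeroˡ b))

sum-indicator-≟ : ∀ {n} (i : Fin n) (f : Fin n → ℚ) →
                  sum (λ j → indicator (i Finₚ.≟ j) ℚ.* f j) ≡ f i
sum-indicator-≟ {suc n} zero f = ≡.trans
  (≡.cong₂ ℚ._+_ (ℚₚ.*-identityˡ (f zero))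
    (≡.trans (sum-cong-≗ (λ j → ℚₚ.*-zeroˡ (f (suc j)))) (sum-replicate-zero n)))
  (ℚₚ.+-identityʳ (f zero))
sum-indicator-≟ {suc n} (suc i) f = ≡.trans
  (≡.cong₂ ℚ._+_ (ℚₚ.*-zeroˡ (f zero))
    (≡.trans (sum-cong-≗ (λ j → ≡.cong (ℚ._* f (suc j)) (indicator-⇔ (suc i Finₚ.≟ suc j) (i Finₚ.≟ j) Finₚ.suc-injective (≡.cong suc))))
      (sum-indicator-≟ i (f ∘ suc))))
  (ℚₚ.+-identityˡ (f (suc i)))

module _ (V : VectorSpace) where
  open LeftModule V
  open AbelianGroupProperties +ᴹ-abelianGroup using (⁻¹-∙-comm; ε⁻¹≈ε)
  open CommutativeSemigroupProperties
    (CommutativeMonoid.commutativeSemigroup +ᴹ-commutativeMonoid) using (interchange)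

  ∑ⱽ : ∀ {b} {B : Set b} → List B → (B → Carrierᴹ) → Carrierᴹ
  ∑ⱽ = ListSum.∑ᴸ +ᴹ-commutativeMonoid

  ∑ⱽ-*ᵣ : ∀ {b} {B : Set b} (xs : List B) (c : B → ℚ) v → ∑ⱽ xs (λ x → c x *ₗ v) ≈ᴹ ∑ᴸ xs c *ₗ v
  ∑ⱽ-*ᵣ []       c v = ≈ᴹ-sym (*ₗ-zeroˡ v)
  ∑ⱽ-*ᵣ (x ∷ xs) c v = ≈ᴹ-trans (+ᴹ-cong ≈ᴹ-refl (∑ⱽ-*ᵣ xs c v)) (≈ᴹ-sym (*ₗ-distribʳ v _ _))

  indicator-*ₗ-cong : ∀ {p} {P : Set p} (P? : Dec P) {v w} → (P → v ≈ᴹ w) →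
                      indicator P? *ₗ v ≈ᴹ indicator P? *ₗ w
  indicator-*ₗ-cong (yes x) e = *ₗ-cong ≡.refl (e x)
  indicator-*ₗ-cong (no _)  e = ≈ᴹ-trans (*ₗ-zeroˡ _) (≈ᴹ-sym (*ₗ-zeroˡ _))

  *ₗ-swap : ∀ p q v → p *ₗ (q *ₗ v) ≈ᴹ q *ₗ (p *ₗ v)
  *ₗ-swap p q v = ≈ᴹ-trans (≈ᴹ-sym (*ₗ-assoc p q v))
    (≈ᴹ-trans (*ₗ-cong (ℚₚ.*-comm p q) ≈ᴹ-refl) (*ₗ-assoc q p v))

  *ₗ-neg : ∀ q v → q *ₗ (-ᴹ v) ≈ᴹ -ᴹ (q *ₗ v)
  *ₗ-neg q v = ≈ᴹ-trans (*ₗ-cong ≡.refl (≈ᴹ-sym (neg-one V v)))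
    (≈ᴹ-trans (*ₗ-swap q _ v) (neg-one V _))

  module _ {G : Set} where

    -- Linearity on raw expressions, with no compatibility with a relation demanded. By structural
    -- induction (`linear-ext`) two such maps agree as soon as they agree on generators, so
    -- identities in ℚ𝔖ₙ and in tensor products are checked on permutations and pure tensors.
    record Linear (φ : Expr G → Carrierᴹ) : Set where
      field
        0-homo : φ 0ᴱ ≈ᴹ 0ᴹ
        +-homo : ∀ x y → φ (x +ᴱ y) ≈ᴹ φ x +ᴹ φ y
        -‿homo : ∀ x → φ (-ᴱ x) ≈ᴹ -ᴹ φ x
        *-homo : ∀ q x → φ (q *ᴱ x) ≈ᴹ q *ₗ φ x

    linear-ext : ∀ {φ ψ} → Linear φ → Linear ψ → (∀ a → φ (gen a) ≈ᴹ ψ (gen a)) → ∀ x → φ x ≈ᴹ ψ x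
    linear-ext {φ} {ψ} L L′ e = go
      where
      module L = Linear L
      module L′ = Linear L′
      go : ∀ x → φ x ≈ᴹ ψ x
      go (gen a)  = e a
      go 0ᴱ       = ≈ᴹ-trans L.0-homo (≈ᴹ-sym L′.0-homo)
      go (x +ᴱ y) = ≈ᴹ-trans (L.+-homo x y) (≈ᴹ-trans (+ᴹ-cong (go x) (go y)) (≈ᴹ-sym (L′.+-homo x y)))
      go (-ᴱ x)   = ≈ᴹ-trans (L.-‿homo x) (≈ᴹ-trans (-ᴹ‿cong (go x)) (≈ᴹ-sym (L′.-‿homo x)))
      go (q *ᴱ x) = ≈ᴹ-trans (L.*-homo q x) (≈ᴹ-trans (*ₗ-cong ≡.refl (go x)) (≈ᴹ-sym (L′.*-homo q x)))

    linear-zero : Linear (λ _ → 0ᴹ)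
    linear-zero = record
      { 0-homo = ≈ᴹ-refl
      ; +-homo = λ _ _ → ≈ᴹ-sym (+ᴹ-identityˡ 0ᴹ)
      ; -‿homo = λ _ → ≈ᴹ-sym ε⁻¹≈ε
      ; *-homo = λ q _ → ≈ᴹ-sym (*ₗ-zeroʳ q)
      }

    linear-+ : ∀ {φ ψ} → Linear φ → Linear ψ → Linear (λ x → φ x +ᴹ ψ x)
    linear-+ L L′ = record
      { 0-homo = ≈ᴹ-trans (+ᴹ-cong L.0-homo L′.0-homo) (+ᴹ-identityˡ 0ᴹ)
      ; +-homo = λ x y → ≈ᴹ-trans (+ᴹ-cong (L.+-homo x y) (L′.+-homo x y)) (interchange _ _ _ _)
      ; -‿homo = λ x → ≈ᴹ-trans (+ᴹ-cong (L.-‿homo x) (L′.-‿homo x)) (⁻¹-∙-comm _ _)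
      ; *-homo = λ q x → ≈ᴹ-trans (+ᴹ-cong (L.*-homo q x) (L′.*-homo q x)) (≈ᴹ-sym (*ₗ-distribˡ q _ _))
      }
      where
      module L = Linear L
      module L′ = Linear L′

    linear-* : ∀ {φ} p → Linear φ → Linear (λ x → p *ₗ φ x)
    linear-* p L = record
      { 0-homo = ≈ᴹ-trans (*ₗ-cong ≡.refl L.0-homo) (*ₗ-zeroʳ p)
      ; +-homo = λ x y → ≈ᴹ-trans (*ₗ-cong ≡.refl (L.+-homo x y)) (*ₗ-distribˡ p _ _)
      ; -‿homo = λ x → ≈ᴹ-trans (*ₗ-cong ≡.refl (L.-‿homo x)) (*ₗ-neg p _)
      ; *-homo = λ q x → ≈ᴹ-trans (*ₗ-cong ≡.refl (L.*-homo q x)) (*ₗ-swap p q _)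
      }
      where module L = Linear L

    linear-neg : ∀ {φ} → Linear φ → Linear (λ x → -ᴹ φ x)
    linear-neg L = record
      { 0-homo = ≈ᴹ-trans (-ᴹ‿cong L.0-homo) ε⁻¹≈ε
      ; +-homo = λ x y → ≈ᴹ-trans (-ᴹ‿cong (L.+-homo x y)) (≈ᴹ-sym (⁻¹-∙-comm _ _))
      ; -‿homo = λ x → -ᴹ‿cong (L.-‿homo x)
      ; *-homo = λ q x → ≈ᴹ-trans (-ᴹ‿cong (L.*-homo q x)) (≈ᴹ-sym (*ₗ-neg q _))
      }
      where module L = Linear L

    linear-∑ⱽ : ∀ {b} {B : Set b} (xs : List B) {φ : B → Expr G → Carrierᴹ} →
                (∀ i → Linear (φ i)) → Linear (λ x → ∑ⱽ xs (λ i → φ i x))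
    linear-∑ⱽ []       L = linear-zero
    linear-∑ⱽ (i ∷ xs) L = linear-+ (L i) (linear-∑ⱽ xs L)

    fold : (G → Carrierᴹ) → Expr G → Carrierᴹ
    fold f (gen a)  = f a
    fold f 0ᴱ       = 0ᴹ
    fold f (x +ᴱ y) = fold f x +ᴹ fold f y
    fold f (-ᴱ x)   = -ᴹ fold f x
    fold f (q *ᴱ x) = q *ₗ fold f x

    fold-linear : ∀ f → Linear (fold f)
    fold-linear f = record
      { 0-homo = ≈ᴹ-refl
      ; +-homo = λ _ _ → ≈ᴹ-refl
      ; -‿homo = λ _ → ≈ᴹ-refl
      ; *-homo = λ _ _ → ≈ᴹ-refl
      }

    -- The universal property of a presented space: `Eq R` is generated by `R` and the vector space
    -- axioms, and the target satisfies the axioms.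
    fold-cong : ∀ {R : Expr G → Expr G → Set} {f} → (∀ {x y} → R x y → fold f x ≈ᴹ fold f y) →
                ∀ {x y} → Eq R x y → fold f x ≈ᴹ fold f y
    fold-cong r (rel p) = r p
    fold-cong r refl = ≈ᴹ-refl
    fold-cong r (sym p) = ≈ᴹ-sym (fold-cong r p)
    fold-cong r (trans p q) = ≈ᴹ-trans (fold-cong r p) (fold-cong r q)
    fold-cong r (+-cong p q) = +ᴹ-cong (fold-cong r p) (fold-cong r q)
    fold-cong r (neg-cong p) = -ᴹ‿cong (fold-cong r p)
    fold-cong r (*-cong q p) = *ₗ-cong ≡.refl (fold-cong r p)
    fold-cong r (+-assoc x y z) = +ᴹ-assoc _ _ _
    fold-cong r (+-comm x y) = +ᴹ-comm _ _
    fold-cong r (+-identity x) = +ᴹ-identityˡ _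
    fold-cong r (+-inverse x) = -ᴹ‿inverseˡ _
    fold-cong r (*-zeroˡ x) = *ₗ-zeroˡ _
    fold-cong r (*-zeroʳ q) = *ₗ-zeroʳ q
    fold-cong r (*-distribˡ q x y) = *ₗ-distribˡ q _ _
    fold-cong r (*-distribʳ x p q) = *ₗ-distribʳ _ p q
    fold-cong r (*-assoc p q x) = *ₗ-assoc p q _
    fold-cong r (*-identity x) = *ₗ-identityˡ _

extend-linear : ∀ {G H : Set} {R : Expr H → Expr H → Set} (f : G → Expr H) →
                Linear (presented H R) (extend f)
extend-linear f = record
  { 0-homo = refl
  ; +-homo = λ _ _ → refl
  ; -‿homo = λ _ → refl
  ; *-homo = λ _ _ → refl
  }

linear-∘-extend : ∀ {G H : Set} (V : VectorSpace) {φ : Expr H → LeftModule.Carrierᴹ V} (f : G → Expr H) →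
                  Linear V φ → Linear V (λ x → φ (extend f x))
linear-∘-extend V f L = record
  { 0-homo = 0-homo
  ; +-homo = λ _ _ → +-homo _ _
  ; -‿homo = λ _ → -‿homo _
  ; *-homo = λ q _ → *-homo q _
  }
  where open Linear L

-- Coefficients in the group algebra

_⁻¹ : ∀ {n} → Perm n → Perm n
_⁻¹ = Perm.flip

infix 9 _⁻¹

infix 4 _≟ₚ_

_≟ₚ_ : ∀ {n} (u w : Perm n) → Dec (u Perm.≈ w)
u ≟ₚ w = Finₚ.all? (λ i → (u ⟨$⟩ʳ i) Finₚ.≟ (w ⟨$⟩ʳ i))

module _ {n : ℕ} where

  ≈ₚ-sym : {u w : Perm n} → u Perm.≈ w → w Perm.≈ u
  ≈ₚ-sym p i = ≡.sym (p i)

  ≈ₚ-trans : {u v w : Perm n} → u Perm.≈ v → v Perm.≈ w → u Perm.≈ w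
  ≈ₚ-trans p q i = ≡.trans (p i) (q i)

  ⁻¹-∙-cancel : (u w : Perm n) → (u ⁻¹ ∙ (u ∙ w)) Perm.≈ w
  ⁻¹-∙-cancel u w i = Perm.inverseˡ u

  ∙-⁻¹-cancel : (u w : Perm n) → (u ∙ (u ⁻¹ ∙ w)) Perm.≈ w
  ∙-⁻¹-cancel u w i = Perm.inverseʳ u

  ∙-moveˡ : (u : Perm n) {v w : Perm n} → (u ∙ v) Perm.≈ w → v Perm.≈ (u ⁻¹ ∙ w)
  ∙-moveˡ u p i = ≡.trans (≡.sym (Perm.inverseˡ u)) (≡.cong (u ⟨$⟩ˡ_) (p i))

  ∙-moveʳ : (u : Perm n) {v w : Perm n} → (v ∙ u) Perm.≈ w → v Perm.≈ (w ∙ u ⁻¹)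
  ∙-moveʳ u {v} p i = ≡.trans (≡.cong (v ⟨$⟩ʳ_) (≡.sym (Perm.inverseʳ u))) (p (u ⟨$⟩ˡ i))

  perm-injective : (u : Perm n) {i j : Fin n} → u ⟨$⟩ʳ i ≡ u ⟨$⟩ʳ j → i ≡ j
  perm-injective u {i} {j} p =
    ≡.trans (≡.sym (Perm.inverseˡ u)) (≡.trans (≡.cong (u ⟨$⟩ˡ_) p) (Perm.inverseˡ u))

∑-*ˡ : ∀ {B : Set} (xs : List B) q (f : B → ℚ) → ∑ᴸ xs (λ x → q ℚ.* f x) ≡ q ℚ.* ∑ᴸ xs f
∑-*ˡ []       q f = ≡.sym (ℚₚ.*-zeroʳ q)
∑-*ˡ (x ∷ xs) q f = ≡.trans (≡.cong (q ℚ.* f x ℚ.+_) (∑-*ˡ xs q f)) (≡.sym (ℚₚ.*-distribˡ-+ q _ _))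

-- Completeness of `allPerms n` gives at least one match; a sum over the list selects a single term
-- because the match is also unique. A match of `u` with `insert zero j w` fixes `j` as the image of
-- `zero` and `w` as what remains.
∑-indicator-≟ₚ : ∀ {n} (u : Perm n) → ∑ᴸ (allPerms n) (λ w → indicator (u ≟ₚ w)) ≡ 1ℚ
∑-indicator-≟ₚ {zero}  u = ≡.refl
∑-indicator-≟ₚ {suc n} u = begin
  ∑ᴸ (allPerms (suc n)) (λ w → indicator (u ≟ₚ w))
    ≡⟨ ∑ᴸ-allPerms n (λ w → indicator (u ≟ₚ w)) ⟩
  sum (λ j → ∑ᴸ (allPerms n) (λ w → indicator (u ≟ₚ insert zero j w)))
    ≡⟨ sum-cong-≗ (λ j → ∑ᴸ-cong (allPerms n) (λ w → split j w)) ⟩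
  sum (λ j → ∑ᴸ (allPerms n) (λ w → indicator (u₀ Finₚ.≟ j) ℚ.* indicator (u′ ≟ₚ w)))
    ≡⟨ sum-cong-≗ (λ j → ∑-*ˡ (allPerms n) (indicator (u₀ Finₚ.≟ j)) (λ w → indicator (u′ ≟ₚ w))) ⟩
  sum (λ j → indicator (u₀ Finₚ.≟ j) ℚ.* ∑ᴸ (allPerms n) (λ w → indicator (u′ ≟ₚ w)))
    ≡⟨ sum-indicator-≟ u₀ (λ _ → ∑ᴸ (allPerms n) (λ w → indicator (u′ ≟ₚ w))) ⟩
  ∑ᴸ (allPerms n) (λ w → indicator (u′ ≟ₚ w))
    ≡⟨ ∑-indicator-≟ₚ u′ ⟩
  1ℚ ∎
  where
  open ≡.≡-Reasoning

  u₀ : Fin (suc n)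
  u₀ = u ⟨$⟩ʳ zero

  u′ : Perm n
  u′ = remove zero u

  remove-cong : ∀ {u w : Perm (suc n)} → u Perm.≈ w → remove zero u Perm.≈ remove zero w
  remove-cong {u} {w} p i = Finₚ.punchIn-injective (w ⟨$⟩ʳ zero) _ _ (≡.trans
    (≡.cong (λ j → punchIn j (remove zero u ⟨$⟩ʳ i)) (≡.sym (p zero)))
    (≡.trans (≡.sym (Perm.punchIn-permute u zero i))
      (≡.trans (p (suc i)) (Perm.punchIn-permute w zero i))))

  split : ∀ j w → indicator (u ≟ₚ insert zero j w) ≡ indicator (u₀ Finₚ.≟ j) ℚ.* indicator (u′ ≟ₚ w)
  split j w = ≡.trans
    (indicator-⇔ (u ≟ₚ insert zero j w) ((u₀ Finₚ.≟ j) ×-dec (u′ ≟ₚ w))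
      (λ p → p zero , λ i → ≡.trans (remove-cong {u} {insert zero j w} p i) (remove-insert zero j w i))
      (λ { (≡.refl , q) i → ≡.trans (≡.sym (insert-remove zero u i)) (insert-cong zero u₀ q i) }))
    (indicator-× (u₀ Finₚ.≟ j) (u′ ≟ₚ w))

coeff : ∀ {n} → Perm n → ℚ[𝔖 n ] → ℚ
coeff u = fold ℚᵥ (λ w → indicator (w ≟ₚ u))

coeff-linear : ∀ {n} (u : Perm n) → Linear ℚᵥ (coeff u)
coeff-linear u = fold-linear ℚᵥ _

coeff-cong : ∀ {n} (u : Perm n) {x y : ℚ[𝔖 n ]} → x ≈ₐ y → coeff u x ≡ coeff u y
coeff-cong u = fold-cong ℚᵥ λ { (same v w p) →
  indicator-⇔ (v ≟ₚ u) (w ≟ₚ u) (≈ₚ-trans {u = w} {v} {u} (≈ₚ-sym {u = v} {w} p)) (≈ₚ-trans {u = v} {w} {u} p) }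

coeff-resp : ∀ {n} {u w : Perm n} → u Perm.≈ w → ∀ (x : ℚ[𝔖 n ]) → coeff u x ≡ coeff w x
coeff-resp {u = u} {w} p = linear-ext ℚᵥ (coeff-linear u) (coeff-linear w) λ v →
  indicator-⇔ (v ≟ₚ u) (v ≟ₚ w) (λ q → ≈ₚ-trans {u = v} {u} {w} q p) (λ q → ≈ₚ-trans {u = v} {w} {u} q (≈ₚ-sym {u = u} {w} p))

module _ {n : ℕ} where
  open LeftModule (ℚ𝔖 n) public using () renaming (≈ᴹ-setoid to ℚ𝔖-setoid)

  gen-cong : {u w : Perm n} → u Perm.≈ w → gen u ≈ₐ gen w
  gen-cong {u} {w} p = rel (same u w p)

  expansion : ∀ x → x ≈ₐ ∑ⱽ (ℚ𝔖 n) (allPerms n) (λ w → coeff w x *ᴱ gen w)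
  expansion = linear-ext (ℚ𝔖 n) id-linear
    (linear-∑ⱽ (ℚ𝔖 n) (allPerms n) (λ w → record
      { 0-homo = *-zeroˡ _
      ; +-homo = λ x y → *-distribʳ (gen w) (coeff w x) (coeff w y)
      ; -‿homo = λ x → *ₗ-negˡ (coeff w x) (gen w)
      ; *-homo = λ q x → *-assoc q (coeff w x) (gen w)
      }))
    λ u → sym (trans
      (ListSum.∑ᴸ-cong (LeftModule.+ᴹ-commutativeMonoid (ℚ𝔖 n)) (allPerms n) λ w →
        indicator-*ₗ-cong (ℚ𝔖 n) (u ≟ₚ w) (λ p → gen-cong (≈ₚ-sym {u = u} {w} p)))
      (trans (∑ⱽ-*ᵣ (ℚ𝔖 n) (allPerms n) (λ w → indicator (u ≟ₚ w)) (gen u))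
        (trans (LeftModule.*ₗ-cong (ℚ𝔖 n) (∑-indicator-≟ₚ u) refl) (*-identity _))))
    where
    id-linear : Linear (ℚ𝔖 n) {Perm n} (λ x → x)
    id-linear = record { 0-homo = refl ; +-homo = λ _ _ → refl ; -‿homo = λ _ → refl ; *-homo = λ _ _ → refl }

    *ₗ-negˡ : ∀ q v → (ℚ.- q) *ᴱ v ≈ₐ -ᴱ (q *ᴱ v)
    *ₗ-negˡ q v = trans (LeftModule.*ₗ-cong (ℚ𝔖 n) (≡.trans (≡.cong ℚ.-_ (≡.sym (ℚₚ.*-identityˡ q))) (ℚₚ.neg-distribˡ-* 1ℚ q)) refl)
      (trans (*-assoc _ _ _) (neg-one (ℚ𝔖 n) _))

  -- By `expansion`, an element is recovered from its coefficients. This carries equalities computed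
  -- in ℚ back into the group algebra.
  coeff-ext : ∀ {x y : ℚ[𝔖 n ]} → (∀ u → coeff u x ≡ coeff u y) → x ≈ₐ y
  coeff-ext {x} {y} p = trans (expansion x) (trans
    (ListSum.∑ᴸ-cong (LeftModule.+ᴹ-commutativeMonoid (ℚ𝔖 n)) (allPerms n)
      λ w → LeftModule.*ₗ-cong (ℚ𝔖 n) (p w) refl)
    (sym (expansion y)))

  *ₐ-linear : ∀ x → Linear (ℚ𝔖 n) (x *ₐ_)
  *ₐ-linear x = extend-linear _

  ·ₐ-linear : ∀ w → Linear (ℚ𝔖 n) (_·ₐ w)
  ·ₐ-linear w = extend-linear _

  *ₐ-congʳ : ∀ (x : ℚ[𝔖 n ]) {y y′ : ℚ[𝔖 n ]} → y ≈ₐ y′ → x *ₐ y ≈ₐ x *ₐ y′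
  *ₐ-congʳ x = extend-cong λ { (same u w p) → ·ₐ-congʳ x u w p }

  *ₐ-congˡ : ∀ {x x′ : ℚ[𝔖 n ]} (y : ℚ[𝔖 n ]) → x ≈ₐ x′ → x *ₐ y ≈ₐ x′ *ₐ y
  *ₐ-congˡ y p = extend-ext (λ w → ·ₐ-cong w p) y

  *ₐ-assoc : ∀ (x y z : ℚ[𝔖 n ]) → (x *ₐ y) *ₐ z ≈ₐ x *ₐ (y *ₐ z)
  *ₐ-assoc x y = linear-ext (ℚ𝔖 n) (*ₐ-linear (x *ₐ y))
    (linear-∘-extend (ℚ𝔖 n) (λ w → y ·ₐ w) (*ₐ-linear x)) (λ w → sym (*ₐ-·ₐ x y w))

  *ₐ-+ˡ : ∀ (x x′ y : ℚ[𝔖 n ]) → (x +ᴱ x′) *ₐ y ≈ₐ x *ₐ y +ᴱ x′ *ₐ y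
  *ₐ-+ˡ x x′ = linear-ext (ℚ𝔖 n) (*ₐ-linear (x +ᴱ x′)) (linear-+ (ℚ𝔖 n) (*ₐ-linear x) (*ₐ-linear x′)) (λ _ → refl)

  *ₐ-*ˡ : ∀ q (x y : ℚ[𝔖 n ]) → (q *ᴱ x) *ₐ y ≈ₐ q *ᴱ (x *ₐ y)
  *ₐ-*ˡ q x = linear-ext (ℚ𝔖 n) (*ₐ-linear (q *ᴱ x)) (linear-* (ℚ𝔖 n) q (*ₐ-linear x)) (λ _ → refl)

  *ₐ-0ˡ : ∀ (y : ℚ[𝔖 n ]) → 0ᴱ *ₐ y ≈ₐ 0ᴱ
  *ₐ-0ˡ = linear-ext (ℚ𝔖 n) (*ₐ-linear 0ᴱ) (linear-zero (ℚ𝔖 n)) (λ _ → refl)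

  *ₐ-negˡ : ∀ (x y : ℚ[𝔖 n ]) → (-ᴱ x) *ₐ y ≈ₐ -ᴱ (x *ₐ y)
  *ₐ-negˡ x = linear-ext (ℚ𝔖 n) (*ₐ-linear (-ᴱ x)) (linear-neg (ℚ𝔖 n) (*ₐ-linear x)) (λ _ → refl)

  *ₐ-linearˡ : ∀ y → Linear (ℚ𝔖 n) (_*ₐ y)
  *ₐ-linearˡ y = record
    { 0-homo = *ₐ-0ˡ y
    ; +-homo = λ x x′ → *ₐ-+ˡ x x′ y
    ; -‿homo = λ x → *ₐ-negˡ x y
    ; *-homo = λ q x → *ₐ-*ˡ q x y
    }

  *ₐ-identityˡ : ∀ (x : ℚ[𝔖 n ]) → gen Perm.id *ₐ x ≈ₐ x
  *ₐ-identityˡ x = ≡.subst (gen Perm.id *ₐ x ≈ₐ_) (extend-gen x) (extend-ext (λ w → gen-cong λ _ → ≡.refl) x)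

  *ₐ-identityʳ : ∀ (x : ℚ[𝔖 n ]) → x *ₐ gen Perm.id ≈ₐ x
  *ₐ-identityʳ = ·ₐ-id

  coeff-·ₐ : ∀ (u w : Perm n) x → coeff u (x ·ₐ w) ≡ coeff (u ∙ w ⁻¹) x
  coeff-·ₐ u w = linear-ext ℚᵥ (linear-∘-extend ℚᵥ (λ v → gen (v ∙ w)) (coeff-linear u)) (coeff-linear (u ∙ w ⁻¹)) λ v →
    indicator-⇔ (v ∙ w ≟ₚ u) (v ≟ₚ u ∙ w ⁻¹) (∙-moveʳ w {v} {u})
      (λ p i → ≡.trans (p (w ⟨$⟩ʳ i)) (≡.cong (u ⟨$⟩ʳ_) (Perm.inverseˡ w)))

  coeff-gen-*ₐ : ∀ (u w : Perm n) x → coeff u (gen w *ₐ x) ≡ coeff (w ⁻¹ ∙ u) x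
  coeff-gen-*ₐ u w = linear-ext ℚᵥ (linear-∘-extend ℚᵥ (λ v → gen (w ∙ v)) (coeff-linear u)) (coeff-linear (w ⁻¹ ∙ u)) λ v →
    indicator-⇔ (w ∙ v ≟ₚ u) (v ≟ₚ w ⁻¹ ∙ u) (∙-moveˡ w {v} {u})
      (λ p i → ≡.trans (≡.cong (w ⟨$⟩ʳ_) (p i)) (Perm.inverseʳ w))

-- The sign character

module ℕ-sum = MonoidSum ℕₚ.+-0-commutativeMonoid
module ℕ∑ = ListSum ℕₚ.+-0-commutativeMonoid

indicatorᴺ : ∀ {p} {P : Set p} → Dec P → ℕ
indicatorᴺ P? = if does P? then 1 else 0

length-filter : ∀ {A : Set} {P : A → Set} (P? : ∀ x → Dec (P x)) xs →
                length (filter P? xs) ≡ ℕ∑.∑ᴸ xs (λ x → indicatorᴺ (P? x))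
length-filter P? []       = ≡.refl
length-filter P? (x ∷ xs) with does (P? x)
... | true  = ≡.cong suc (length-filter P? xs)
... | false = length-filter P? xs

module _ {n : ℕ} where

  less : Fin n → Fin n → ℕ
  less i j = indicatorᴺ (i Finₚ.<? j)

  less-true : ∀ {i j} → i Fin.< j → less i j ≡ 1
  less-true {i} {j} p = ≡.cong (if_then 1 else 0) (dec-true (i Finₚ.<? j) p)

  less-false : ∀ {i j} → ¬ (i Fin.< j) → less i j ≡ 0
  less-false {i} {j} p = ≡.cong (if_then 1 else 0) (dec-false (i Finₚ.<? j) p)

  less-cases : ∀ i j → i ≢ j → (less i j ≡ 1 × less j i ≡ 0) ⊎ (less i j ≡ 0 × less j i ≡ 1)
  less-cases i j i≢j = go (ℕₚ.<-cmp (toℕ i) (toℕ j))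
    where
    go : Tri (i Fin.< j) (toℕ i ≡ toℕ j) (j Fin.< i) →
         (less i j ≡ 1 × less j i ≡ 0) ⊎ (less i j ≡ 0 × less j i ≡ 1)
    go (tri< p _ q) = inj₁ (less-true {i} {j} p , less-false {j} {i} q)
    go (tri≈ _ p _) = contradiction (Finₚ.toℕ-injective p) i≢j
    go (tri> p _ q) = inj₂ (less-false {i} {j} p , less-true {j} {i} q)

  inverted : Perm n → Fin n → Fin n → ℕ
  inverted w i j = less i j ℕ.* less (w ⟨$⟩ʳ j) (w ⟨$⟩ʳ i)

  ∑∑ : (Fin n → Fin n → ℕ) → ℕ
  ∑∑ f = ℕ-sum.sum (λ i → ℕ-sum.sum (λ j → f i j))

  ∑∑-cong : ∀ {f g} → (∀ i j → f i j ≡ g i j) → ∑∑ f ≡ ∑∑ g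
  ∑∑-cong p = ℕ-sum.sum-cong-≗ (λ i → ℕ-sum.sum-cong-≗ (p i))

  ∑∑-+ : ∀ f g → ∑∑ (λ i j → f i j ℕ.+ g i j) ≡ ∑∑ f ℕ.+ ∑∑ g
  ∑∑-+ f g = ≡.trans (ℕ-sum.sum-cong-≗ (λ i → ℕ-sum.∑-distrib-+ (f i) (g i)))
    (ℕ-sum.∑-distrib-+ (λ i → ℕ-sum.sum (f i)) (λ i → ℕ-sum.sum (g i)))

  ∑∑-permute : ∀ f (w : Perm n) → ∑∑ f ≡ ∑∑ (λ i j → f (w ⟨$⟩ʳ i) (w ⟨$⟩ʳ j))
  ∑∑-permute f w = ≡.trans (ℕ-sum.sum-permute (λ i → ℕ-sum.sum (f i)) w)
    (ℕ-sum.sum-cong-≗ (λ i → ℕ-sum.sum-permute (f (w ⟨$⟩ʳ i)) w))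

  inversionNumber : Perm n → ℕ
  inversionNumber w = ∑∑ (inverted w)

  length-inversions : ∀ w → length (inversions w) ≡ inversionNumber w
  length-inversions w = begin
    length (inversions w)
      ≡⟨ length-filter inv? (cartesianProduct (allFin n) (allFin n)) ⟩
    ℕ∑.∑ᴸ (cartesianProduct (allFin n) (allFin n)) (λ p → indicatorᴺ (inv? p))
      ≡⟨ ℕ∑.∑ᴸ-product _,_ (allFin n) (allFin n) (λ p → indicatorᴺ (inv? p)) ⟩
    ℕ∑.∑ᴸ (allFin n) (λ i → ℕ∑.∑ᴸ (allFin n) (λ j → indicatorᴺ (inv? (i , j))))
      ≡⟨ ℕ∑.∑ᴸ-tabulate {n = n} (λ i → i) (λ i → ℕ∑.∑ᴸ (allFin n) (λ j → indicatorᴺ (inv? (i , j)))) ⟩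
    ℕ-sum.sum (λ i → ℕ∑.∑ᴸ (allFin n) (λ j → indicatorᴺ (inv? (i , j))))
      ≡⟨ ℕ-sum.sum-cong-≗ (λ i → ℕ∑.∑ᴸ-tabulate {n = n} (λ j → j) (λ j → indicatorᴺ (inv? (i , j)))) ⟩
    ∑∑ (λ i j → indicatorᴺ (inv? (i , j)))
      ≡⟨ ∑∑-cong (λ i j → indicatorᴺ-× (i Finₚ.<? j) ((w ⟨$⟩ʳ j) Finₚ.<? (w ⟨$⟩ʳ i))) ⟩
    inversionNumber w ∎
    where
    open ≡.≡-Reasoning

    inv? : ∀ ((i , j) : Fin n × Fin n) → Dec (i Fin.< j × (w ⟨$⟩ʳ j) Fin.< (w ⟨$⟩ʳ i))
    inv? (i , j) = (i Finₚ.<? j) ×-dec ((w ⟨$⟩ʳ j) Finₚ.<? (w ⟨$⟩ʳ i))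

    indicatorᴺ-× : ∀ {P Q : Set} (P? : Dec P) (Q? : Dec Q) →
                   indicatorᴺ (P? ×-dec Q?) ≡ indicatorᴺ P? ℕ.* indicatorᴺ Q?
    indicatorᴺ-× (yes _) (yes _) = ≡.refl
    indicatorᴺ-× (yes _) (no _)  = ≡.refl
    indicatorᴺ-× (no _)  Q?      = ≡.refl

  -- Half the sum over ordered pairs of a symmetric function is its sum over pairs i < j,
  -- and sums over ordered pairs can be reindexed by w.
  ∑-inverted-permute : ∀ (u w : Perm n) →
    ∑∑ (λ i j → less i j ℕ.* (inverted u (w ⟨$⟩ʳ i) (w ⟨$⟩ʳ j) ℕ.+ inverted u (w ⟨$⟩ʳ j) (w ⟨$⟩ʳ i))) ≡ inversionNumber u
  ∑-inverted-permute u w = ℕₚ.*-cancelˡ-≡ _ _ 2 (≡.trans (double S) (≡.sym (≡.trans (double (inversionNumber u)) (begin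
    inversionNumber u ℕ.+ inversionNumber u
      ≡⟨ ≡.cong (inversionNumber u ℕ.+_) (ℕ-sum.∑-comm (inverted u)) ⟩
    ∑∑ (inverted u) ℕ.+ ∑∑ (λ i j → inverted u j i)
      ≡⟨ ≡.sym (∑∑-+ (inverted u) (λ i j → inverted u j i)) ⟩
    ∑∑ f
      ≡⟨ ∑∑-permute f w ⟩
    ∑∑ g
      ≡⟨ ∑∑-cong split ⟩
    ∑∑ (λ i j → less i j ℕ.* g i j ℕ.+ less j i ℕ.* g j i)
      ≡⟨ ∑∑-+ (λ i j → less i j ℕ.* g i j) (λ i j → less j i ℕ.* g j i) ⟩
    S ℕ.+ ∑∑ (λ i j → less j i ℕ.* g j i)
      ≡⟨ ≡.cong (S ℕ.+_) (ℕ-sum.∑-comm (λ i j → less j i ℕ.* g j i)) ⟩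
    S ℕ.+ S ∎))))
    where
    open ≡.≡-Reasoning

    f g : Fin n → Fin n → ℕ
    f i j = inverted u i j ℕ.+ inverted u j i
    g i j = f (w ⟨$⟩ʳ i) (w ⟨$⟩ʳ j)

    S : ℕ
    S = ∑∑ (λ i j → less i j ℕ.* g i j)

    double : ∀ k → 2 ℕ.* k ≡ k ℕ.+ k
    double k = ≡.cong (k ℕ.+_) (ℕₚ.+-identityʳ k)

    split : ∀ i j → g i j ≡ less i j ℕ.* g i j ℕ.+ less j i ℕ.* g j i
    split i j with i Finₚ.≟ j
    ... | yes ≡.refl
        rewrite less-false {i} {i} (ℕₚ.<-irrefl ≡.refl)
              | less-false {w ⟨$⟩ʳ i} {w ⟨$⟩ʳ i} (ℕₚ.<-irrefl ≡.refl) = ≡.refl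
    ... | no i≢j with less-cases i j i≢j
    ...   | inj₁ (p , q) rewrite p | q = ≡.sym (≡.trans (ℕₚ.+-identityʳ _) (ℕₚ.*-identityˡ (g i j)))
    ...   | inj₂ (p , q) rewrite p | q = ≡.trans
            (ℕₚ.+-comm (inverted u (w ⟨$⟩ʳ i) (w ⟨$⟩ʳ j)) (inverted u (w ⟨$⟩ʳ j) (w ⟨$⟩ʳ i)))
            (≡.sym (ℕₚ.*-identityˡ (g j i)))

  -- A pair i < j is an inversion of u ∙ w iff exactly one of w and (at the pair w i, w j) u inverts it.
  inversionNumber-∙ : ∀ (u w : Perm n) →
    ∃[ k ] inversionNumber (u ∙ w) ℕ.+ (k ℕ.+ k) ≡ inversionNumber w ℕ.+ inversionNumber u
  inversionNumber-∙ u w = ∑∑ x , (begin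
    inversionNumber (u ∙ w) ℕ.+ (∑∑ x ℕ.+ ∑∑ x)
      ≡⟨ ≡.cong (inversionNumber (u ∙ w) ℕ.+_) (≡.sym (∑∑-+ x x)) ⟩
    inversionNumber (u ∙ w) ℕ.+ ∑∑ (λ i j → x i j ℕ.+ x i j)
      ≡⟨ ≡.sym (∑∑-+ (inverted (u ∙ w)) (λ i j → x i j ℕ.+ x i j)) ⟩
    ∑∑ (λ i j → inverted (u ∙ w) i j ℕ.+ (x i j ℕ.+ x i j))
      ≡⟨ ∑∑-cong pointwise ⟩
    ∑∑ (λ i j → inverted w i j ℕ.+ less i j ℕ.* g i j)
      ≡⟨ ∑∑-+ (inverted w) (λ i j → less i j ℕ.* g i j) ⟩
    inversionNumber w ℕ.+ ∑∑ (λ i j → less i j ℕ.* g i j)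
      ≡⟨ ≡.cong (inversionNumber w ℕ.+_) (∑-inverted-permute u w) ⟩
    inversionNumber w ℕ.+ inversionNumber u ∎)
    where
    open ≡.≡-Reasoning

    g x : Fin n → Fin n → ℕ
    g i j = inverted u (w ⟨$⟩ʳ i) (w ⟨$⟩ʳ j) ℕ.+ inverted u (w ⟨$⟩ʳ j) (w ⟨$⟩ʳ i)
    -- The pairs that `w` inverts and `u` puts back in order: `w` and `u` both count them and the
    -- product does not, hence the correction `k + k`.
    x i j = inverted w i j ℕ.* less (u ∙ w ⟨$⟩ʳ i) (u ∙ w ⟨$⟩ʳ j)

    pointwise : ∀ i j → inverted (u ∙ w) i j ℕ.+ (x i j ℕ.+ x i j) ≡ inverted w i j ℕ.+ less i j ℕ.* g i j
    pointwise i j with i Finₚ.≟ j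
    ... | yes ≡.refl rewrite less-false {i} {i} (ℕₚ.<-irrefl ≡.refl) = ≡.refl
    ... | no i≢j
        with less-cases i j i≢j
           | less-cases (w ⟨$⟩ʳ i) (w ⟨$⟩ʳ j) (λ p → i≢j (perm-injective w p))
           | less-cases (u ∙ w ⟨$⟩ʳ i) (u ∙ w ⟨$⟩ʳ j) (λ p → i≢j (perm-injective (u ∙ w) p))
    ... | inj₂ (p , _) | _ | _ rewrite p = ≡.refl
    ... | inj₁ (p , _) | inj₁ (q , q′) | inj₁ (r , r′) rewrite p | q | q′ | r′ = ≡.refl
    ... | inj₁ (p , _) | inj₁ (q , q′) | inj₂ (r , r′) rewrite p | q | q′ | r′ = ≡.refl
    ... | inj₁ (p , _) | inj₂ (q , q′) | inj₁ (r , r′) rewrite p | q | q′ | r | r′ = ≡.refl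
    ... | inj₁ (p , _) | inj₂ (q , q′) | inj₂ (r , r′) rewrite p | q | q′ | r | r′ = ≡.refl

-1ℚ : ℚ
-1ℚ = ℚ.- 1ℚ

-1^-+ : ∀ a b → -1ℚ ^ℚ (a ℕ.+ b) ≡ (-1ℚ ^ℚ a) ℚ.* (-1ℚ ^ℚ b)
-1^-+ zero    b = ≡.sym (ℚₚ.*-identityˡ _)
-1^-+ (suc a) b = ≡.trans (≡.cong (-1ℚ ℚ.*_) (-1^-+ a b)) (≡.sym (ℚₚ.*-assoc -1ℚ (-1ℚ ^ℚ a) (-1ℚ ^ℚ b)))

-1^-square : ∀ a → (-1ℚ ^ℚ a) ℚ.* (-1ℚ ^ℚ a) ≡ 1ℚ
-1^-square zero    = ≡.refl
-1^-square (suc a) = ≡.trans (interchange -1ℚ (-1ℚ ^ℚ a) -1ℚ (-1ℚ ^ℚ a)) (≡.cong (1ℚ ℚ.*_) (-1^-square a))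
  where open CommutativeSemigroupProperties (CommutativeMonoid.commutativeSemigroup ℚₚ.*-1-commutativeMonoid) using (interchange)

module _ {n : ℕ} where

  sgn-inversionNumber : (w : Perm n) → sgn w ≡ -1ℚ ^ℚ inversionNumber w
  sgn-inversionNumber w = ≡.cong (-1ℚ ^ℚ_) (length-inversions w)

  sgn-cong : {u w : Perm n} → u Perm.≈ w → sgn u ≡ sgn w
  sgn-cong {u} {w} p = ≡.trans (sgn-inversionNumber u) (≡.trans
    (≡.cong (-1ℚ ^ℚ_) (∑∑-cong (λ i j → ≡.cong₂ (λ a b → less i j ℕ.* less a b) (p j) (p i))))
    (≡.sym (sgn-inversionNumber w)))

  sgn-∙ : (u w : Perm n) → sgn (u ∙ w) ≡ sgn u ℚ.* sgn w
  sgn-∙ u w with inversionNumber-∙ u w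
  ... | k , p = begin
    sgn (u ∙ w)
      ≡⟨ sgn-inversionNumber (u ∙ w) ⟩
    -1ℚ ^ℚ inversionNumber (u ∙ w)
      ≡⟨ ≡.sym (ℚₚ.*-identityʳ _) ⟩
    (-1ℚ ^ℚ inversionNumber (u ∙ w)) ℚ.* 1ℚ
      ≡⟨ ≡.cong ((-1ℚ ^ℚ inversionNumber (u ∙ w)) ℚ.*_) (≡.sym (≡.trans (-1^-+ k k) (-1^-square k))) ⟩
    (-1ℚ ^ℚ inversionNumber (u ∙ w)) ℚ.* (-1ℚ ^ℚ (k ℕ.+ k))
      ≡⟨ ≡.sym (-1^-+ (inversionNumber (u ∙ w)) (k ℕ.+ k)) ⟩
    -1ℚ ^ℚ (inversionNumber (u ∙ w) ℕ.+ (k ℕ.+ k))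
      ≡⟨ ≡.cong (-1ℚ ^ℚ_) (≡.trans p (ℕₚ.+-comm (inversionNumber w) (inversionNumber u))) ⟩
    -1ℚ ^ℚ (inversionNumber u ℕ.+ inversionNumber w)
      ≡⟨ -1^-+ (inversionNumber u) (inversionNumber w) ⟩
    (-1ℚ ^ℚ inversionNumber u) ℚ.* (-1ℚ ^ℚ inversionNumber w)
      ≡⟨ ≡.sym (≡.cong₂ ℚ._*_ (sgn-inversionNumber u) (sgn-inversionNumber w)) ⟩
    sgn u ℚ.* sgn w ∎
    where open ≡.≡-Reasoning

  sgn-square : (w : Perm n) → sgn w ℚ.* sgn w ≡ 1ℚ
  sgn-square w = -1^-square (length (inversions w))

  -- `id ∙ id` is `id`, and a sign multiplied by itself is 1.
  sgn-id : sgn (Perm.id {n}) ≡ 1ℚ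
  sgn-id = ≡.trans (sgn-∙ Perm.id Perm.id) (sgn-square Perm.id)

  sgn-⁻¹ : (w : Perm n) → sgn (w ⁻¹) ≡ sgn w
  sgn-⁻¹ w = begin
    sgn (w ⁻¹)                         ≡⟨ ≡.sym (ℚₚ.*-identityʳ _) ⟩
    sgn (w ⁻¹) ℚ.* 1ℚ                  ≡⟨ ≡.cong (sgn (w ⁻¹) ℚ.*_) (≡.sym (sgn-square w)) ⟩
    sgn (w ⁻¹) ℚ.* (sgn w ℚ.* sgn w)   ≡⟨ ≡.sym (ℚₚ.*-assoc (sgn (w ⁻¹)) (sgn w) (sgn w)) ⟩
    (sgn (w ⁻¹) ℚ.* sgn w) ℚ.* sgn w   ≡⟨ ≡.cong (ℚ._* sgn w) (≡.sym (sgn-∙ (w ⁻¹) w)) ⟩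
    sgn (w ⁻¹ ∙ w) ℚ.* sgn w           ≡⟨ ≡.cong (ℚ._* sgn w) (≡.trans (sgn-cong {w ⁻¹ ∙ w} {Perm.id} (λ _ → Perm.inverseˡ w)) sgn-id) ⟩
    1ℚ ℚ.* sgn w                       ≡⟨ ℚₚ.*-identityˡ (sgn w) ⟩
    sgn w ∎
    where open ≡.≡-Reasoning

  sgn-^ : (w : Perm n) → ∀ k → sgn (w ^ₚ k) ≡ sgn w ^ℚ k
  sgn-^ w zero    = sgn-id
  sgn-^ w (suc k) = ≡.trans (sgn-∙ w (w ^ₚ k)) (≡.cong (sgn w ℚ.*_) (sgn-^ w k))

punchIn-fromℕ : ∀ {m} (i : Fin m) → punchIn (fromℕ m) i ≡ inject₁ i
punchIn-fromℕ zero    = ≡.refl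
punchIn-fromℕ (suc i) = ≡.cong suc (punchIn-fromℕ i)

insert-self : ∀ {m} (i j : Fin (suc m)) (w : Perm m) → insert i j w ⟨$⟩ʳ i ≡ j
insert-self i j w with i Finₚ.≟ i
... | yes _  = ≡.refl
... | no i≢i = contradiction ≡.refl i≢i

module _ {m : ℕ} (w : Perm m) where

  ι-inject₁ : ∀ i → ι w ⟨$⟩ʳ inject₁ i ≡ inject₁ (w ⟨$⟩ʳ i)
  ι-inject₁ i = ≡.trans (≡.cong (ι w ⟨$⟩ʳ_) (≡.sym (punchIn-fromℕ i)))
    (≡.trans (insert-punchIn (fromℕ m) (fromℕ m) w i) (punchIn-fromℕ (w ⟨$⟩ʳ i)))

  ι-fromℕ : ι w ⟨$⟩ʳ fromℕ m ≡ fromℕ m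
  ι-fromℕ = insert-self (fromℕ m) (fromℕ m) w

  -- The last point is fixed and is the largest, so neither the last row nor the last column of the
  -- table of pairs contains an inversion.
  sgn-ι : sgn (ι w) ≡ sgn w
  sgn-ι = ≡.trans (sgn-inversionNumber (ι w)) (≡.trans (≡.cong (-1ℚ ^ℚ_) (begin
    ∑∑ (inverted (ι w))
      ≡⟨ ℕ-sum.sum-init-last (λ i → ℕ-sum.sum (inverted (ι w) i)) ⟩
    ℕ-sum.sum (λ i → ℕ-sum.sum (inverted (ι w) (inject₁ i))) ℕ.+ ℕ-sum.sum (inverted (ι w) (fromℕ m))
      ≡⟨ ≡.cong₂ ℕ._+_ (ℕ-sum.sum-cong-≗ row) last-row ⟩
    inversionNumber w ℕ.+ 0
      ≡⟨ ℕₚ.+-identityʳ _ ⟩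
    inversionNumber w ∎)) (≡.sym (sgn-inversionNumber w)))
    where
    open ≡.≡-Reasoning

    fromℕ-max : ∀ j → less (fromℕ m) j ≡ 0
    fromℕ-max j = less-false {i = fromℕ m} {j} (ℕₚ.≤⇒≯ (Finₚ.≤fromℕ j))

    less-inject₁ : ∀ (i j : Fin m) → less (inject₁ i) (inject₁ j) ≡ less i j
    less-inject₁ i j rewrite Finₚ.toℕ-inject₁ i | Finₚ.toℕ-inject₁ j = ≡.refl

    last-row : ℕ-sum.sum (inverted (ι w) (fromℕ m)) ≡ 0
    last-row = ≡.trans
      (ℕ-sum.sum-cong-≗ (λ j → ≡.cong (ℕ._* less (ι w ⟨$⟩ʳ j) (ι w ⟨$⟩ʳ fromℕ m)) (fromℕ-max j)))
      (ℕ-sum.sum-replicate-zero (suc m))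

    row : ∀ i → ℕ-sum.sum (inverted (ι w) (inject₁ i)) ≡ ℕ-sum.sum (inverted w i)
    row i = ≡.trans (ℕ-sum.sum-init-last (inverted (ι w) (inject₁ i)))
      (≡.trans (≡.cong₂ ℕ._+_
        (ℕ-sum.sum-cong-≗ (λ j → ≡.cong₂ ℕ._*_ (less-inject₁ i j)
          (≡.trans (≡.cong₂ less (ι-inject₁ j) (ι-inject₁ i)) (less-inject₁ (w ⟨$⟩ʳ j) (w ⟨$⟩ʳ i)))))
        (≡.trans (≡.cong (less (inject₁ i) (fromℕ m) ℕ.*_)
            (≡.trans (≡.cong (λ k → less k (ι w ⟨$⟩ʳ inject₁ i)) ι-fromℕ) (fromℕ-max (ι w ⟨$⟩ʳ inject₁ i))))
          (ℕₚ.*-zeroʳ (less (inject₁ i) (fromℕ m)))))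
      (ℕₚ.+-identityʳ _))

-- Shuffles and the coefficients of s

∑-mono : ∀ {B : Set} (xs : List B) {f g : B → ℚ} → (∀ x → f x ℚ.≤ g x) → ∑ᴸ xs f ℚ.≤ ∑ᴸ xs g
∑-mono []       p = ℚₚ.≤-refl
∑-mono (x ∷ xs) p = ℚₚ.+-mono-≤ (p x) (∑-mono xs p)

∑-select : ∀ {n} (u : Perm n) (f : Perm n → ℚ) → (∀ {w} → u Perm.≈ w → f w ≡ f u) →
           ∑ᴸ (allPerms n) (λ w → indicator (u ≟ₚ w) ℚ.* f w) ≡ f u
∑-select {n} u f resp-f = begin
  ∑ᴸ (allPerms n) (λ w → indicator (u ≟ₚ w) ℚ.* f w)
    ≡⟨ ∑ᴸ-cong (allPerms n) (λ w → indicator-*-cong (u ≟ₚ w) {f w} {f u} (resp-f {w})) ⟩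
  ∑ᴸ (allPerms n) (λ w → indicator (u ≟ₚ w) ℚ.* f u)
    ≡⟨ ∑ⱽ-*ᵣ ℚᵥ (allPerms n) (λ w → indicator (u ≟ₚ w)) (f u) ⟩
  ∑ᴸ (allPerms n) (λ w → indicator (u ≟ₚ w)) ℚ.* f u
    ≡⟨ ≡.cong (ℚ._* f u) (∑-indicator-≟ₚ u) ⟩
  1ℚ ℚ.* f u
    ≡⟨ ℚₚ.*-identityˡ (f u) ⟩
  f u ∎
  where open ≡.≡-Reasoning

indicator-≥0 : ∀ {p} {P : Set p} (P? : Dec P) → 0ℚ ℚ.≤ indicator P?
indicator-≥0 (yes _) = ℚₚ.≤ᵇ⇒≤ _
indicator-≥0 (no _)  = ℚₚ.≤-refl

*-mono-≥0ˡ : ∀ {p q} r → 0ℚ ℚ.≤ r → p ℚ.≤ q → r ℚ.* p ℚ.≤ r ℚ.* q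
*-mono-≥0ˡ r r≥0 p≤q = ℚₚ.*-monoˡ-≤-nonNeg r {{ℚ.nonNegative r≥0}} p≤q

*-≥0 : ∀ {p q} → 0ℚ ℚ.≤ p → 0ℚ ℚ.≤ q → 0ℚ ℚ.≤ p ℚ.* q
*-≥0 {p} {q} p≥0 q≥0 = ≡.subst (ℚ._≤ p ℚ.* q) (ℚₚ.*-zeroʳ p) (*-mono-≥0ˡ p p≥0 q≥0)

∑-term-≤ : ∀ {n} (u : Perm n) (f : Perm n → ℚ) → (∀ {w} → u Perm.≈ w → f w ≡ f u) → (∀ w → 0ℚ ℚ.≤ f w) →
           f u ℚ.≤ ∑ᴸ (allPerms n) f
∑-term-≤ {n} u f resp-f f≥0 = ≡.subst (ℚ._≤ ∑ᴸ (allPerms n) f) (∑-select u f resp-f)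
  (∑-mono (allPerms n) λ w → bound (u ≟ₚ w) w)
  where
  bound : ∀ {P : Set} (P? : Dec P) w → indicator P? ℚ.* f w ℚ.≤ f w
  bound (yes _) w = ℚₚ.≤-reflexive (ℚₚ.*-identityˡ (f w))
  bound (no _)  w = ≡.subst (ℚ._≤ f w) (≡.sym (ℚₚ.*-zeroˡ (f w))) (f≥0 w)

sum-≥0 : ∀ {n} (f : Fin n → ℚ) → (∀ i → 0ℚ ℚ.≤ f i) → 0ℚ ℚ.≤ sum f
sum-≥0 {zero}  f p = ℚₚ.≤-refl
sum-≥0 {suc n} f p = ℚₚ.+-mono-≤ (p zero) (sum-≥0 (f ∘ suc) (p ∘ suc))

sum-term-≤ : ∀ {n} (f : Fin n → ℚ) → (∀ i → 0ℚ ℚ.≤ f i) → ∀ i → f i ℚ.≤ sum f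
sum-term-≤ f p zero    = ≡.subst (ℚ._≤ sum f) (ℚₚ.+-identityʳ (f zero))
  (ℚₚ.+-mono-≤ (ℚₚ.≤-refl {f zero}) (sum-≥0 (f ∘ suc) (p ∘ suc)))
sum-term-≤ f p (suc i) = ≡.subst (ℚ._≤ sum f) (ℚₚ.+-identityˡ (f (suc i)))
  (ℚₚ.+-mono-≤ (p zero) (sum-term-≤ (f ∘ suc) (p ∘ suc) i))

-- Convolution, arranged so that the coefficients of `x` act as weights on translates of those of
-- `y`. With `x = s n` this becomes the averaging operator of the maximum principle.
coeff-*ₐ : ∀ {n} (u : Perm n) x y →
           coeff u (x *ₐ y) ≡ ∑ᴸ (allPerms n) (λ w → coeff w x ℚ.* coeff (w ⁻¹ ∙ u) y)
coeff-*ₐ {n} u x y = ≡.trans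
  (linear-ext ℚᵥ
    (record
      { 0-homo = coeff-cong u {0ᴱ *ₐ y} {0ᴱ} (*ₐ-0ˡ y)
      ; +-homo = λ x x′ → coeff-cong u {(x +ᴱ x′) *ₐ y} {x *ₐ y +ᴱ x′ *ₐ y} (*ₐ-+ˡ x x′ y)
      ; -‿homo = λ x → coeff-cong u {(-ᴱ x) *ₐ y} { -ᴱ (x *ₐ y)} (*ₐ-negˡ x y)
      ; *-homo = λ q x → coeff-cong u {(q *ᴱ x) *ₐ y} {q *ᴱ (x *ₐ y)} (*ₐ-*ˡ q x y)
      })
    (linear-∑ⱽ ℚᵥ (allPerms n) (λ w → linear-* ℚᵥ (coeff (w ⁻¹ ∙ u) y) (coeff-linear w)))
    (λ v → ≡.trans (coeff-gen-*ₐ u v y) (≡.sym (≡.trans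
      (∑ᴸ-cong (allPerms n) (λ w → ℚₚ.*-comm (coeff (w ⁻¹ ∙ u) y) (indicator (v ≟ₚ w))))
      (∑-select v (λ w → coeff (w ⁻¹ ∙ u) y) (λ {w} p → coeff-resp {u = w ⁻¹ ∙ u} {v ⁻¹ ∙ u} (⁻¹-cong {v = v} {w} p) y)))))
    x)
  (∑ᴸ-cong (allPerms n) (λ w → ℚₚ.*-comm (coeff (w ⁻¹ ∙ u) y) (coeff w x)))
  where
  ⁻¹-cong : ∀ {v w : Perm n} → v Perm.≈ w → (w ⁻¹ ∙ u) Perm.≈ (v ⁻¹ ∙ u)
  ⁻¹-cong {v} {w} p i = ≡.trans (≡.cong (w ⟨$⟩ˡ_) (≡.trans (≡.sym (Perm.inverseʳ v)) (p _))) (Perm.inverseˡ w)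

-- The coefficients of `s n` with the sign removed (`coeff-s`): a permutation counts once for each
-- block length from 1 to n - 1 for which it is a shuffle.
shuffleCount : ∀ {n} → Perm n → ℚ
shuffleCount {n} w = sum {n ∸ 1} (λ k → indicator (isShuffle? (suc (toℕ k)) w))

isShuffle-cong : ∀ {n} i {u w : Perm n} → u Perm.≈ w → IsShuffle i u → IsShuffle i w
isShuffle-cong i p (f , g) =
  (λ a b a<b b<i → ≡.subst₂ Fin._<_ (p a) (p b) (f a b a<b b<i)) ,
  (λ a b a<b i≤a → ≡.subst₂ Fin._<_ (p a) (p b) (g a b a<b i≤a))

indicator-shuffle-cong : ∀ {n} i {u w : Perm n} → u Perm.≈ w →
                         indicator (isShuffle? i u) ≡ indicator (isShuffle? i w)
indicator-shuffle-cong i {u} {w} p = indicator-⇔ (isShuffle? i u) (isShuffle? i w)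
  (isShuffle-cong i {u} {w} p) (isShuffle-cong i {w} {u} (≈ₚ-sym {u = u} {w} p))

shuffleCount-cong : ∀ {n} {u w : Perm n} → u Perm.≈ w → shuffleCount u ≡ shuffleCount w
shuffleCount-cong {n} {u} {w} p = sum-cong-≗ {n ∸ 1} (λ k → indicator-shuffle-cong (suc (toℕ k)) {u} {w} p)

shuffleCount-≥0 : ∀ {n} (w : Perm n) → 0ℚ ℚ.≤ shuffleCount w
shuffleCount-≥0 {n} w = sum-≥0 {n ∸ 1} _ (λ k → indicator-≥0 (isShuffle? (suc (toℕ k)) w))

coeff-s : ∀ {n} (u : Perm n) → coeff u (s n) ≡ shuffleCount u ℚ.* sgn u
coeff-s {n} u = ≡.trans (coeff-sum {n ∸ 1} (λ k → signedShuffles n (suc (toℕ k))))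
  (≡.trans (sum-cong-≗ {n ∸ 1} (λ k → coeff-signedShuffles (suc (toℕ k))))
    (≡.sym (*-distribʳ-sum {n ∸ 1} (sgn u) (λ k → indicator (isShuffle? (suc (toℕ k)) u)))))
  where
  open import Algebra.Definitions.RawMonoid (LeftModule.+ᴹ-rawMonoid (ℚ𝔖 n)) using () renaming (sum to sumᴱ)

  coeff-sum : ∀ {m} (f : Fin m → ℚ[𝔖 n ]) → coeff u (sumᴱ f) ≡ sum (λ k → coeff u (f k))
  coeff-sum {zero}  f = ≡.refl
  coeff-sum {suc m} f = ≡.cong (coeff u (f zero) ℚ.+_) (coeff-sum (f ∘ suc))

  coeff-filter : ∀ i ws → coeff u (foldr _+ᴱ_ 0ᴱ (map (λ w → sgn w *ᴱ gen w) (filter (isShuffle? i) ws)))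
                        ≡ ∑ᴸ ws (λ w → indicator (u ≟ₚ w) ℚ.* (indicator (isShuffle? i w) ℚ.* sgn w))
  coeff-filter i []       = ≡.refl
  coeff-filter i (w ∷ ws) with does (isShuffle? i w)
  ... | true  = ≡.cong₂ ℚ._+_
    (≡.trans (ℚₚ.*-comm (sgn w) (indicator (w ≟ₚ u))) (≡.cong₂ ℚ._*_
      (indicator-⇔ (w ≟ₚ u) (u ≟ₚ w) (≈ₚ-sym {u = w} {u}) (≈ₚ-sym {u = u} {w})) (≡.sym (ℚₚ.*-identityˡ (sgn w)))))
    (coeff-filter i ws)
  ... | false = ≡.trans (coeff-filter i ws) (≡.sym (≡.trans (≡.cong (ℚ._+ rest)
      (≡.trans (≡.cong (indicator (u ≟ₚ w) ℚ.*_) (ℚₚ.*-zeroˡ (sgn w))) (ℚₚ.*-zeroʳ (indicator (u ≟ₚ w)))))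
      (ℚₚ.+-identityˡ rest)))
    where
    rest : ℚ
    rest = ∑ᴸ ws (λ w → indicator (u ≟ₚ w) ℚ.* (indicator (isShuffle? i w) ℚ.* sgn w))

  coeff-signedShuffles : ∀ i → coeff u (signedShuffles n i) ≡ indicator (isShuffle? i u) ℚ.* sgn u
  coeff-signedShuffles i = ≡.trans (coeff-filter i (allPerms n))
    (∑-select u (λ w → indicator (isShuffle? i w) ℚ.* sgn w)
      (λ {w} p → ≡.cong₂ ℚ._*_ (≡.sym (indicator-shuffle-cong i {u} {w} p)) (≡.sym (sgn-cong {u = u} {w} p))))

-- Both blocks are nonempty, so these are the permutations that occur in `s n`, and they have weight
-- at least 1.
IsProperShuffle : ∀ {n} → Perm n → Set
IsProperShuffle {n} w = ∃[ k ] IsShuffle (suc (toℕ {n ∸ 1} k)) w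

shuffleCount-≥1 : ∀ {n} (w : Perm n) → IsProperShuffle w → 1ℚ ℚ.≤ shuffleCount w
shuffleCount-≥1 {n} w (k , p) = ≡.subst (ℚ._≤ shuffleCount w) (indicator-yes (isShuffle? (suc (toℕ k)) w) p)
  (sum-term-≤ {n ∸ 1} _ (λ k → indicator-≥0 (isShuffle? (suc (toℕ k)) w)) k)

punchIn-mono-< : ∀ {n} (j : Fin (suc n)) {p q : Fin n} → p Fin.< q → punchIn j p Fin.< punchIn j q
punchIn-mono-< zero    p<q = s≤s p<q
punchIn-mono-< (suc j) {zero}  {suc q} p<q = s≤s z≤n
punchIn-mono-< (suc j) {suc p} {suc q} (s≤s p<q) = s≤s (punchIn-mono-< j p<q)

-- Each u factors as insert zero j id ∙ lift₀ w, where the first factor is a shuffle.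
shuffles-generate : ∀ {n} (P : Perm n → Set) → (∀ {u w} → u Perm.≈ w → P u → P w) →
                    (∀ w u → IsProperShuffle w → P (w ∙ u) → P u) → ∀ u → P u → P Perm.id
shuffles-generate {zero}        P resp-P cancel u p = resp-P {u} {Perm.id} (λ ()) p
shuffles-generate {suc zero}    P resp-P cancel u p = resp-P {u} {Perm.id} (λ i → unique (u ⟨$⟩ʳ i) i) p
  where
  unique : (i j : Fin 1) → i ≡ j
  unique zero zero = ≡.refl
shuffles-generate {suc (suc n)} P resp-P cancel u p =
  resp-P {lift₀ Perm.id} {Perm.id} (λ { zero → ≡.refl ; (suc i) → ≡.refl })
    (shuffles-generate (λ w → P (lift₀ w))
      (λ {v} {w} q → resp-P {lift₀ v} {lift₀ w} (Perm.lift₀-cong v w q))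
      (λ w v sh q → cancel (lift₀ w) (lift₀ v) (lift₀-shuffle w sh)
        (resp-P {lift₀ (w ∙ v)} {lift₀ w ∙ lift₀ v} (λ { zero → ≡.refl ; (suc i) → ≡.refl }) q))
      (remove zero u)
      (cancel κ (lift₀ (remove zero u)) κ-shuffle (resp-P {u} {κ ∙ lift₀ (remove zero u)} factor p)))
  where
  j : Fin (suc (suc n))
  j = u ⟨$⟩ʳ zero

  κ : Perm (suc (suc n))
  κ = insert zero j Perm.id

  factor : u Perm.≈ (κ ∙ lift₀ (remove zero u))
  factor zero    = ≡.refl
  factor (suc i) = Perm.punchIn-permute u zero i

  -- The first block has length 1; the other values are listed by `punchIn j`, which is monotone.
  κ-shuffle : IsProperShuffle κ
  κ-shuffle = zero ,
    (λ { a zero () b<1 ; a (suc b) a<b (s≤s ()) }) ,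
    (λ { zero b a<b () ; (suc a) zero () 1≤a ; (suc a) (suc b) (s≤s a<b) 1≤a → punchIn-mono-< j a<b })

  lift₀-shuffle : ∀ (w : Perm (suc n)) → IsProperShuffle w → IsProperShuffle (lift₀ w)
  lift₀-shuffle w (k , f , g) = suc k ,
    (λ { zero    zero    ()        b<k
       ; zero    (suc b) a<b       b<k       → s≤s z≤n
       ; (suc a) (suc b) (s≤s a<b) (s≤s b<k) → s≤s (f a b a<b b<k) }) ,
    (λ { (suc a) (suc b) (s≤s a<b) (s≤s k≤a) → s≤s (g a b a<b k≤a) })

-- The maximum principle and the number of shuffles

open import Data.List.Extrema (DecTotalOrder.totalOrder ℚₚ.≤-decTotalOrder) using (argmax; f[xs]≤f[argmax])

-- At a maximum M of y the nonnegative terms a w (M − y (w⁻¹u)) sum to zero, hence each vanishes.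
module MaximumPrinciple {n : ℕ} (a y : Perm n → ℚ)
  (a-cong : ∀ {u w} → u Perm.≈ w → a u ≡ a w) (y-cong : ∀ {u w} → u Perm.≈ w → y u ≡ y w)
  (a-≥0 : ∀ w → 0ℚ ℚ.≤ a w) (a-≥1 : ∀ w → IsProperShuffle w → 1ℚ ℚ.≤ a w)
  (mean : ∀ u → ∑ᴸ (allPerms n) (λ w → a w ℚ.* y (w ⁻¹ ∙ u)) ≡ ∑ᴸ (allPerms n) a ℚ.* y u) where

  u* : Perm n
  u* = argmax y Perm.id (allPerms n)

  M : ℚ
  M = y u*

  y-≤M : ∀ u → y u ℚ.≤ M
  y-≤M u = go (allPerms n) (f[xs]≤f[argmax] Perm.id (allPerms n)) (allPerms-complete u)
    where
    go : ∀ ws → All (λ w → y w ℚ.≤ M) ws → Any (u Perm.≈_) ws → y u ℚ.≤ M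
    go (w ∷ ws) (q All.∷ qs) (here p)  = ≡.subst (ℚ._≤ M) (≡.sym (y-cong {u} {w} p)) q
    go (w ∷ ws) (q All.∷ qs) (there p) = go ws qs p

  deficit : Perm n → Perm n → ℚ
  deficit u w = a w ℚ.* (M ℚ.- y (w ⁻¹ ∙ u))

  M-y≥0 : ∀ u → 0ℚ ℚ.≤ M ℚ.- y u
  M-y≥0 u = ≡.subst (ℚ._≤ M ℚ.- y u) (ℚₚ.+-inverseʳ (y u)) (ℚₚ.+-monoˡ-≤ (ℚ.- y u) (y-≤M u))

  ∑-deficit : ∀ u → y u ≡ M → ∑ᴸ (allPerms n) (deficit u) ≡ 0ℚ
  ∑-deficit u p = begin
    ∑ᴸ (allPerms n) (deficit u)
      ≡⟨ ∑ᴸ-cong (allPerms n) (λ w → ℚₚ.*-distribˡ-+ (a w) M (ℚ.- y (w ⁻¹ ∙ u))) ⟩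
    ∑ᴸ (allPerms n) (λ w → a w ℚ.* M ℚ.+ a w ℚ.* (ℚ.- y (w ⁻¹ ∙ u)))
      ≡⟨ ∑ᴸ-+ (allPerms n) (λ w → a w ℚ.* M) (λ w → a w ℚ.* (ℚ.- y (w ⁻¹ ∙ u))) ⟩
    ∑ᴸ (allPerms n) (λ w → a w ℚ.* M) ℚ.+ ∑ᴸ (allPerms n) (λ w → a w ℚ.* (ℚ.- y (w ⁻¹ ∙ u)))
      ≡⟨ ≡.cong₂ ℚ._+_ (∑ⱽ-*ᵣ ℚᵥ (allPerms n) a M)
           (≡.trans (∑ᴸ-cong (allPerms n) (λ w → pull (a w) (y (w ⁻¹ ∙ u))))
             (≡.trans (∑-*ˡ (allPerms n) -1ℚ (λ w → a w ℚ.* y (w ⁻¹ ∙ u))) (≡.cong (-1ℚ ℚ.*_) (mean u)))) ⟩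
    A ℚ.* M ℚ.+ -1ℚ ℚ.* (A ℚ.* y u)
      ≡⟨ ≡.cong (λ m → A ℚ.* M ℚ.+ -1ℚ ℚ.* (A ℚ.* m)) p ⟩
    A ℚ.* M ℚ.+ -1ℚ ℚ.* (A ℚ.* M)
      ≡⟨ ≡.cong (A ℚ.* M ℚ.+_) (≡.sym (≡.trans (≡.cong ℚ.-_ (≡.sym (ℚₚ.*-identityˡ _))) (ℚₚ.neg-distribˡ-* 1ℚ (A ℚ.* M)))) ⟩
    A ℚ.* M ℚ.- A ℚ.* M
      ≡⟨ ℚₚ.+-inverseʳ (A ℚ.* M) ⟩
    0ℚ ∎
    where
    open ≡.≡-Reasoning

    A : ℚ
    A = ∑ᴸ (allPerms n) a

    pull : ∀ p q → p ℚ.* (ℚ.- q) ≡ -1ℚ ℚ.* (p ℚ.* q)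
    pull p q = ≡.trans (≡.sym (ℚₚ.neg-distribʳ-* p q))
      (≡.trans (≡.cong ℚ.-_ (≡.sym (ℚₚ.*-identityˡ (p ℚ.* q)))) (ℚₚ.neg-distribˡ-* 1ℚ (p ℚ.* q)))

  -- In the deficit sum at `w ∙ u` the term of index `w` concerns the point `u`. It is at most the
  -- whole sum, which is 0, and its weight is at least 1, so the deficit at `u` cannot be positive.
  max-propagates : ∀ w u → IsProperShuffle w → y (w ∙ u) ≡ M → y u ≡ M
  max-propagates w u sh p = ≡.trans (y-cong {u} {w ⁻¹ ∙ (w ∙ u)} (≈ₚ-sym {u = w ⁻¹ ∙ (w ∙ u)} {u} (⁻¹-∙-cancel w u)))
    (ℚₚ.≤-antisym (y-≤M v) M≤y)
    where
    v : Perm n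
    v = w ⁻¹ ∙ (w ∙ u)

    ⁻¹-cong : ∀ {w w′ : Perm n} → w Perm.≈ w′ → (w′ ⁻¹ ∙ (w ∙ u)) Perm.≈ u
    ⁻¹-cong {w} {w′} q i = ≡.trans (≡.cong (w′ ⟨$⟩ˡ_) (q _)) (Perm.inverseˡ w′)

    deficit-cong : ∀ {w′} → w Perm.≈ w′ → deficit (w ∙ u) w′ ≡ deficit (w ∙ u) w
    deficit-cong {w′} q = ≡.cong₂ (λ b c → b ℚ.* (M ℚ.- c)) (≡.sym (a-cong {w} {w′} q))
      (y-cong {w′ ⁻¹ ∙ (w ∙ u)} {v} (λ i → ≡.trans (⁻¹-cong {w} {w′} q i) (≡.sym (⁻¹-∙-cancel w u i))))

    deficit≤0 : M ℚ.- y v ℚ.≤ 0ℚ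
    deficit≤0 = begin
      M ℚ.- y v
        ≡⟨ ≡.sym (ℚₚ.*-identityˡ (M ℚ.- y v)) ⟩
      1ℚ ℚ.* (M ℚ.- y v)
        ≤⟨ ℚₚ.*-monoʳ-≤-nonNeg (M ℚ.- y v) {{ℚ.nonNegative (M-y≥0 v)}} (a-≥1 w sh) ⟩
      deficit (w ∙ u) w
        ≤⟨ ∑-term-≤ w (deficit (w ∙ u)) (λ {w′} → deficit-cong {w′})
             (λ w′ → *-≥0 (a-≥0 w′) (M-y≥0 (w′ ⁻¹ ∙ (w ∙ u)))) ⟩
      ∑ᴸ (allPerms n) (deficit (w ∙ u))
        ≡⟨ ∑-deficit (w ∙ u) p ⟩
      0ℚ ∎
      where open ℚₚ.≤-Reasoning

    M≤y : M ℚ.≤ y v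
    M≤y = begin
      M                            ≡⟨ ≡.sym (ℚₚ.+-identityʳ M) ⟩
      M ℚ.+ 0ℚ                     ≡⟨ ≡.cong (M ℚ.+_) (≡.sym (ℚₚ.+-inverseˡ (y v))) ⟩
      M ℚ.+ (ℚ.- y v ℚ.+ y v)      ≡⟨ ≡.sym (ℚₚ.+-assoc M (ℚ.- y v) (y v)) ⟩
      (M ℚ.- y v) ℚ.+ y v          ≤⟨ ℚₚ.+-monoˡ-≤ (y v) deficit≤0 ⟩
      0ℚ ℚ.+ y v                   ≡⟨ ℚₚ.+-identityˡ (y v) ⟩
      y v ∎
      where open ℚₚ.≤-Reasoning

  -- From a maximal point, stripping off shuffles one at a time leads down to the identity, and
  -- maximality is kept all the way. The identity thus serves as a common point of reference for
  -- every such `y`.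
  maximal-at-id : ∀ u → y u ℚ.≤ y Perm.id
  maximal-at-id u = ≡.subst (y u ℚ.≤_) (≡.sym id-max) (y-≤M u)
    where
    id-max : y Perm.id ≡ M
    id-max = shuffles-generate (λ u → y u ≡ M)
      (λ {u} {w} p q → ≡.trans (≡.sym (y-cong {u} {w} p)) q) max-propagates u* ≡.refl

-- With block length 0 the second block is the whole word, so increasing permutations are counted.
-- The value `zero` cannot come after the first position, and deleting it leaves an increasing
-- permutation.
∑-indicator-increasing : ∀ n → ∑ᴸ (allPerms n) (λ w → indicator (isShuffle? 0 w)) ≡ 1ℚ
∑-indicator-increasing zero    = ≡.refl
∑-indicator-increasing (suc n) = begin
  ∑ᴸ (allPerms (suc n)) (λ w → indicator (isShuffle? 0 w))
    ≡⟨ ∑ᴸ-allPerms n (λ w → indicator (isShuffle? 0 w)) ⟩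
  sum (λ j → ∑ᴸ (allPerms n) (λ w → indicator (isShuffle? 0 (insert zero j w))))
    ≡⟨ sum-cong-≗ {suc n} (λ j → ≡.trans (∑ᴸ-cong (allPerms n) (λ w → split j w))
         (∑-*ˡ (allPerms n) (indicator (zero Finₚ.≟ j)) (λ w → indicator (isShuffle? 0 w)))) ⟩
  sum {suc n} (λ j → indicator (zero Finₚ.≟ j) ℚ.* ∑ᴸ (allPerms n) (λ w → indicator (isShuffle? 0 w)))
    ≡⟨ sum-indicator-≟ {suc n} zero (λ _ → ∑ᴸ (allPerms n) (λ w → indicator (isShuffle? 0 w))) ⟩
  ∑ᴸ (allPerms n) (λ w → indicator (isShuffle? 0 w))
    ≡⟨ ∑-indicator-increasing n ⟩
  1ℚ ∎
  where
  open ≡.≡-Reasoning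

  smallest-first : ∀ j w → IsShuffle 0 (insert zero j w) → zero ≡ j
  smallest-first j w (_ , g) with insert zero j w ⟨$⟩ˡ zero in eq
  ... | zero  = ≡.sym (≡.subst (λ i → insert zero j w ⟨$⟩ʳ i ≡ zero) eq (Perm.inverseʳ (insert zero j w)))
  ... | suc i = contradiction
    (≡.subst (j Fin.<_) (≡.trans (≡.cong (insert zero j w ⟨$⟩ʳ_) (≡.sym eq)) (Perm.inverseʳ (insert zero j w))) (g zero (suc i) (s≤s z≤n) z≤n)) λ ()

  split : ∀ j w → indicator (isShuffle? 0 (insert zero j w)) ≡ indicator (zero Finₚ.≟ j) ℚ.* indicator (isShuffle? 0 w)
  split j w = ≡.trans
    (indicator-⇔ (isShuffle? 0 (insert zero j w)) ((zero Finₚ.≟ j) ×-dec isShuffle? 0 w)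
      (λ sh → smallest-first j w sh , (λ _ _ _ ()) , λ a b a<b _ → shrink sh a b a<b)
      (λ { (≡.refl , sh) → (λ _ _ _ ()) , grow sh }))
    (indicator-× (zero Finₚ.≟ j) (isShuffle? 0 w))
    where
    shrink : IsShuffle 0 (insert zero j w) → ∀ a b → a Fin.< b → (w ⟨$⟩ʳ a) Fin.< (w ⟨$⟩ʳ b)
    shrink sh@(_ , g) a b a<b with smallest-first j w sh
    ... | ≡.refl = ℕₚ.≤-pred (g (suc a) (suc b) (s≤s a<b) z≤n)

    grow : IsShuffle 0 w → ∀ a b → a Fin.< b → 0 ≤ toℕ a → (insert zero zero w ⟨$⟩ʳ a) Fin.< (insert zero zero w ⟨$⟩ʳ b)
    grow (_ , g) zero    (suc b) a<b       _ = s≤s z≤n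
    grow (_ , g) (suc a) (suc b) (s≤s a<b) _ = s≤s (g a b a<b z≤n)

-- The lower bound j on the values of the first block makes the count of shuffles recursive: it is
-- the first value, which bounds the rest of its block.
FrontShuffle : ∀ {n} → ℕ → ℕ → Perm n → Set
FrontShuffle i j w = IsShuffle i w × (∀ p → toℕ p < i → j ≤ toℕ (w ⟨$⟩ʳ p))

frontShuffle? : ∀ {n} i j (w : Perm n) → Dec (FrontShuffle i j w)
frontShuffle? i j w = isShuffle? i w ×-dec
  Finₚ.all? (λ p → (toℕ p ℕₚ.<? i) →-dec (j ℕₚ.≤? toℕ (w ⟨$⟩ʳ p)))

-- The first value `k` must respect the bound `j`, and the rest of its block must exceed `k`. Once
-- `k` is deleted and larger values are lowered by one, exceeding `k` becomes being at least `k`, so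
-- `k` is the new bound.
frontShuffle-insert : ∀ {n} i j k (w : Perm n) →
  indicator (frontShuffle? (suc i) j (insert zero k w)) ≡ indicator (j ℕₚ.≤? toℕ k) ℚ.* indicator (frontShuffle? i (toℕ k) w)
frontShuffle-insert i j k w = ≡.trans
  (indicator-⇔ (frontShuffle? (suc i) j (insert zero k w)) ((j ℕₚ.≤? toℕ k) ×-dec frontShuffle? i (toℕ k) w)
    (λ ((f , g) , h) → h zero (s≤s z≤n) ,
      ((λ a b a<b b<i → punchIn-cancel-< (f (suc a) (suc b) (s≤s a<b) (s≤s b<i))) ,
       (λ a b a<b i≤a → punchIn-cancel-< (g (suc a) (suc b) (s≤s a<b) (s≤s i≤a)))) ,
      λ a a<i → above (f zero (suc a) (s≤s z≤n) (s≤s a<i)))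
    (λ (j≤k , (f , g) , h) →
      ((λ { zero    zero    ()        b<i
          ; zero    (suc b) a<b       (s≤s b<i) → shift (h b b<i)
          ; (suc a) (suc b) (s≤s a<b) (s≤s b<i) → punchIn-mono-< k (f a b a<b b<i) }) ,
       (λ { (suc a) (suc b) (s≤s a<b) (s≤s i≤a) → punchIn-mono-< k (g a b a<b i≤a) })) ,
      λ { zero    a<i       → j≤k
        ; (suc a) (s≤s a<i) → ℕₚ.≤-trans j≤k (ℕₚ.<⇒≤ (shift (h a a<i))) }))
  (indicator-× (j ℕₚ.≤? toℕ k) (frontShuffle? i (toℕ k) w))
  where
  punchIn-cancel-< : ∀ {a b} → punchIn k a Fin.< punchIn k b → a Fin.< b
  punchIn-cancel-< {a} {b} p = ℕₚ.≰⇒> (λ b≤a → ℕₚ.<⇒≱ p (Finₚ.punchIn-mono-≤ k b a b≤a))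

  above : ∀ {a} → toℕ k < toℕ (punchIn k a) → toℕ k ≤ toℕ a
  above {a} p = ℕₚ.≮⇒≥ (λ a<k → ℕₚ.<-asym p (≡.subst (_< toℕ k) (≡.sym (below k a a<k)) a<k))
    where
    below : ∀ {n} (k : Fin (suc n)) a → toℕ a < toℕ k → toℕ (punchIn k a) ≡ toℕ a
    below (suc k) zero    p       = ≡.refl
    below (suc k) (suc a) (s≤s p) = ≡.cong suc (below k a p)

  shift : ∀ {a} → toℕ k ≤ toℕ a → toℕ k < toℕ (punchIn k a)
  shift {a} p = beyond k a p
    where
    beyond : ∀ {n} (k : Fin (suc n)) a → toℕ k ≤ toℕ a → toℕ k < toℕ (punchIn k a)
    beyond zero    a       p       = s≤s p
    beyond (suc k) (suc a) (s≤s p) = s≤s (beyond k a p)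

-- The surviving terms are 2^(n-j), ..., 2, 1, and one further 1, later the contribution of the
-- empty first block, completes them to a power of two. For j = n + 1 no term survives and only that
-- 1 remains.
geometric-sum : ∀ n j → j ≤ suc n →
  1ℚ ℚ.+ sum {suc n} (λ k → indicator (j ℕₚ.≤? toℕ k) ℚ.* (2ℚ ^ℚ (n ∸ toℕ k))) ≡ 2ℚ ^ℚ (suc n ∸ j)
geometric-sum zero    zero          _ = ≡.refl
geometric-sum zero    (suc zero)    _ = ≡.refl
geometric-sum zero    (suc (suc j)) (s≤s ())
geometric-sum (suc n) zero          _ = begin
  1ℚ ℚ.+ (1ℚ ℚ.* x ℚ.+ sum {suc n} (λ k → indicator (0 ℕₚ.≤? toℕ k) ℚ.* (2ℚ ^ℚ (n ∸ toℕ k))))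
    ≡⟨ ≡.cong (1ℚ ℚ.+_) (ℚₚ.+-comm (1ℚ ℚ.* x) S) ⟩
  1ℚ ℚ.+ (S ℚ.+ 1ℚ ℚ.* x)
    ≡⟨ ≡.sym (ℚₚ.+-assoc 1ℚ S (1ℚ ℚ.* x)) ⟩
  (1ℚ ℚ.+ S) ℚ.+ 1ℚ ℚ.* x
    ≡⟨ ≡.cong₂ ℚ._+_ (geometric-sum n zero z≤n) (≡.refl {x = 1ℚ ℚ.* x}) ⟩
  x ℚ.+ 1ℚ ℚ.* x
    ≡⟨ ≡.cong (ℚ._+ 1ℚ ℚ.* x) (≡.sym (ℚₚ.*-identityˡ x)) ⟩
  1ℚ ℚ.* x ℚ.+ 1ℚ ℚ.* x
    ≡⟨ ≡.sym (ℚₚ.*-distribʳ-+ x 1ℚ 1ℚ) ⟩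
  2ℚ ℚ.* x ∎
  where
  open ≡.≡-Reasoning

  x S : ℚ
  x = 2ℚ ^ℚ suc n
  S = sum {suc n} (λ k → indicator (0 ℕₚ.≤? toℕ k) ℚ.* (2ℚ ^ℚ (n ∸ toℕ k)))
geometric-sum (suc n) (suc j) (s≤s p) = ≡.trans
  (≡.cong (1ℚ ℚ.+_) (≡.trans
    (≡.cong₂ ℚ._+_ (ℚₚ.*-zeroˡ (2ℚ ^ℚ suc n))
      (sum-cong-≗ {suc n} (λ k → ≡.cong (ℚ._* (2ℚ ^ℚ (n ∸ toℕ k)))
        (indicator-⇔ (suc j ℕₚ.≤? suc (toℕ k)) (j ℕₚ.≤? toℕ k) ℕₚ.≤-pred s≤s))))
    (ℚₚ.+-identityˡ (sum {suc n} (λ k → indicator (j ℕₚ.≤? toℕ k) ℚ.* (2ℚ ^ℚ (n ∸ toℕ k)))))))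
  (geometric-sum n j p)

-- For each block length a front shuffle is determined by the set of values in its first block, and
-- altogether these sets are the subsets of the n - j values not below `j`. The induction splits off
-- the first value `k` and uses the case of bound `k`.
∑-frontShuffles : ∀ n j → j ≤ n →
  sum {suc n} (λ i → ∑ᴸ (allPerms n) (λ w → indicator (frontShuffle? (toℕ i) j w))) ≡ 2ℚ ^ℚ (n ∸ j)
∑-frontShuffles zero    zero    _ = ≡.refl
∑-frontShuffles (suc n) j       p = begin
  ∑ᴸ (allPerms (suc n)) (λ w → indicator (frontShuffle? 0 j w)) ℚ.+
    sum {suc n} (λ i → ∑ᴸ (allPerms (suc n)) (λ w → indicator (frontShuffle? (suc (toℕ i)) j w)))
    ≡⟨ ≡.cong₂ ℚ._+_
         (≡.trans (∑ᴸ-cong (allPerms (suc n)) (λ w → indicator-⇔ (frontShuffle? 0 j w) (isShuffle? 0 w) proj₁ (λ sh → sh , λ _ ())))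
           (∑-indicator-increasing (suc n)))
         (sum-cong-≗ {suc n} (λ i → ≡.trans (∑ᴸ-allPerms n (λ w → indicator (frontShuffle? (suc (toℕ i)) j w)))
           (sum-cong-≗ {suc n} (λ k → ≡.trans
             (∑ᴸ-cong (allPerms n) (frontShuffle-insert (toℕ i) j k))
             (∑-*ˡ (allPerms n) (indicator (j ℕₚ.≤? toℕ k)) (λ w → indicator (frontShuffle? (toℕ i) (toℕ k) w))))))) ⟩
  1ℚ ℚ.+ sum {suc n} (λ i → sum {suc n} (λ k → indicator (j ℕₚ.≤? toℕ k) ℚ.* front (toℕ i) k))
    ≡⟨ ≡.cong (1ℚ ℚ.+_) (∑-comm {suc n} {suc n} (λ i k → indicator (j ℕₚ.≤? toℕ k) ℚ.* front (toℕ i) k)) ⟩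
  1ℚ ℚ.+ sum {suc n} (λ k → sum {suc n} (λ i → indicator (j ℕₚ.≤? toℕ k) ℚ.* front (toℕ i) k))
    ≡⟨ ≡.cong (1ℚ ℚ.+_) (sum-cong-≗ {suc n} (λ k → ≡.trans
         (≡.sym (*-distribˡ-sum {suc n} (indicator (j ℕₚ.≤? toℕ k)) (λ i → front (toℕ i) k)))
         (≡.cong (indicator (j ℕₚ.≤? toℕ k) ℚ.*_) (∑-frontShuffles n (toℕ k) (ℕₚ.≤-pred (Finₚ.toℕ<n k)))))) ⟩
  1ℚ ℚ.+ sum {suc n} (λ k → indicator (j ℕₚ.≤? toℕ k) ℚ.* (2ℚ ^ℚ (n ∸ toℕ k)))
    ≡⟨ geometric-sum n j p ⟩
  2ℚ ^ℚ (suc n ∸ j) ∎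
  where
  open ≡.≡-Reasoning
  open SemiringSum (Ring.semiring ℚ-ring) using (∑-comm)

  front : ℕ → Fin (suc n) → ℚ
  front i k = ∑ᴸ (allPerms n) (λ w → indicator (frontShuffle? i (toℕ k) w))

-- Over all block lengths there are 2^(n+1) shuffles. The lengths 0 and n + 1, which are absent from
-- `s`, allow only the identity and account for the subtracted 2.
∑-shuffleCount : ∀ n → ∑ᴸ (allPerms (suc n)) shuffleCount ≡ eigenvalue (suc n)
∑-shuffleCount n = begin
  ∑ᴸ (allPerms (suc n)) shuffleCount
    ≡⟨ ∑ᴸ-sum (allPerms (suc n)) {n} (λ w k → indicator (isShuffle? (suc (toℕ k)) w)) ⟩
  S
    ≡⟨ isolate 1ℚ S ⟩
  (1ℚ ℚ.+ (S ℚ.+ 1ℚ)) ℚ.- 2ℚ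
    ≡⟨ ≡.cong (ℚ._- 2ℚ) (≡.sym total) ⟩
  eigenvalue (suc n) ∎
  where
  open ≡.≡-Reasoning

  count : ℕ → ℚ
  count i = ∑ᴸ (allPerms (suc n)) (λ w → indicator (isShuffle? i w))

  S : ℚ
  S = sum {n} (λ k → count (suc (toℕ k)))

  isolate : ∀ p q → q ≡ (p ℚ.+ (q ℚ.+ p)) ℚ.- (p ℚ.+ p)
  isolate p q = ≡.sym (≡.trans (≡.cong (ℚ._- (p ℚ.+ p)) (x∙yz≈y∙xz p q p))
    (≡.trans (ℚₚ.+-assoc q (p ℚ.+ p) _) (≡.trans (≡.cong (q ℚ.+_) (ℚₚ.+-inverseʳ (p ℚ.+ p))) (ℚₚ.+-identityʳ q))))
    where open CommutativeSemigroupProperties (CommutativeMonoid.commutativeSemigroup ℚₚ.+-0-commutativeMonoid) using (x∙yz≈y∙xz)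

  all-in-front : count (suc (toℕ (fromℕ n))) ≡ 1ℚ
  all-in-front = ≡.trans (∑ᴸ-cong (allPerms (suc n)) (λ w → indicator-⇔ (isShuffle? (suc (toℕ (fromℕ n))) w) (isShuffle? 0 w)
      (λ (f , _) → (λ _ _ _ ()) , λ a b a<b _ → f a b a<b (bound b))
      (λ (_ , g) → (λ a b a<b _ → g a b a<b z≤n) , λ a b a<b _ → g a b a<b z≤n)))
    (∑-indicator-increasing (suc n))
    where
    bound : ∀ b → toℕ b < suc (toℕ (fromℕ n))
    bound b = ≡.subst (λ k → toℕ b < suc k) (≡.sym (Finₚ.toℕ-fromℕ n)) (Finₚ.toℕ<n b)

  total : 2ℚ ^ℚ suc n ≡ 1ℚ ℚ.+ (S ℚ.+ 1ℚ)
  total = ≡.trans (≡.sym (∑-frontShuffles (suc n) 0 z≤n)) (≡.trans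
    (sum-cong-≗ {suc (suc n)} (λ i → ∑ᴸ-cong (allPerms (suc n)) (λ w →
      indicator-⇔ (frontShuffle? (toℕ i) 0 w) (isShuffle? (toℕ i) w) proj₁ (λ sh → sh , λ _ _ → z≤n))))
    (≡.cong₂ ℚ._+_ (∑-indicator-increasing (suc n))
      (≡.trans (sum-init-last {n} (λ i → count (suc (toℕ i))))
        (≡.cong₂ ℚ._+_ (sum-cong-≗ {n} (λ k → ≡.cong (λ i → count (suc i)) (Finₚ.toℕ-inject₁ k))) all-in-front))))

-- The top eigenspace

module _ {n : ℕ} where

  combine : (Perm n → ℚ) → ℚ[𝔖 n ]
  combine c = ∑ⱽ (ℚ𝔖 n) (allPerms n) (λ w → c w *ᴱ gen w)

  coeff-combine : ∀ {c} → (∀ {u w} → u Perm.≈ w → c u ≡ c w) → ∀ u → coeff u (combine c) ≡ c u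
  coeff-combine {c} c-cong u = ≡.trans (coeff-list (allPerms n))
    (∑-select u c (λ {w} p → ≡.sym (c-cong {u} {w} p)))
    where
    coeff-list : ∀ ws → coeff u (∑ⱽ (ℚ𝔖 n) ws (λ w → c w *ᴱ gen w)) ≡ ∑ᴸ ws (λ w → indicator (u ≟ₚ w) ℚ.* c w)
    coeff-list []       = ≡.refl
    coeff-list (w ∷ ws) = ≡.cong₂ ℚ._+_
      (≡.trans (ℚₚ.*-comm (c w) (indicator (w ≟ₚ u)))
        (≡.cong (ℚ._* c w) (indicator-⇔ (w ≟ₚ u) (u ≟ₚ w) (≈ₚ-sym {u = w} {u}) (≈ₚ-sym {u = u} {w}))))
      (coeff-list ws)

  ε : ℚ[𝔖 n ]
  ε = combine sgn

  coeff-ε : ∀ u → coeff u ε ≡ sgn u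
  coeff-ε = coeff-combine (λ {u} {w} → sgn-cong {u = u} {w})

  ε-·ₐ : ∀ (w : Perm n) → ε ·ₐ w ≈ₐ sgn w *ᴱ ε
  ε-·ₐ w = coeff-ext λ u → begin
    coeff u (ε ·ₐ w)         ≡⟨ coeff-·ₐ u w ε ⟩
    coeff (u ∙ w ⁻¹) ε       ≡⟨ coeff-ε (u ∙ w ⁻¹) ⟩
    sgn (u ∙ w ⁻¹)           ≡⟨ sgn-∙ u (w ⁻¹) ⟩
    sgn u ℚ.* sgn (w ⁻¹)     ≡⟨ ℚₚ.*-comm (sgn u) (sgn (w ⁻¹)) ⟩
    sgn (w ⁻¹) ℚ.* sgn u     ≡⟨ ≡.cong₂ ℚ._*_ (sgn-⁻¹ w) (≡.sym (coeff-ε u)) ⟩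
    sgn w ℚ.* coeff u ε ∎
    where open ≡.≡-Reasoning

  -- Since `sgn w = sgn u · sgn (w⁻¹ u)`, the signs of `s n` can be absorbed into the coefficients
  -- of `x`. Multiplication by `s n` then acts on `sgn u · coeff u x` with the nonnegative weights
  -- `shuffleCount`.
  coeff-s-*ₐ : ∀ (u : Perm n) x → coeff u (s n *ₐ x) ≡
               ∑ᴸ (allPerms n) (λ w → sgn u ℚ.* (shuffleCount w ℚ.* (sgn (w ⁻¹ ∙ u) ℚ.* coeff (w ⁻¹ ∙ u) x)))
  coeff-s-*ₐ u x = ≡.trans (coeff-*ₐ u (s n) x) (∑ᴸ-cong (allPerms n) λ w →
    ≡.trans (≡.cong₂ (λ b c → b ℚ.* c) (coeff-s w) (≡.refl {x = coeff (w ⁻¹ ∙ u) x}))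
      (rearrange (shuffleCount w) (sgn u) (sgn w) (coeff (w ⁻¹ ∙ u) x) (sgn (w ⁻¹ ∙ u)) (sgn-square u)
        (≡.trans (sgn-∙ (w ⁻¹) u) (≡.cong (ℚ._* sgn u) (sgn-⁻¹ w)))))
    where
    open ≡.≡-Reasoning

    rearrange : ∀ a b c d e → b ℚ.* b ≡ 1ℚ → e ≡ c ℚ.* b → a ℚ.* c ℚ.* d ≡ b ℚ.* (a ℚ.* (e ℚ.* d))
    rearrange a b c d e b²≡1 ≡.refl = ≡.sym (begin
      b ℚ.* (a ℚ.* (c ℚ.* b ℚ.* d))    ≡⟨ ≡.sym (ℚₚ.*-assoc b a _) ⟩
      b ℚ.* a ℚ.* (c ℚ.* b ℚ.* d)      ≡⟨ ≡.cong₂ ℚ._*_ (ℚₚ.*-comm b a) (≡.trans (≡.cong (ℚ._* d) (ℚₚ.*-comm c b)) (ℚₚ.*-assoc b c d)) ⟩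
      a ℚ.* b ℚ.* (b ℚ.* (c ℚ.* d))    ≡⟨ ℚₚ.*-assoc a b _ ⟩
      a ℚ.* (b ℚ.* (b ℚ.* (c ℚ.* d)))  ≡⟨ ≡.cong (a ℚ.*_) (≡.trans (≡.sym (ℚₚ.*-assoc b b _)) (≡.cong (ℚ._* (c ℚ.* d)) b²≡1)) ⟩
      a ℚ.* (1ℚ ℚ.* (c ℚ.* d))         ≡⟨ ≡.cong (a ℚ.*_) (ℚₚ.*-identityˡ _) ⟩
      a ℚ.* (c ℚ.* d)                  ≡⟨ ≡.sym (ℚₚ.*-assoc a c d) ⟩
      a ℚ.* c ℚ.* d ∎)

-- Twisted by the sign, s (suc n) is a sum of shuffles with nonnegative weights of total 2^(n+1) − 2,
-- so an eigenvector for this eigenvalue is a mean-value function of the shuffles.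
module TopEigenspace (n : ℕ) where

  private
    N : ℕ
    N = suc n

  twisted-≤ : ∀ x → InEigenspace N N x → ∀ u → sgn u ℚ.* coeff u x ℚ.≤ sgn (Perm.id {N}) ℚ.* coeff Perm.id x
  twisted-≤ x eig = MaximumPrinciple.maximal-at-id shuffleCount (λ u → sgn u ℚ.* coeff u x)
    (λ {u} {w} → shuffleCount-cong {N} {u} {w})
    (λ {u} {w} p → ≡.cong₂ ℚ._*_ (sgn-cong {u = u} {w} p) (coeff-resp {u = u} {w} p x))
    shuffleCount-≥0 shuffleCount-≥1 mean
    where
    open ≡.≡-Reasoning

    mean : ∀ u → ∑ᴸ (allPerms N) (λ w → shuffleCount w ℚ.* (sgn (w ⁻¹ ∙ u) ℚ.* coeff (w ⁻¹ ∙ u) x))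
               ≡ ∑ᴸ (allPerms N) shuffleCount ℚ.* (sgn u ℚ.* coeff u x)
    mean u = begin
      T                                            ≡⟨ ≡.sym (ℚₚ.*-identityˡ T) ⟩
      1ℚ ℚ.* T                                     ≡⟨ ≡.cong (ℚ._* T) (≡.sym (sgn-square u)) ⟩
      sgn u ℚ.* sgn u ℚ.* T                        ≡⟨ ℚₚ.*-assoc (sgn u) (sgn u) T ⟩
      sgn u ℚ.* (sgn u ℚ.* T)                      ≡⟨ ≡.cong (sgn u ℚ.*_) (≡.sym (≡.trans (coeff-s-*ₐ u x) (∑-*ˡ (allPerms N) (sgn u) _))) ⟩
      sgn u ℚ.* coeff u (s N *ₐ x)                 ≡⟨ ≡.cong (sgn u ℚ.*_) (coeff-cong u {s N *ₐ x} {eigenvalue N *ᴱ x} eig) ⟩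
      sgn u ℚ.* (eigenvalue N ℚ.* coeff u x)       ≡⟨ ≡.cong (λ l → sgn u ℚ.* (l ℚ.* coeff u x)) (≡.sym (∑-shuffleCount n)) ⟩
      sgn u ℚ.* (∑ᴸ (allPerms N) shuffleCount ℚ.* coeff u x)  ≡⟨ *ₗ-swap ℚᵥ (sgn u) (∑ᴸ (allPerms N) shuffleCount) (coeff u x) ⟩
      ∑ᴸ (allPerms N) shuffleCount ℚ.* (sgn u ℚ.* coeff u x) ∎
      where
      T : ℚ
      T = ∑ᴸ (allPerms N) (λ w → shuffleCount w ℚ.* (sgn (w ⁻¹ ∙ u) ℚ.* coeff (w ⁻¹ ∙ u) x))

  -- The maximum principle puts the maximum of the twisted coefficients at the identity; applied to
  -- `-ᴱ x` it puts the minimum there as well. So the twisted coefficients are constant.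
  spanned-by-ε : ∀ x → InEigenspace N N x → x ≈ₐ coeff Perm.id x *ᴱ ε
  spanned-by-ε x eig = coeff-ext λ u → ≡.trans (coefficient u)
    (≡.trans (ℚₚ.*-comm (sgn u) (coeff Perm.id x)) (≡.cong (coeff Perm.id x ℚ.*_) (≡.sym (coeff-ε u))))
    where
    neg-eig : InEigenspace N N (-ᴱ x)
    neg-eig = trans (neg-cong eig) (sym (*ₗ-neg (ℚ𝔖 N) (eigenvalue N) x))

    constant : ∀ u → sgn u ℚ.* coeff u x ≡ sgn (Perm.id {N}) ℚ.* coeff Perm.id x
    constant u = ℚₚ.≤-antisym (twisted-≤ x eig u) (neg-cancel
      (≡.subst₂ ℚ._≤_ (≡.sym (ℚₚ.neg-distribʳ-* (sgn u) (coeff u x)))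
        (≡.sym (ℚₚ.neg-distribʳ-* (sgn (Perm.id {N})) (coeff Perm.id x))) (twisted-≤ (-ᴱ x) neg-eig u)))
      where
      module ℚ-neg = AbelianGroupProperties (Ring.+-abelianGroup ℚ-ring)

      neg-cancel : ∀ {p q} → ℚ.- p ℚ.≤ ℚ.- q → q ℚ.≤ p
      neg-cancel {p} {q} r = ≡.subst₂ ℚ._≤_ (ℚ-neg.⁻¹-involutive q) (ℚ-neg.⁻¹-involutive p) (ℚₚ.neg-antimono-≤ r)

    coefficient : ∀ u → coeff u x ≡ sgn u ℚ.* coeff Perm.id x
    coefficient u = begin
      coeff u x                                        ≡⟨ ≡.sym (ℚₚ.*-identityˡ _) ⟩
      1ℚ ℚ.* coeff u x                                 ≡⟨ ≡.cong (ℚ._* coeff u x) (≡.sym (sgn-square u)) ⟩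
      sgn u ℚ.* sgn u ℚ.* coeff u x                    ≡⟨ ℚₚ.*-assoc (sgn u) (sgn u) (coeff u x) ⟩
      sgn u ℚ.* (sgn u ℚ.* coeff u x)                  ≡⟨ ≡.cong (sgn u ℚ.*_) (constant u) ⟩
      sgn u ℚ.* (sgn (Perm.id {N}) ℚ.* coeff Perm.id x)  ≡⟨ ≡.cong (λ b → sgn u ℚ.* (b ℚ.* coeff Perm.id x)) (sgn-id {N}) ⟩
      sgn u ℚ.* (1ℚ ℚ.* coeff Perm.id x)               ≡⟨ ≡.cong (sgn u ℚ.*_) (ℚₚ.*-identityˡ _) ⟩
      sgn u ℚ.* coeff Perm.id x ∎
      where open ≡.≡-Reasoning

  ε-eigen : InEigenspace N N ε
  ε-eigen = coeff-ext λ u → begin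
    coeff u (s N *ₐ ε)
      ≡⟨ coeff-s-*ₐ u ε ⟩
    ∑ᴸ (allPerms N) (λ w → sgn u ℚ.* (shuffleCount w ℚ.* (sgn (w ⁻¹ ∙ u) ℚ.* coeff (w ⁻¹ ∙ u) ε)))
      ≡⟨ ∑ᴸ-cong (allPerms N) (λ w → ≡.cong (λ b → sgn u ℚ.* b) (≡.trans (≡.cong (shuffleCount w ℚ.*_)
           (≡.trans (≡.cong (sgn (w ⁻¹ ∙ u) ℚ.*_) (coeff-ε (w ⁻¹ ∙ u))) (sgn-square (w ⁻¹ ∙ u)))) (ℚₚ.*-identityʳ (shuffleCount w)))) ⟩
    ∑ᴸ (allPerms N) (λ w → sgn u ℚ.* shuffleCount w)
      ≡⟨ ∑-*ˡ (allPerms N) (sgn u) shuffleCount ⟩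
    sgn u ℚ.* ∑ᴸ (allPerms N) shuffleCount
      ≡⟨ ≡.cong₂ ℚ._*_ (≡.sym (coeff-ε u)) (∑-shuffleCount n) ⟩
    coeff u ε ℚ.* eigenvalue N
      ≡⟨ ℚₚ.*-comm (coeff u ε) (eigenvalue N) ⟩
    eigenvalue N ℚ.* coeff u ε ∎
    where open ≡.≡-Reasoning

  module _ {e : ℚ[𝔖 N ]} (idem : IsEulerianIdempotent N N e) where
    open IsEulerianIdempotent idem

    e-*ₐ-ε : e *ₐ ε ≈ₐ ε
    e-*ₐ-ε = fixes ε ε-eigen

    e-≈-ε : e ≈ₐ coeff Perm.id e *ᴱ ε
    -- `e` lies in the eigenspace because it is its own product with the identity, to which `into`
    -- applies.
    e-≈-ε = spanned-by-ε e (trans (*ₐ-congʳ (s N) {e} {e *ₐ gen Perm.id} (sym (*ₐ-identityʳ e)))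
      (trans (into (gen Perm.id)) (*-cong (eigenvalue N) (*ₐ-identityʳ e))))

top-*ₐ-ε : ∀ {n} {e : ℚ[𝔖 n ]} → 1 ≤ n → IsEulerianIdempotent n n e → e *ₐ ε ≈ₐ ε
top-*ₐ-ε {suc n} _ = TopEigenspace.e-*ₐ-ε n

top-≈-ε : ∀ {n} {e : ℚ[𝔖 n ]} → 1 ≤ n → IsEulerianIdempotent n n e → e ≈ₐ coeff Perm.id e *ᴱ ε
top-≈-ε {suc n} _ = TopEigenspace.e-≈-ε n

-- The cycle and Λ

module _ (V : VectorSpace) where
  open LeftModule V
  open import Algebra.Definitions.RawMonoid +ᴹ-rawMonoid using () renaming (sum to sumⱽ)
  open MonoidSum +ᴹ-commutativeMonoid using () renaming (sum-init-last to sumⱽ-init-last; sum-cong-≗ to sumⱽ-cong-≗)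

  linear-sum : ∀ {G : Set} {R : Expr G → Expr G → Set} {φ} → Linear V φ → ∀ {n} (f : Fin n → Expr G) →
               φ (MonoidSum.sum (LeftModule.+ᴹ-commutativeMonoid (presented G R)) f) ≈ᴹ sumⱽ (λ i → φ (f i))
  linear-sum L {zero}  f = Linear.0-homo L
  linear-sum {R = R} L {suc n} f = ≈ᴹ-trans (Linear.+-homo L _ _) (+ᴹ-cong ≈ᴹ-refl (linear-sum {R = R} L (f ∘ suc)))

  -- Both sides complete to the sum of `f` over 0, ..., n, the left one by `f 0` and the right one
  -- by `f n`.
  sum-shift : ∀ n (f : ℕ → Carrierᴹ) → f n ≈ᴹ f 0 →
              sumⱽ {n} (λ i → f (suc (toℕ i))) ≈ᴹ sumⱽ {n} (λ i → f (toℕ i))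
  sum-shift n f p = ∙-cancelˡ (f 0) _ _ (≈ᴹ-trans (sumⱽ-init-last {n} (λ i → f (toℕ i)))
    (≈ᴹ-trans (+ᴹ-cong
      (≈ᴹ-reflexive (sumⱽ-cong-≗ {n} (λ i → ≡.cong f (Finₚ.toℕ-inject₁ i))))
      (≈ᴹ-trans (≈ᴹ-reflexive (≡.cong f (Finₚ.toℕ-fromℕ n))) p))
    (+ᴹ-comm _ _)))
    where
    open import Algebra.Properties.Group +ᴹ-group using () renaming (∙-cancelˡ to ∙-cancelˡ)

^ₚ-+ : ∀ {n} (w : Perm n) a b i → (w ^ₚ (a ℕ.+ b)) ⟨$⟩ʳ i ≡ (w ^ₚ a) ⟨$⟩ʳ ((w ^ₚ b) ⟨$⟩ʳ i)
^ₚ-+ w zero    b i = ≡.refl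
^ₚ-+ w (suc a) b i = ≡.cong (w ⟨$⟩ʳ_) (^ₚ-+ w a b i)

^ₚ-suc : ∀ {n} (w : Perm n) k i → (w ^ₚ k) ⟨$⟩ʳ (w ⟨$⟩ʳ i) ≡ (w ^ₚ suc k) ⟨$⟩ʳ i
^ₚ-suc w zero    i = ≡.refl
^ₚ-suc w (suc k) i = ≡.cong (w ⟨$⟩ʳ_) (^ₚ-suc w k i)

module Cycle (m : ℕ) where

  c : Perm (suc m)
  c = cycle m

  last : Fin (suc m)
  last = fromℕ m

  cycle-inject₁ : ∀ i → c ⟨$⟩ʳ inject₁ i ≡ suc i
  cycle-inject₁ i = ≡.trans (≡.cong (c ⟨$⟩ʳ_) (≡.sym (punchIn-fromℕ i))) (insert-punchIn last zero Perm.id i)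

  cycle-last : c ⟨$⟩ʳ last ≡ zero
  cycle-last = insert-self last zero Perm.id

  data View : Fin (suc m) → Set where
    inner : ∀ i → View (inject₁ i)
    final : View last

  view : ∀ i → View i
  view = go
    where
    lift : ∀ {k} → (i : Fin (suc k)) → (∃[ j ] i ≡ inject₁ j) ⊎ i ≡ fromℕ k
    lift {zero}  zero    = inj₂ ≡.refl
    lift {suc k} zero    = inj₁ (zero , ≡.refl)
    lift {suc k} (suc i) with lift i
    ... | inj₁ (j , p) = inj₁ (suc j , ≡.cong suc p)
    ... | inj₂ p       = inj₂ (≡.cong suc p)

    go : ∀ i → View i
    go i with lift i
    ... | inj₁ (j , ≡.refl) = inner j
    ... | inj₂ ≡.refl       = final

  toℕ-cycle : ∀ p → toℕ p < m → toℕ (c ⟨$⟩ʳ p) ≡ suc (toℕ p)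
  toℕ-cycle p p<m with view p
  ... | inner i = ≡.trans (≡.cong toℕ (cycle-inject₁ i)) (≡.cong suc (≡.sym (Finₚ.toℕ-inject₁ i)))
  ... | final   = contradiction p<m (ℕₚ.<-irrefl (Finₚ.toℕ-fromℕ m))

  toℕ-power-last : ∀ k → k ≤ m → toℕ ((c ^ₚ suc k) ⟨$⟩ʳ last) ≡ k
  toℕ-power-last zero    _ = ≡.cong toℕ cycle-last
  toℕ-power-last (suc k) p = ≡.trans (toℕ-cycle _ (≡.subst (_< m) (≡.sym ih) p)) (≡.cong suc ih)
    where
    ih : toℕ ((c ^ₚ suc k) ⟨$⟩ʳ last) ≡ k
    ih = toℕ-power-last k (ℕₚ.<⇒≤ p)

  power-from-last : ∀ p → (c ^ₚ suc (toℕ p)) ⟨$⟩ʳ last ≡ p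
  power-from-last p = Finₚ.toℕ-injective (toℕ-power-last (toℕ p) (ℕₚ.≤-pred (Finₚ.toℕ<n p)))

  power-moves-last : ∀ k → k < m → (c ^ₚ suc k) ⟨$⟩ʳ last ≢ last
  power-moves-last k k<m p = ℕₚ.<-irrefl
    (≡.trans (≡.sym (toℕ-power-last k (ℕₚ.<⇒≤ k<m))) (≡.trans (≡.cong toℕ p) (Finₚ.toℕ-fromℕ m))) k<m

  -- Every point is a power of `c` applied to `last`, and powers of `c` commute; hence it suffices
  -- that `last` returns after m + 1 steps.
  cycle-period : (c ^ₚ suc m) Perm.≈ Perm.id
  cycle-period p = begin
    (c ^ₚ suc m) ⟨$⟩ʳ p                             ≡⟨ ≡.cong ((c ^ₚ suc m) ⟨$⟩ʳ_) (≡.sym (power-from-last p)) ⟩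
    (c ^ₚ suc m) ⟨$⟩ʳ ((c ^ₚ j) ⟨$⟩ʳ last)          ≡⟨ ≡.sym (^ₚ-+ c (suc m) j last) ⟩
    (c ^ₚ (suc m ℕ.+ j)) ⟨$⟩ʳ last                  ≡⟨ ≡.cong (λ k → (c ^ₚ k) ⟨$⟩ʳ last) (ℕₚ.+-comm (suc m) j) ⟩
    (c ^ₚ (j ℕ.+ suc m)) ⟨$⟩ʳ last                  ≡⟨ ^ₚ-+ c j (suc m) last ⟩
    (c ^ₚ j) ⟨$⟩ʳ ((c ^ₚ suc m) ⟨$⟩ʳ last)          ≡⟨ ≡.cong ((c ^ₚ j) ⟨$⟩ʳ_) (Finₚ.toℕ-injective (≡.trans (toℕ-power-last m ℕₚ.≤-refl) (≡.sym (Finₚ.toℕ-fromℕ m)))) ⟩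
    (c ^ₚ j) ⟨$⟩ʳ last                              ≡⟨ power-from-last p ⟩
    p ∎
    where
    open ≡.≡-Reasoning

    j : ℕ
    j = suc (toℕ p)

  power-to-last : ∀ p → (c ^ₚ (m ∸ toℕ p)) ⟨$⟩ʳ p ≡ last
  power-to-last p = begin
    (c ^ₚ (m ∸ toℕ p)) ⟨$⟩ʳ p
      ≡⟨ ≡.cong ((c ^ₚ (m ∸ toℕ p)) ⟨$⟩ʳ_) (≡.sym (power-from-last p)) ⟩
    (c ^ₚ (m ∸ toℕ p)) ⟨$⟩ʳ ((c ^ₚ suc (toℕ p)) ⟨$⟩ʳ last)
      ≡⟨ ≡.sym (^ₚ-+ c (m ∸ toℕ p) (suc (toℕ p)) last) ⟩
    (c ^ₚ (m ∸ toℕ p ℕ.+ suc (toℕ p))) ⟨$⟩ʳ last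
      ≡⟨ ≡.cong (λ k → (c ^ₚ k) ⟨$⟩ʳ last) (≡.trans (ℕₚ.+-suc (m ∸ toℕ p) (toℕ p))
           (≡.cong suc (ℕₚ.m∸n+n≡m (ℕₚ.≤-pred (Finₚ.toℕ<n p))))) ⟩
    (c ^ₚ suc m) ⟨$⟩ʳ last
      ≡⟨ cycle-period last ⟩
    last ∎
    where open ≡.≡-Reasoning

  restrict : Perm (suc m) → Perm m
  restrict u = remove last u

  ι-restrict : ∀ u → u ⟨$⟩ʳ last ≡ last → ι (restrict u) Perm.≈ u
  ι-restrict u p i = ≡.trans (≡.cong (λ j → insert last j (remove last u) ⟨$⟩ʳ i) (≡.sym p)) (insert-remove last u i)

  -- The exponents are chosen so that the power of `c` carries `last` to `u last` on the left, and
  -- `u⁻¹ last` to `last` on the right. Dividing by it leaves a permutation that fixes `last`, that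
  -- is, one in the image of `ι`.
  leftPower rightPower : Perm (suc m) → ℕ
  leftPower  u = suc (toℕ (u ⟨$⟩ʳ last))
  rightPower u = m ∸ toℕ (u ⟨$⟩ˡ last)

  leftPart rightPart : Perm (suc m) → Perm m
  leftPart  u = restrict ((c ^ₚ leftPower u) ⁻¹ ∙ u)
  rightPart u = restrict (u ∙ (c ^ₚ rightPower u) ⁻¹)

  factorˡ : ∀ u → u Perm.≈ ((c ^ₚ leftPower u) ∙ ι (leftPart u))
  factorˡ u i = ≡.trans (≡.sym (∙-⁻¹-cancel cᵏ u i)) (≡.cong (cᵏ ⟨$⟩ʳ_) (≡.sym (ι-restrict (cᵏ ⁻¹ ∙ u) fixes-last i)))
    where
    cᵏ : Perm (suc m)
    cᵏ = c ^ₚ leftPower u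

    fixes-last : (cᵏ ⁻¹ ∙ u) ⟨$⟩ʳ last ≡ last
    fixes-last = ≡.trans (≡.cong (cᵏ ⟨$⟩ˡ_) (≡.sym (power-from-last (u ⟨$⟩ʳ last)))) (Perm.inverseˡ cᵏ)

  factorʳ : ∀ u → u Perm.≈ (ι (rightPart u) ∙ (c ^ₚ rightPower u))
  factorʳ u i = ≡.trans (≡.cong (u ⟨$⟩ʳ_) (≡.sym (Perm.inverseˡ cᵏ)))
    (≡.sym (ι-restrict (u ∙ cᵏ ⁻¹) fixes-last (cᵏ ⟨$⟩ʳ i)))
    where
    cᵏ : Perm (suc m)
    cᵏ = c ^ₚ rightPower u

    fixes-last : (u ∙ cᵏ ⁻¹) ⟨$⟩ʳ last ≡ last
    fixes-last = ≡.trans (≡.cong (λ i → u ⟨$⟩ʳ (cᵏ ⟨$⟩ˡ i)) (≡.sym (power-to-last (u ⟨$⟩ˡ last))))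
      (≡.trans (≡.cong (u ⟨$⟩ʳ_) (Perm.inverseˡ cᵏ)) (Perm.inverseʳ u))

  ι-cong : ∀ {u w : Perm m} → u Perm.≈ w → ι u Perm.≈ ι w
  ι-cong {u} {w} = insert-cong last last {u} {w}

  ι-cancel : ∀ {u w : Perm m} → ι u Perm.≈ ι w → u Perm.≈ w
  ι-cancel {u} {w} p i = Finₚ.inject₁-injective
    (≡.trans (≡.sym (ι-inject₁ u i)) (≡.trans (p (inject₁ i)) (ι-inject₁ w i)))

  ι-∙ : ∀ (u w : Perm m) → ι (u ∙ w) Perm.≈ (ι u ∙ ι w)
  ι-∙ u w i with view i
  ... | inner j = ≡.trans (ι-inject₁ (u ∙ w) j)
    (≡.sym (≡.trans (≡.cong (ι u ⟨$⟩ʳ_) (ι-inject₁ w j)) (ι-inject₁ u (w ⟨$⟩ʳ j))))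
  ... | final   = ≡.trans (ι-fromℕ (u ∙ w)) (≡.sym (≡.trans (≡.cong (ι u ⟨$⟩ʳ_) (ι-fromℕ w)) (ι-fromℕ u)))

  ι-id : ι (Perm.id {m}) Perm.≈ Perm.id
  ι-id i with view i
  ... | inner j = ι-inject₁ Perm.id j
  ... | final   = ι-fromℕ Perm.id

  ιₐ-linear : Linear (ℚ𝔖 (suc m)) {Perm m} ιₐ
  ιₐ-linear = extend-linear _

  ιₐ-cong : ∀ {x y : ℚ[𝔖 m ]} → x ≈ₐ y → ιₐ x ≈ₐ ιₐ y
  ιₐ-cong = extend-cong λ { (same u w p) → gen-cong {u = ι u} {ι w} (ι-cong {u} {w} p) }

  ιₐ-*ₐ : ∀ (x y : ℚ[𝔖 m ]) → ιₐ (x *ₐ y) ≈ₐ ιₐ x *ₐ ιₐ y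
  ιₐ-*ₐ x = linear-ext (ℚ𝔖 (suc m))
    (linear-∘-extend (ℚ𝔖 (suc m)) (λ w → x ·ₐ w) ιₐ-linear)
    (linear-∘-extend (ℚ𝔖 (suc m)) (λ w → gen (ι w)) (*ₐ-linear (ιₐ x)))
    (λ w → linear-ext (ℚ𝔖 (suc m))
      (linear-∘-extend (ℚ𝔖 (suc m)) (λ u → gen (u ∙ w)) ιₐ-linear)
      (linear-∘-extend (ℚ𝔖 (suc m)) (λ u → gen (ι u)) (·ₐ-linear (ι w)))
      (λ u → gen-cong {u = ι (u ∙ w)} {ι u ∙ ι w} (ι-∙ u w)) x)

  q : ℚ
  q = sgn c

  term : ℕ → ℚ[𝔖 suc m ]
  term k = (q ^ℚ k) *ᴱ gen (c ^ₚ k)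

  term-period : term (suc m) ≈ₐ term 0
  term-period = trans (LeftModule.*ₗ-cong (ℚ𝔖 (suc m)) {q ^ℚ suc m} {1ℚ} q-period refl)
    (*-cong 1ℚ (gen-cong {u = c ^ₚ suc m} {Perm.id} cycle-period))
    where
    q-period : q ^ℚ suc m ≡ 1ℚ
    q-period = ≡.trans (≡.sym (sgn-^ c (suc m))) (≡.trans (sgn-cong {u = c ^ₚ suc m} {Perm.id} cycle-period) (sgn-id {suc m}))

  q-cancel : ∀ {x y : ℚ[𝔖 suc m ]} → q *ᴱ x ≈ₐ y → x ≈ₐ q *ᴱ y
  q-cancel {x} {y} p = trans (sym (*-identity x))
    (trans (LeftModule.*ₗ-cong (ℚ𝔖 (suc m)) (≡.sym (sgn-square c)) refl)
      (trans (*-assoc q q x) (*-cong q p)))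

  -- Serves left and right multiplication by `c` alike: either one turns q times the k-th term into
  -- the next, and the terms are periodic, so rotating the sum gives back `Λ`. The factor `q`
  -- changes sides because q² = 1.
  Λ-shift : ∀ {φ : ℚ[𝔖 suc m ] → ℚ[𝔖 suc m ]} → Linear (ℚ𝔖 (suc m)) φ →
            (∀ k → φ (gen (c ^ₚ k)) ≈ₐ gen (c ^ₚ suc k)) → φ (Λ m) ≈ₐ q *ᴱ Λ m
  Λ-shift {φ} L p = q-cancel (trans
    (linear-sum (ℚ𝔖 (suc m)) {R = SamePerm} (linear-* (ℚ𝔖 (suc m)) q L) {suc m} (λ i → term (toℕ i)))
    (trans (MonoidSum.sum-cong-≋ (LeftModule.+ᴹ-commutativeMonoid (ℚ𝔖 (suc m))) {suc m} (λ i → step (toℕ i)))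
      (sum-shift (ℚ𝔖 (suc m)) (suc m) term term-period)))
    where
    step : ∀ k → q *ᴱ φ (term k) ≈ₐ term (suc k)
    step k = trans (*-cong q (trans (Linear.*-homo L (q ^ℚ k) _) (*-cong (q ^ℚ k) (p k)))) (sym (*-assoc q (q ^ℚ k) _))

  Λ-·ₐ-cycle : Λ m ·ₐ c ≈ₐ q *ᴱ Λ m
  Λ-·ₐ-cycle = Λ-shift (·ₐ-linear c) (λ k → gen-cong {u = (c ^ₚ k) ∙ c} {c ^ₚ suc k} (^ₚ-suc c k))

  cycle-*ₐ-Λ : gen c *ₐ Λ m ≈ₐ q *ᴱ Λ m
  cycle-*ₐ-Λ = Λ-shift (*ₐ-linear (gen c)) (λ k → refl)

  ·ₐ-power : ∀ {x : ℚ[𝔖 suc m ]} → x ·ₐ c ≈ₐ q *ᴱ x → ∀ k → x ·ₐ (c ^ₚ k) ≈ₐ (q ^ℚ k) *ᴱ x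
  ·ₐ-power {x} p zero    = trans (·ₐ-id x) (sym (*-identity x))
  ·ₐ-power {x} p (suc k) = trans (·ₐ-∙ x c (c ^ₚ k))
    (trans (·ₐ-cong (c ^ₚ k) {x ·ₐ c} {q *ᴱ x} p)
      (trans (*-cong q (·ₐ-power p k)) (sym (*-assoc q (q ^ℚ k) x))))

  sum-head : ∀ {n} (f : Fin (suc n) → ℚ) → (∀ i → f (suc i) ≡ 0ℚ) → sum f ≡ f zero
  sum-head {n} f p = ≡.trans (≡.cong (f zero ℚ.+_) (≡.trans (sum-cong-≗ {n} p) (sum-replicate-zero n))) (ℚₚ.+-identityʳ (f zero))

  coeff-Λ : ∀ {φ : ℚ[𝔖 suc m ] → ℚ[𝔖 suc m ]} (u v : Perm (suc m)) → Linear (ℚ𝔖 (suc m)) φ →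
            φ (gen Perm.id) ≈ₐ gen v →
            (∀ k → k < m → coeff u (φ (gen (c ^ₚ suc k))) ≡ 0ℚ) → coeff u (φ (Λ m)) ≡ coeff u (gen v)
  coeff-Λ {φ} u v L p z = begin
    coeff u (φ (Λ m))
      ≡⟨ linear-sum ℚᵥ {R = SamePerm} L′ {suc m} (λ i → term (toℕ i)) ⟩
    sum {suc m} (λ i → coeff u (φ (term (toℕ i))))
      ≡⟨ sum-cong-≗ {suc m} (λ i → Linear.*-homo L′ (q ^ℚ toℕ i) (gen (c ^ₚ toℕ i))) ⟩
    sum {suc m} (λ i → (q ^ℚ toℕ i) ℚ.* coeff u (φ (gen (c ^ₚ toℕ i))))
      ≡⟨ sum-head {m} (λ i → (q ^ℚ toℕ i) ℚ.* coeff u (φ (gen (c ^ₚ toℕ i)))) (λ i →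
           ≡.trans (≡.cong ((q ^ℚ suc (toℕ i)) ℚ.*_) (z (toℕ i) (Finₚ.toℕ<n i))) (ℚₚ.*-zeroʳ (q ^ℚ suc (toℕ i)))) ⟩
    1ℚ ℚ.* coeff u (φ (gen Perm.id))
      ≡⟨ ≡.trans (ℚₚ.*-identityˡ _) (coeff-cong u p) ⟩
    coeff u (gen v) ∎
    where
    open ≡.≡-Reasoning

    L′ : Linear ℚᵥ (λ x → coeff u (φ x))
    L′ = record
      { 0-homo = coeff-cong u (Linear.0-homo L)
      ; +-homo = λ x y → coeff-cong u (Linear.+-homo L x y)
      ; -‿homo = λ x → coeff-cong u (Linear.-‿homo L x)
      ; *-homo = λ r x → coeff-cong u (Linear.*-homo L r x)
      }

  coeff-∘ιₐ : ∀ {φ : ℚ[𝔖 m ] → ℚ[𝔖 suc m ]} → Linear (ℚ𝔖 (suc m)) φ → ∀ h →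
              (∀ w → coeff (ι h) (φ (gen w)) ≡ coeff (ι h) (gen (ι w))) → ∀ x → coeff (ι h) (φ x) ≡ coeff h x
  coeff-∘ιₐ {φ} L h p = linear-ext ℚᵥ
    (record
      { 0-homo = coeff-cong (ι h) (Linear.0-homo L)
      ; +-homo = λ x y → coeff-cong (ι h) (Linear.+-homo L x y)
      ; -‿homo = λ x → coeff-cong (ι h) (Linear.-‿homo L x)
      ; *-homo = λ r x → coeff-cong (ι h) (Linear.*-homo L r x)
      })
    (coeff-linear h)
    (λ w → ≡.trans (p w) (indicator-⇔ (ι w ≟ₚ ι h) (w ≟ₚ h) (ι-cancel {w} {h}) (ι-cong {w} {h})))

  -- The powers of `c` with exponent 1, ..., m move `last`, so they carry 𝔖ₘ into other cosets, and
  -- only the term `id` of `Λ` contributes on 𝔖ₘ. In particular Λ x determines x.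
  coeff-Λ-*ₐ-ιₐ : ∀ h x → coeff (ι h) (Λ m *ₐ ιₐ x) ≡ coeff h x
  coeff-Λ-*ₐ-ιₐ h = coeff-∘ιₐ (linear-∘-extend (ℚ𝔖 (suc m)) (λ w → gen (ι w)) (*ₐ-linear (Λ m))) h
    (λ w → coeff-Λ (ι h) (ι w) (·ₐ-linear (ι w)) (gen-cong {u = Perm.id ∙ ι w} {ι w} (λ _ → ≡.refl))
      (λ k k<m → indicator-no ((c ^ₚ suc k) ∙ ι w ≟ₚ ι h) (λ p → power-moves-last k k<m
        (≡.trans (≡.cong ((c ^ₚ suc k) ⟨$⟩ʳ_) (≡.sym (ι-fromℕ w))) (≡.trans (p last) (ι-fromℕ h))))))

  coeff-ιₐ-*ₐ-Λ : ∀ h x → coeff (ι h) (ιₐ x *ₐ Λ m) ≡ coeff h x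
  coeff-ιₐ-*ₐ-Λ h = coeff-∘ιₐ (linear-∘-extend (ℚ𝔖 (suc m)) (λ w → gen (ι w)) (*ₐ-linearˡ (Λ m))) h
    (λ w → coeff-Λ (ι h) (ι w) (*ₐ-linear (gen (ι w))) (gen-cong {u = ι w ∙ Perm.id} {ι w} (λ _ → ≡.refl))
      (λ k k<m → indicator-no (ι w ∙ (c ^ₚ suc k) ≟ₚ ι h) (λ p → power-moves-last k k<m
        (perm-injective (ι w) (≡.trans (p last) (≡.trans (ι-fromℕ h) (≡.sym (ι-fromℕ w))))))))

  coeff-leftEquivariant : ∀ {x} → gen c *ₐ x ≈ₐ q *ᴱ x → ∀ k v → coeff ((c ^ₚ k) ∙ v) x ≡ (q ^ℚ k) ℚ.* coeff v x
  coeff-leftEquivariant {x} p zero    v = ≡.trans (coeff-resp {u = Perm.id ∙ v} {v} (λ _ → ≡.refl) x) (≡.sym (ℚₚ.*-identityˡ _))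
  coeff-leftEquivariant {x} p (suc k) v = begin
    coeff ((c ^ₚ suc k) ∙ v) x
      ≡⟨ ≡.sym (ℚₚ.*-identityˡ _) ⟩
    1ℚ ℚ.* coeff ((c ^ₚ suc k) ∙ v) x
      ≡⟨ ≡.cong (ℚ._* coeff ((c ^ₚ suc k) ∙ v) x) (≡.sym (sgn-square c)) ⟩
    q ℚ.* q ℚ.* coeff ((c ^ₚ suc k) ∙ v) x
      ≡⟨ ℚₚ.*-assoc q q _ ⟩
    q ℚ.* coeff ((c ^ₚ suc k) ∙ v) (q *ᴱ x)
      ≡⟨ ≡.cong (q ℚ.*_) (≡.sym (≡.trans (coeff-resp {u = (c ^ₚ k) ∙ v} {c ⁻¹ ∙ ((c ^ₚ suc k) ∙ v)} (λ _ → ≡.sym (Perm.inverseˡ c)) x) (≡.trans (≡.sym (coeff-gen-*ₐ ((c ^ₚ suc k) ∙ v) c x)) (coeff-cong ((c ^ₚ suc k) ∙ v) p)))) ⟩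
    q ℚ.* coeff ((c ^ₚ k) ∙ v) x
      ≡⟨ ≡.cong (q ℚ.*_) (coeff-leftEquivariant p k v) ⟩
    q ℚ.* ((q ^ℚ k) ℚ.* coeff v x)
      ≡⟨ ≡.sym (ℚₚ.*-assoc q (q ^ℚ k) _) ⟩
    (q ^ℚ suc k) ℚ.* coeff v x ∎
    where open ≡.≡-Reasoning

  coeff-rightEquivariant : ∀ {x} → x ·ₐ c ≈ₐ q *ᴱ x → ∀ k v → coeff (v ∙ (c ^ₚ k)) x ≡ (q ^ℚ k) ℚ.* coeff v x
  coeff-rightEquivariant {x} p zero    v = ≡.trans (coeff-resp {u = v ∙ Perm.id} {v} (λ _ → ≡.refl) x) (≡.sym (ℚₚ.*-identityˡ _))
  coeff-rightEquivariant {x} p (suc k) v = begin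
    coeff (v ∙ (c ^ₚ suc k)) x
      ≡⟨ ≡.sym (ℚₚ.*-identityˡ _) ⟩
    1ℚ ℚ.* coeff (v ∙ (c ^ₚ suc k)) x
      ≡⟨ ≡.cong (ℚ._* coeff (v ∙ (c ^ₚ suc k)) x) (≡.sym (sgn-square c)) ⟩
    q ℚ.* q ℚ.* coeff (v ∙ (c ^ₚ suc k)) x
      ≡⟨ ℚₚ.*-assoc q q _ ⟩
    q ℚ.* coeff (v ∙ (c ^ₚ suc k)) (q *ᴱ x)
      ≡⟨ ≡.cong (q ℚ.*_) (≡.sym (≡.trans (coeff-resp {u = v ∙ (c ^ₚ k)} {(v ∙ (c ^ₚ suc k)) ∙ c ⁻¹} untwist x) (≡.trans (≡.sym (coeff-·ₐ (v ∙ (c ^ₚ suc k)) c x)) (coeff-cong (v ∙ (c ^ₚ suc k)) p)))) ⟩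
    q ℚ.* coeff (v ∙ (c ^ₚ k)) x
      ≡⟨ ≡.cong (q ℚ.*_) (coeff-rightEquivariant p k v) ⟩
    q ℚ.* ((q ^ℚ k) ℚ.* coeff v x)
      ≡⟨ ≡.sym (ℚₚ.*-assoc q (q ^ℚ k) _) ⟩
    (q ^ℚ suc k) ℚ.* coeff v x ∎
    where
    open ≡.≡-Reasoning

    untwist : (v ∙ (c ^ₚ k)) Perm.≈ ((v ∙ (c ^ₚ suc k)) ∙ c ⁻¹)
    untwist i = ≡.cong (v ⟨$⟩ʳ_) (≡.sym (≡.trans (≡.sym (^ₚ-suc c k (c ⟨$⟩ˡ i))) (≡.cong ((c ^ₚ k) ⟨$⟩ʳ_) (Perm.inverseʳ c))))

  -- `factorˡ` moves every coefficient into 𝔖ₘ at the price of a power of `q`. A product with `Λ` in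
  -- front is visibly equivariant on the left, one with `Λ` behind on the right, hence the two
  -- versions.
  leftEquivariant-ext : ∀ {x y} → gen c *ₐ x ≈ₐ q *ᴱ x → gen c *ₐ y ≈ₐ q *ᴱ y →
                        (∀ h → coeff (ι h) x ≡ coeff (ι h) y) → x ≈ₐ y
  leftEquivariant-ext {x} {y} p r e = coeff-ext λ u →
    let k = leftPower u ; h = leftPart u in
    ≡.trans (coeff-resp {u = u} {(c ^ₚ k) ∙ ι h} (factorˡ u) x) (≡.trans (coeff-leftEquivariant p k (ι h))
      (≡.trans (≡.cong ((q ^ℚ k) ℚ.*_) (e h))
        (≡.sym (≡.trans (coeff-resp {u = u} {(c ^ₚ k) ∙ ι h} (factorˡ u) y) (coeff-leftEquivariant r k (ι h))))))

  rightEquivariant-ext : ∀ {x y} → x ·ₐ c ≈ₐ q *ᴱ x → y ·ₐ c ≈ₐ q *ᴱ y →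
                         (∀ h → coeff (ι h) x ≡ coeff (ι h) y) → x ≈ₐ y
  rightEquivariant-ext {x} {y} p r e = coeff-ext λ u →
    let k = rightPower u ; h = rightPart u in
    ≡.trans (coeff-resp {u = u} {ι h ∙ (c ^ₚ k)} (factorʳ u) x) (≡.trans (coeff-rightEquivariant p k (ι h))
      (≡.trans (≡.cong ((q ^ℚ k) ℚ.*_) (e h))
        (≡.sym (≡.trans (coeff-resp {u = u} {ι h ∙ (c ^ₚ k)} (factorʳ u) y) (coeff-rightEquivariant r k (ι h))))))

-- Cyclic descents

-- The weight in `s` of a permutation of M + 1 points as a function of its number of descents.
-- Without descents all M block lengths fit; a single descent forces the first block to end there;
-- two descents cannot both lie between the blocks. The value M is left as a sum of ones to match
-- `shuffleCount`.
shuffleCountFor : ℕ → ℕ → ℚ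
shuffleCountFor M 0             = sum {M} (λ _ → 1ℚ)
shuffleCountFor M 1             = 1ℚ
shuffleCountFor M (suc (suc _)) = 0ℚ

sum-all-zero : ∀ {M} (d : Fin M → ℕ) → (∀ k → d k ≡ 0) → ℕ-sum.sum d ≡ 0
sum-all-zero {M} d p = ≡.trans (ℕ-sum.sum-cong-≗ {M} p) (ℕ-sum.sum-replicate-zero M)

sum-zero⇒all-zero : ∀ {M} (d : Fin M → ℕ) → ℕ-sum.sum d ≡ 0 → ∀ k → d k ≡ 0
sum-zero⇒all-zero {suc M} d p zero    = ℕₚ.m+n≡0⇒m≡0 (d zero) p
sum-zero⇒all-zero {suc M} d p (suc k) = sum-zero⇒all-zero (d ∘ suc) (ℕₚ.m+n≡0⇒n≡0 (d zero) p) k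

-- The condition `sum d = d k` says that nothing outside `k` contributes. Entries being 0 or 1, it
-- holds for all, for one or for none of the `k` according to the total.
∑-indicator-sum≟ : ∀ {M} (d : Fin M → ℕ) → (∀ k → d k ≤ 1) →
  sum {M} (λ k → indicator (ℕ-sum.sum d ℕₚ.≟ d k)) ≡ shuffleCountFor M (ℕ-sum.sum d)
∑-indicator-sum≟ {M} d d≤1 with ℕ-sum.sum d in total
... | zero        = sum-cong-≗ {M} (λ k → indicator-yes (0 ℕₚ.≟ d k) (≡.sym (sum-zero⇒all-zero d total k)))
... | suc (suc D) = ≡.trans
  (sum-cong-≗ {M} (λ k → indicator-no (suc (suc D) ℕₚ.≟ d k) (λ p → ℕₚ.<⇒≱ (s≤s (s≤s z≤n)) (≡.subst (_≤ 1) (≡.sym p) (d≤1 k)))))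
  (sum-replicate-zero M)
... | suc zero    = single d d≤1 total
  where
  single : ∀ {M} (d : Fin M → ℕ) → (∀ k → d k ≤ 1) → ℕ-sum.sum d ≡ 1 → sum {M} (λ k → indicator (1 ℕₚ.≟ d k)) ≡ 1ℚ
  single {suc M} d d≤1 total with d zero | d≤1 zero
  ... | zero        | _        = ≡.trans (ℚₚ.+-identityˡ _) (single (d ∘ suc) (d≤1 ∘ suc) total)
  ... | suc zero    | _        = ≡.trans (≡.cong (1ℚ ℚ.+_) (≡.trans
    (sum-cong-≗ {M} (λ k → ≡.cong (λ a → indicator (1 ℕₚ.≟ a)) (sum-zero⇒all-zero (d ∘ suc) (ℕₚ.suc-injective total) k)))
    (sum-replicate-zero M))) ≡.refl
  ... | suc (suc _) | s≤s ()

module _ {M : ℕ} (w : Perm (suc M)) where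

  descent : Fin M → ℕ
  descent p = less (w ⟨$⟩ʳ suc p) (w ⟨$⟩ʳ inject₁ p)

  descent≤1 : ∀ p → descent p ≤ 1
  descent≤1 p with (w ⟨$⟩ʳ suc p) Finₚ.<? (w ⟨$⟩ʳ inject₁ p)
  ... | yes q rewrite less-true  {i = w ⟨$⟩ʳ suc p} {w ⟨$⟩ʳ inject₁ p} q = s≤s z≤n
  ... | no q  rewrite less-false {i = w ⟨$⟩ʳ suc p} {w ⟨$⟩ʳ inject₁ p} q = z≤n

  ascent : ∀ p → descent p ≡ 0 → (w ⟨$⟩ʳ inject₁ p) Fin.< (w ⟨$⟩ʳ suc p)
  ascent p d≡0 with ℕₚ.<-cmp (toℕ (w ⟨$⟩ʳ inject₁ p)) (toℕ (w ⟨$⟩ʳ suc p))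
  ... | tri< q _ _ = q
  ... | tri≈ _ q _ = contradiction (≡.cong toℕ (perm-injective w (Finₚ.toℕ-injective q)))
    (λ r → ℕₚ.<-irrefl (≡.trans (≡.sym (Finₚ.toℕ-inject₁ p)) r) ℕₚ.≤-refl)
  ... | tri> _ _ q = contradiction (≡.trans (≡.sym (less-true {i = w ⟨$⟩ʳ suc p} {w ⟨$⟩ʳ inject₁ p} q)) d≡0) λ ()

  no-descent : ∀ p → (w ⟨$⟩ʳ inject₁ p) Fin.< (w ⟨$⟩ʳ suc p) → descent p ≡ 0
  no-descent p q = less-false {i = w ⟨$⟩ʳ suc p} {w ⟨$⟩ʳ inject₁ p} (ℕₚ.<-asym q)

  -- The bound `t` carries the recursion: the step from `suc b` to `inject₁ b` is not structural.
  ascending : ∀ t (a b : Fin (suc M)) → toℕ b ≤ t → a Fin.< b →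
              (∀ p → toℕ a ≤ toℕ p → toℕ p < toℕ b → descent p ≡ 0) → (w ⟨$⟩ʳ a) Fin.< (w ⟨$⟩ʳ b)
  ascending (suc t) a (suc b) (s≤s b≤t) (s≤s a≤b) h with ℕₚ.m≤n⇒m<n∨m≡n a≤b
  ... | inj₂ a≡b = ≡.subst (λ i → (w ⟨$⟩ʳ i) Fin.< (w ⟨$⟩ʳ suc b))
    (Finₚ.toℕ-injective (≡.trans (Finₚ.toℕ-inject₁ b) (≡.sym a≡b)))
    (ascent b (h b a≤b ℕₚ.≤-refl))
  ... | inj₁ a<b = ℕₚ.<-trans
    (ascending t a (inject₁ b) (≡.subst (_≤ t) (≡.sym (Finₚ.toℕ-inject₁ b)) b≤t)
      (≡.subst (toℕ a <_) (≡.sym (Finₚ.toℕ-inject₁ b)) a<b)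
      (λ p a≤p p<b → h p a≤p (ℕₚ.m≤n⇒m≤1+n (≡.subst (toℕ p <_) (Finₚ.toℕ-inject₁ b) p<b))))
    (ascent b (h b a≤b ℕₚ.≤-refl))

  shuffle⇒descents : ∀ k → IsShuffle (suc (toℕ k)) w → ∀ p → p ≢ k → descent p ≡ 0
  shuffle⇒descents k (f , g) p p≢k with ℕₚ.<-cmp (toℕ p) (toℕ k)
  ... | tri< p<k _ _ = no-descent p (f (inject₁ p) (suc p) (s≤s (ℕₚ.≤-reflexive (Finₚ.toℕ-inject₁ p))) (s≤s p<k))
  ... | tri≈ _ p≡k _ = contradiction (Finₚ.toℕ-injective p≡k) p≢k
  ... | tri> _ _ k<p = no-descent p (g (inject₁ p) (suc p) (s≤s (ℕₚ.≤-reflexive (Finₚ.toℕ-inject₁ p)))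
    (≡.subst (suc (toℕ k) ≤_) (≡.sym (Finₚ.toℕ-inject₁ p)) k<p))

  descents⇒shuffle : ∀ k → (∀ p → p ≢ k → descent p ≡ 0) → IsShuffle (suc (toℕ k)) w
  descents⇒shuffle k h =
    (λ a b a<b b≤k → ascending (toℕ b) a b ℕₚ.≤-refl a<b (λ p a≤p p<b → h p λ { ≡.refl → ℕₚ.<⇒≱ p<b (ℕₚ.≤-pred b≤k) })) ,
    (λ a b a<b k<a → ascending (toℕ b) a b ℕₚ.≤-refl a<b (λ p a≤p p<b → h p λ { ≡.refl → ℕₚ.<⇒≱ k<a a≤p }))

  -- Shuffles with first block of length k + 1 are the permutations whose descents all sit at
  -- position `k`, and this is the case when the total number of descents equals the entry at `k`.
  shuffleCount-descents : shuffleCount w ≡ shuffleCountFor M (ℕ-sum.sum descent)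
  shuffleCount-descents = ≡.trans
    (sum-cong-≗ {M} (λ k → indicator-⇔ (isShuffle? (suc (toℕ k)) w) (ℕ-sum.sum descent ℕₚ.≟ descent k)
      (λ sh → only⇒ descent k (shuffle⇒descents k sh))
      (λ p → descents⇒shuffle k (only⇐ descent k p))))
    (∑-indicator-sum≟ descent descent≤1)
    where
    only⇒ : ∀ {M} (d : Fin M → ℕ) k → (∀ p → p ≢ k → d p ≡ 0) → ℕ-sum.sum d ≡ d k
    only⇒ {suc M} d k h = ≡.trans (ℕ-sum.sum-remove {M} {k} d)
      (≡.trans (≡.cong (d k ℕ.+_) (sum-all-zero {M} _ (λ p → h (punchIn k p) (Finₚ.punchInᵢ≢i k p)))) (ℕₚ.+-identityʳ (d k)))

    only⇐ : ∀ {M} (d : Fin M → ℕ) k → ℕ-sum.sum d ≡ d k → ∀ p → p ≢ k → d p ≡ 0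
    only⇐ {suc M} d k h p p≢k = ≡.trans (≡.cong d (≡.sym (Finₚ.punchIn-punchOut {i = k} {p} (λ q → p≢k (≡.sym q)))))
      (sum-zero⇒all-zero {M} (λ i → d (punchIn k i))
        (ℕₚ.+-cancelˡ-≡ (d k) _ 0 (≡.trans (≡.sym (ℕ-sum.sum-remove {M} {k} d)) (≡.trans h (≡.sym (ℕₚ.+-identityʳ (d k)))))) _)

module CyclicDescents (m : ℕ) where
  open Cycle m

  cyclicDescents : Perm (suc m) → ℕ
  cyclicDescents u = ℕ-sum.sum (λ p → less (u ⟨$⟩ʳ (c ⟨$⟩ʳ p)) (u ⟨$⟩ʳ p))

  cyclicDescents-cong : ∀ {u w : Perm (suc m)} → u Perm.≈ w → cyclicDescents u ≡ cyclicDescents w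
  cyclicDescents-cong p = ℕ-sum.sum-cong-≗ {suc m} (λ i → ≡.cong₂ less (p (c ⟨$⟩ʳ i)) (p i))

  cyclicDescents-∙-cycle : ∀ u → cyclicDescents (u ∙ c) ≡ cyclicDescents u
  cyclicDescents-∙-cycle u = ≡.sym (ℕ-sum.sum-permute (λ p → less (u ⟨$⟩ʳ (c ⟨$⟩ʳ p)) (u ⟨$⟩ʳ p)) c)

  isLast : Fin (suc m) → ℕ
  isLast i = indicatorᴺ (last Finₚ.≟ i)

  -- Adding 1 cyclically to the values only affects comparisons with the largest one.
  less-cycle : ∀ a b → less (c ⟨$⟩ʳ b) (c ⟨$⟩ʳ a) ℕ.+ isLast a ≡ less b a ℕ.+ isLast b
  less-cycle a b with view a | view b
  ... | inner i | inner j rewrite cycle-inject₁ i | cycle-inject₁ j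
        | dec-false (last Finₚ.≟ inject₁ i) Finₚ.fromℕ≢inject₁ | dec-false (last Finₚ.≟ inject₁ j) Finₚ.fromℕ≢inject₁
        | Finₚ.toℕ-inject₁ i | Finₚ.toℕ-inject₁ j = ≡.refl
  ... | inner i | final   rewrite cycle-inject₁ i | cycle-last
        | dec-false (last Finₚ.≟ inject₁ i) Finₚ.fromℕ≢inject₁ | dec-true (last Finₚ.≟ last) ≡.refl
        | less-false {i = last} {inject₁ i} (ℕₚ.≤⇒≯ (Finₚ.≤fromℕ (inject₁ i))) = ≡.refl
  ... | final   | inner j rewrite cycle-inject₁ j | cycle-last
        | dec-false (last Finₚ.≟ inject₁ j) Finₚ.fromℕ≢inject₁ | dec-true (last Finₚ.≟ last) ≡.refl
        | less-true {i = inject₁ j} {last} (≡.subst₂ _<_ (≡.sym (Finₚ.toℕ-inject₁ j)) (≡.sym (Finₚ.toℕ-fromℕ m)) (Finₚ.toℕ<n j)) = ≡.refl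
  ... | final   | final   rewrite cycle-last | less-false {i = last} {last} (ℕₚ.<-irrefl ≡.refl) = ≡.refl

  -- Summed around the circle, the corrections of `less-cycle` count the occurrence of the largest
  -- value on both sides, once at each point and once at its successor, so they cancel.
  cyclicDescents-cycle-∙ : ∀ u → cyclicDescents (c ∙ u) ≡ cyclicDescents u
  cyclicDescents-cycle-∙ u = ℕₚ.+-cancelʳ-≡ L (cyclicDescents (c ∙ u)) (cyclicDescents u) (begin
    cyclicDescents (c ∙ u) ℕ.+ L
      ≡⟨ ≡.sym (ℕ-sum.∑-distrib-+ (λ p → less (c ∙ u ⟨$⟩ʳ (c ⟨$⟩ʳ p)) (c ∙ u ⟨$⟩ʳ p)) (λ p → isLast (u ⟨$⟩ʳ p))) ⟩
    ℕ-sum.sum (λ p → less (c ∙ u ⟨$⟩ʳ (c ⟨$⟩ʳ p)) (c ∙ u ⟨$⟩ʳ p) ℕ.+ isLast (u ⟨$⟩ʳ p))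
      ≡⟨ ℕ-sum.sum-cong-≗ {suc m} (λ p → less-cycle (u ⟨$⟩ʳ p) (u ⟨$⟩ʳ (c ⟨$⟩ʳ p))) ⟩
    ℕ-sum.sum (λ p → less (u ⟨$⟩ʳ (c ⟨$⟩ʳ p)) (u ⟨$⟩ʳ p) ℕ.+ isLast (u ⟨$⟩ʳ (c ⟨$⟩ʳ p)))
      ≡⟨ ℕ-sum.∑-distrib-+ (λ p → less (u ⟨$⟩ʳ (c ⟨$⟩ʳ p)) (u ⟨$⟩ʳ p)) (λ p → isLast (u ⟨$⟩ʳ (c ⟨$⟩ʳ p))) ⟩
    cyclicDescents u ℕ.+ ℕ-sum.sum (λ p → isLast (u ⟨$⟩ʳ (c ⟨$⟩ʳ p)))
      ≡⟨ ≡.cong (cyclicDescents u ℕ.+_) (≡.sym (ℕ-sum.sum-permute (λ p → isLast (u ⟨$⟩ʳ p)) c)) ⟩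
    cyclicDescents u ℕ.+ L ∎)
    where
    open ≡.≡-Reasoning

    L : ℕ
    L = ℕ-sum.sum (λ p → isLast (u ⟨$⟩ʳ p))

module CyclicShuffles (M : ℕ) where
  open Cycle (suc M)
  open CyclicDescents (suc M)

  -- In `ι w` the largest value stands at the last position. The step into it is an ascent, the step
  -- from it back to the start is the one extra descent, and the other steps are those of `w`.
  cyclicDescents-ι : ∀ w → cyclicDescents (ι w) ≡ suc (ℕ-sum.sum (descent w))
  cyclicDescents-ι w = begin
    ℕ-sum.sum cd
      ≡⟨ ℕ-sum.sum-init-last cd ⟩
    ℕ-sum.sum (λ i → cd (inject₁ i)) ℕ.+ cd last
      ≡⟨ ≡.cong₂ ℕ._+_ (ℕ-sum.sum-init-last (λ i → cd (inject₁ i))) wrap ⟩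
    ℕ-sum.sum (λ i → cd (inject₁ (inject₁ i))) ℕ.+ cd (inject₁ (fromℕ M)) ℕ.+ 1
      ≡⟨ ≡.cong (ℕ._+ 1) (≡.cong₂ ℕ._+_ (ℕ-sum.sum-cong-≗ {M} inside) before-last) ⟩
    ℕ-sum.sum (descent w) ℕ.+ 0 ℕ.+ 1
      ≡⟨ ≡.trans (≡.cong (ℕ._+ 1) (ℕₚ.+-identityʳ _)) (ℕₚ.+-comm _ 1) ⟩
    suc (ℕ-sum.sum (descent w)) ∎
    where
    open ≡.≡-Reasoning

    cd : Fin (suc (suc M)) → ℕ
    cd p = less (ι w ⟨$⟩ʳ (c ⟨$⟩ʳ p)) (ι w ⟨$⟩ʳ p)

    less-inject₁ : ∀ (i j : Fin (suc M)) → less (inject₁ i) (inject₁ j) ≡ less i j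
    less-inject₁ i j rewrite Finₚ.toℕ-inject₁ i | Finₚ.toℕ-inject₁ j = ≡.refl

    wrap : cd last ≡ 1
    wrap = ≡.trans
      (≡.cong₂ less (≡.trans (≡.cong (ι w ⟨$⟩ʳ_) cycle-last) (ι-inject₁ w zero)) (ι-fromℕ w))
      (less-true {i = inject₁ (w ⟨$⟩ʳ zero)} {last}
        (≡.subst₂ _<_ (≡.sym (Finₚ.toℕ-inject₁ (w ⟨$⟩ʳ zero))) (≡.sym (Finₚ.toℕ-fromℕ (suc M))) (Finₚ.toℕ<n (w ⟨$⟩ʳ zero))))

    before-last : cd (inject₁ (fromℕ M)) ≡ 0
    before-last = ≡.trans
      (≡.cong (λ i → less i (ι w ⟨$⟩ʳ inject₁ (fromℕ M))) (≡.trans (≡.cong (ι w ⟨$⟩ʳ_) (cycle-inject₁ (fromℕ M))) (ι-fromℕ w)))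
      (less-false {i = last} {ι w ⟨$⟩ʳ inject₁ (fromℕ M)} (ℕₚ.≤⇒≯ (Finₚ.≤fromℕ _)))

    inside : ∀ i → cd (inject₁ (inject₁ i)) ≡ descent w i
    inside i = ≡.trans
      (≡.cong₂ less (≡.trans (≡.cong (ι w ⟨$⟩ʳ_) (cycle-inject₁ (inject₁ i))) (ι-inject₁ w (suc i))) (ι-inject₁ w (inject₁ i)))
      (less-inject₁ (w ⟨$⟩ʳ suc i) (w ⟨$⟩ʳ inject₁ i))

  private
    -- Extends the coefficients of `s (suc M)` from the image of `ι` to the whole group; `pred`
    -- takes off the descent that wraps around.
    weight : Perm (suc (suc M)) → ℚ
    weight u = shuffleCountFor M (ℕ.pred (cyclicDescents u)) ℚ.* sgn u

    weight-cong : ∀ {u w} → u Perm.≈ w → weight u ≡ weight w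
    weight-cong {u} {w} p = ≡.cong₂ (λ d r → shuffleCountFor M (ℕ.pred d) ℚ.* r)
      (cyclicDescents-cong {u} {w} p) (sgn-cong {u = u} {w} p)

    B : ℚ[𝔖 suc (suc M) ]
    B = combine weight

    coeff-B : ∀ u → coeff u B ≡ weight u
    coeff-B = coeff-combine (λ {u} {w} → weight-cong {u} {w})

    coeff-B-ι : ∀ h → coeff (ι h) B ≡ coeff h (s (suc M))
    coeff-B-ι h = ≡.trans (coeff-B (ι h)) (≡.trans
      (≡.cong₂ (λ d r → shuffleCountFor M (ℕ.pred d) ℚ.* r) (cyclicDescents-ι h) (sgn-ι h))
      (≡.trans (≡.cong (ℚ._* sgn h) (≡.sym (shuffleCount-descents h))) (≡.sym (coeff-s h))))

    twist : ∀ {d d′ r r′} → d′ ≡ d → r′ ≡ q ℚ.* r →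
            shuffleCountFor M (ℕ.pred d′) ℚ.* r′ ≡ q ℚ.* (shuffleCountFor M (ℕ.pred d) ℚ.* r)
    twist {d} {r = r} ≡.refl ≡.refl = *ₗ-swap ℚᵥ (shuffleCountFor M (ℕ.pred d)) q r

    B-left : gen c *ₐ B ≈ₐ q *ᴱ B
    B-left = coeff-ext λ u → ≡.trans (coeff-gen-*ₐ u c B) (≡.trans (coeff-B (c ⁻¹ ∙ u)) (≡.trans
      (twist
        (≡.trans (≡.sym (cyclicDescents-cycle-∙ (c ⁻¹ ∙ u))) (cyclicDescents-cong {c ∙ (c ⁻¹ ∙ u)} {u} (∙-⁻¹-cancel c u)))
        (≡.trans (sgn-∙ (c ⁻¹) u) (≡.cong (ℚ._* sgn u) (sgn-⁻¹ c))))
      (≡.cong (q ℚ.*_) (≡.sym (coeff-B u)))))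

    B-right : B ·ₐ c ≈ₐ q *ᴱ B
    B-right = coeff-ext λ u → ≡.trans (coeff-·ₐ u c B) (≡.trans (coeff-B (u ∙ c ⁻¹)) (≡.trans
      (twist
        (≡.trans (≡.sym (cyclicDescents-∙-cycle (u ∙ c ⁻¹)))
          (cyclicDescents-cong {(u ∙ c ⁻¹) ∙ c} {u} (λ i → ≡.cong (u ⟨$⟩ʳ_) (Perm.inverseˡ c))))
        (≡.trans (sgn-∙ u (c ⁻¹)) (≡.trans (ℚₚ.*-comm (sgn u) (sgn (c ⁻¹))) (≡.cong (ℚ._* sgn u) (sgn-⁻¹ c)))))
      (≡.cong (q ℚ.*_) (≡.sym (coeff-B u)))))

  -- Both products are the element of ℚ𝔖ₙ whose untwisted coefficients depend only on the number
  -- of cyclic descents.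
  Λ-commutes-s : Λ (suc M) *ₐ ιₐ (s (suc M)) ≈ₐ ιₐ (s (suc M)) *ₐ Λ (suc M)
  Λ-commutes-s = trans
    (leftEquivariant-ext
      (trans (sym (*ₐ-assoc (gen c) (Λ (suc M)) (ιₐ (s (suc M)))))
        (trans (*ₐ-congˡ (ιₐ (s (suc M))) cycle-*ₐ-Λ) (*ₐ-*ˡ q (Λ (suc M)) (ιₐ (s (suc M))))))
      B-left
      (λ h → ≡.trans (coeff-Λ-*ₐ-ιₐ h (s (suc M))) (≡.sym (coeff-B-ι h))))
    (sym (rightEquivariant-ext
      (trans (sym (*ₐ-·ₐ (ιₐ (s (suc M))) (Λ (suc M)) c)) (*ₐ-congʳ (ιₐ (s (suc M))) Λ-·ₐ-cycle))
      B-right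
      (λ h → ≡.trans (coeff-ιₐ-*ₐ-Λ h (s (suc M))) (≡.sym (coeff-B-ι h)))))

module _ (m : ℕ) (1≤m : 1 ≤ m) where
  open Cycle m

  private
    commutes : Λ m *ₐ ιₐ (s m) ≈ₐ ιₐ (s m) *ₐ Λ m
    commutes = positive m 1≤m
      where
      positive : ∀ m → 1 ≤ m → Λ m *ₐ ιₐ (s m) ≈ₐ ιₐ (s m) *ₐ Λ m
      positive (suc M) _ = CyclicShuffles.Λ-commutes-s M

  Λ-commutes-evaluate : ∀ p → Λ m *ₐ ιₐ (evaluate p (s m)) ≈ₐ ιₐ (evaluate p (s m)) *ₐ Λ m
  Λ-commutes-evaluate []      = sym (*ₐ-0ˡ (Λ m))
  Λ-commutes-evaluate (a ∷ p) = trans (+-cong scalar product) (sym (*ₐ-+ˡ (a *ᴱ gen (ι Perm.id)) (ιₐ (s m *ₐ evaluate p (s m))) (Λ m)))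
    where
    L x y : ℚ[𝔖 suc m ]
    L = Λ m
    x = ιₐ (s m)
    y = ιₐ (evaluate p (s m))

    ι-id-≈ : gen (ι Perm.id) ≈ₐ gen Perm.id
    ι-id-≈ = gen-cong {u = ι Perm.id} {Perm.id} ι-id

    scalar : a *ᴱ (L *ₐ gen (ι Perm.id)) ≈ₐ (a *ᴱ gen (ι Perm.id)) *ₐ L
    scalar = trans (*-cong a (trans (*ₐ-congʳ L ι-id-≈) (trans (*ₐ-identityʳ L)
        (sym (trans (*ₐ-congˡ L ι-id-≈) (*ₐ-identityˡ L))))))
      (sym (*ₐ-*ˡ a (gen (ι Perm.id)) L))

    product : L *ₐ ιₐ (s m *ₐ evaluate p (s m)) ≈ₐ ιₐ (s m *ₐ evaluate p (s m)) *ₐ L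
    product = trans (*ₐ-congʳ L (ιₐ-*ₐ (s m) (evaluate p (s m))))
      (trans (sym (*ₐ-assoc L x y))
        (trans (*ₐ-congˡ y commutes)
          (trans (*ₐ-assoc x L y)
            (trans (*ₐ-congʳ x (Λ-commutes-evaluate p))
              (trans (sym (*ₐ-assoc x y L))
                (*ₐ-congˡ L (sym (ιₐ-*ₐ (s m) (evaluate p (s m))))))))))

  Λ-commutes-idempotent : ∀ {j} {e : ℚ[𝔖 m ]} → IsEulerianIdempotent m j e → Λ m *ₐ ιₐ e ≈ₐ ιₐ e *ₐ Λ m
  Λ-commutes-idempotent {e = e} idem with IsEulerianIdempotent.polynomial idem
  ... | p , e≈ = trans (*ₐ-congʳ (Λ m) (ιₐ-cong e≈))
    (trans (Λ-commutes-evaluate p) (*ₐ-congˡ (Λ m) (sym (ιₐ-cong e≈))))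

-- Induction from 𝔖ₘ as a tensor product

module _ (V : VectorSpace) where
  open LeftModule V
  private module V∑ = MonoidSum +ᴹ-commutativeMonoid

  ∑ : ∀ {n} → (Fin n → Carrierᴹ) → Carrierᴹ
  ∑ = V∑.sum

  ∑-cong : ∀ {n} {f g : Fin n → Carrierᴹ} → (∀ i → f i ≈ᴹ g i) → ∑ f ≈ᴹ ∑ g
  ∑-cong = V∑.sum-cong-≋

  ∑-+ : ∀ {n} (f g : Fin n → Carrierᴹ) → ∑ (λ i → f i +ᴹ g i) ≈ᴹ ∑ f +ᴹ ∑ g
  ∑-+ = V∑.∑-distrib-+

  ∑-zero : ∀ {n} {f : Fin n → Carrierᴹ} → (∀ i → f i ≈ᴹ 0ᴹ) → ∑ f ≈ᴹ 0ᴹ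
  ∑-zero {n} p = ≈ᴹ-trans (∑-cong p) (V∑.sum-replicate-zero n)

  ∑-*ₗ : ∀ {n} q (f : Fin n → Carrierᴹ) → ∑ (λ i → q *ₗ f i) ≈ᴹ q *ₗ ∑ f
  ∑-*ₗ {zero}  q f = ≈ᴹ-sym (*ₗ-zeroʳ q)
  ∑-*ₗ {suc n} q f = ≈ᴹ-trans (+ᴹ-cong ≈ᴹ-refl (∑-*ₗ q (f ∘ suc))) (≈ᴹ-sym (*ₗ-distribˡ q _ _))

  ∑-*ᵣ : ∀ {n} (a : Fin n → ℚ) v → ∑ (λ i → a i *ₗ v) ≈ᴹ sum a *ₗ v
  ∑-*ᵣ {zero}  a v = ≈ᴹ-sym (*ₗ-zeroˡ v)
  ∑-*ᵣ {suc n} a v = ≈ᴹ-trans (+ᴹ-cong ≈ᴹ-refl (∑-*ᵣ (a ∘ suc) v)) (≈ᴹ-sym (*ₗ-distribʳ v _ _))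

  ∑-δ : ∀ {n} k (f : Fin n → Carrierᴹ) → ∑ (λ i → δ i k *ₗ f i) ≈ᴹ f k
  ∑-δ zero    f = ≈ᴹ-trans (+ᴹ-cong (*ₗ-identityˡ (f zero)) (∑-zero (λ i → *ₗ-zeroˡ (f (suc i))))) (+ᴹ-identityʳ (f zero))
  ∑-δ (suc k) f = ≈ᴹ-trans (+ᴹ-cong (*ₗ-zeroˡ (f zero)) (∑-δ k (f ∘ suc))) (+ᴹ-identityˡ (f (suc k)))

  -- The part with `δ j k` is a multiple of the whole sum, which vanishes. This is how vectors e_i -
  -- e_j expand a family of sum 0 with its own entries as coefficients.
  ∑-δ-difference : ∀ {n} j k (f : Fin n → Carrierᴹ) → ∑ f ≈ᴹ 0ᴹ → ∑ (λ i → (δ i k ℚ.- δ j k) *ₗ f i) ≈ᴹ f k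
  ∑-δ-difference j k f p = ≈ᴹ-trans (∑-cong (λ i → *ₗ-distribʳ (f i) (δ i k) (ℚ.- δ j k)))
    (≈ᴹ-trans (∑-+ (λ i → δ i k *ₗ f i) (λ i → (ℚ.- δ j k) *ₗ f i))
      (≈ᴹ-trans (+ᴹ-cong (∑-δ k f)
          (≈ᴹ-trans (∑-*ₗ (ℚ.- δ j k) f) (≈ᴹ-trans (*ₗ-cong ≡.refl p) (*ₗ-zeroʳ (ℚ.- δ j k)))))
        (+ᴹ-identityʳ (f k))))

record Hom (V W : VectorSpace) (φ : LeftModule.Carrierᴹ V → LeftModule.Carrierᴹ W) : Set where
  private
    module V = LeftModule V
    module W = LeftModule W
  field
    cong   : ∀ {v v′} → v V.≈ᴹ v′ → φ v W.≈ᴹ φ v′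
    +-homo : ∀ v v′ → φ (v V.+ᴹ v′) W.≈ᴹ φ v W.+ᴹ φ v′
    *-homo : ∀ q v → φ (q V.*ₗ v) W.≈ᴹ q W.*ₗ φ v

  0-homo : φ V.0ᴹ W.≈ᴹ W.0ᴹ
  0-homo = W.≈ᴹ-trans (cong (V.≈ᴹ-sym (V.*ₗ-zeroˡ V.0ᴹ))) (W.≈ᴹ-trans (*-homo 0ℚ V.0ᴹ) (W.*ₗ-zeroˡ _))

  -‿homo : ∀ v → φ (V.-ᴹ v) W.≈ᴹ W.-ᴹ φ v
  -‿homo v = W.≈ᴹ-trans (cong (V.≈ᴹ-sym (neg-one V v))) (W.≈ᴹ-trans (*-homo (ℚ.- 1ℚ) v) (neg-one W (φ v)))

  ∑-homo : ∀ {n} (f : Fin n → V.Carrierᴹ) → φ (∑ V f) W.≈ᴹ ∑ W (λ i → φ (f i))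
  ∑-homo {zero}  f = 0-homo
  ∑-homo {suc n} f = W.≈ᴹ-trans (+-homo _ _) (W.+ᴹ-cong W.≈ᴹ-refl (∑-homo (f ∘ suc)))

  open ModuleMorphisms.LeftModuleMorphisms V.rawLeftModule W.rawLeftModule using (IsLeftModuleHomomorphism)

  isLeftModuleHomomorphism : IsLeftModuleHomomorphism φ
  isLeftModuleHomomorphism = record
    { +ᴹ-isGroupHomomorphism = record
      { isMonoidHomomorphism = record
        { isMagmaHomomorphism = record
          { isRelHomomorphism = record { cong = cong }
          ; homo = +-homo }
        ; ε-homo = 0-homo }
      ; ⁻¹-homo = -‿homo }
    ; *ₗ-homo = *-homo }

Hom-∘ : ∀ {U V W : VectorSpace} {ψ φ} → Hom V W ψ → Hom U V φ → Hom U W (λ u → ψ (φ u))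
Hom-∘ {W = W} H K = record
  { cong = λ p → H.cong (K.cong p)
  ; +-homo = λ u u′ → W.≈ᴹ-trans (H.cong (K.+-homo u u′)) (H.+-homo _ _)
  ; *-homo = λ q u → W.≈ᴹ-trans (H.cong (K.*-homo q u)) (H.*-homo q _)
  }
  where
  module W = LeftModule W
  module H = Hom H
  module K = Hom K

Hom-∑ : ∀ {V W : VectorSpace} {n} {φ : Fin n → LeftModule.Carrierᴹ V → LeftModule.Carrierᴹ W} →
        (∀ i → Hom V W (φ i)) → Hom V W (λ v → ∑ W (λ i → φ i v))
Hom-∑ {W = W} {n} {φ} H = record
  { cong = λ p → ∑-cong W {n} (λ i → Hom.cong (H i) p)
  ; +-homo = λ v v′ → W.≈ᴹ-trans (∑-cong W {n} (λ i → Hom.+-homo (H i) v v′)) (∑-+ W {n} (λ i → φ i v) (λ i → φ i v′))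
  ; *-homo = λ q v → W.≈ᴹ-trans (∑-cong W {n} (λ i → Hom.*-homo (H i) q v)) (∑-*ₗ W {n} q (λ i → φ i v))
  }
  where module W = LeftModule W

module _ {G : Set} {R : Expr G → Expr G → Set} {W : VectorSpace} where

  Hom⇒Linear : ∀ {φ} → Hom (presented G R) W φ → Linear W φ
  Hom⇒Linear H = record { 0-homo = 0-homo ; +-homo = +-homo ; -‿homo = -‿homo ; *-homo = *-homo }
    where open Hom H

  fold-Hom : ∀ {f} → (∀ {x y} → R x y → LeftModule._≈ᴹ_ W (fold W f x) (fold W f y)) → Hom (presented G R) W (fold W f)
  fold-Hom r = record
    { cong = fold-cong W r
    ; +-homo = λ _ _ → LeftModule.≈ᴹ-refl W
    ; *-homo = λ _ _ → LeftModule.≈ᴹ-refl W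
    }

-- Both reflection m ⊗ F and the representation induced from E embed into the (m+1)-fold power of F,
-- by N and M: v ⊗ x has components vᵢ x, and v ⊗ g with g ∈ 𝔖ₘ₊₁ has the single component Λ v g,
-- at the point which g sends to the last one.  The image of N is the families with sum 0, and M is onto.
module Induction (m : ℕ) (e : ℚ[𝔖 m ]) (commutes : Λ m *ₐ ιₐ e ≈ₐ ιₐ e *ₐ Λ m) where
  open Cycle m

  private
    n : ℕ
    n = suc m

    L : ℚ[𝔖 n ]
    L = Λ m

    module E = Rep (E e)
    module F = Rep (F e)
    module V = Rep (reflection m)
    module Ind = Rep (induced (E e))
    module VF = Rep (reflection m ⊗ᴿ F e)
    module T = Tensor E.space (ℚ𝔖 n) {Perm m} (λ h v → v E.· h) (λ h x → gen (ι h) *ₐ x)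
    module U = Tensor V.space F.space {⊥} (λ ()) (λ ())

  Λ-ιₐ-injective : ∀ {x y : ℚ[𝔖 m ]} → L *ₐ ιₐ x ≈ₐ L *ₐ ιₐ y → x ≈ₐ y
  Λ-ιₐ-injective {x} {y} p = coeff-ext λ h →
    ≡.trans (≡.sym (coeff-Λ-*ₐ-ιₐ h x)) (≡.trans (coeff-cong (ι h) p) (coeff-Λ-*ₐ-ιₐ h y))

  module _ (x : ℚ[𝔖 n ]) where

    *ₐ-extend : (θ : Perm n → ℚ[𝔖 m ]) → (∀ u → x ·ₐ u ≈ₐ x *ₐ ιₐ (θ u)) →
                ∀ (y : ℚ[𝔖 n ]) → x *ₐ y ≈ₐ x *ₐ ιₐ (extend θ y)
    *ₐ-extend θ p = linear-ext (ℚ𝔖 n) (*ₐ-linear x)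
      (linear-∘-extend (ℚ𝔖 n) θ (linear-∘-extend (ℚ𝔖 n) (λ w → gen (ι w)) (*ₐ-linear x))) p

    ·ₐ-factor : (∀ k → x ·ₐ (c ^ₚ k) ≈ₐ (q ^ℚ k) *ᴱ x) →
                ∀ u k h → u Perm.≈ ((c ^ₚ k) ∙ ι h) → x ·ₐ u ≈ₐ (q ^ℚ k) *ᴱ (x ·ₐ ι h)
    ·ₐ-factor x-·ₐ-power u k h p = trans (·ₐ-congʳ x u ((c ^ₚ k) ∙ ι h) p)
      (trans (·ₐ-∙ x (c ^ₚ k) (ι h)) (·ₐ-cong (ι h) {x ·ₐ (c ^ₚ k)} {(q ^ℚ k) *ᴱ x} (x-·ₐ-power k)))

  -- `Λ` turns a power of `c` on its right into a scalar, so multiplying `Λ` by a permutation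
  -- amounts to multiplying it by an element of ℚ𝔖ₘ, given here.
  collapse-gen : Perm n → ℚ[𝔖 m ]
  collapse-gen u = (q ^ℚ leftPower u) *ᴱ gen (leftPart u)

  collapse : ℚ[𝔖 n ] → ℚ[𝔖 m ]
  collapse = extend collapse-gen

  Λ-·ₐ-collapse : ∀ u → L ·ₐ u ≈ₐ L *ₐ ιₐ (collapse-gen u)
  Λ-·ₐ-collapse u = ·ₐ-factor L (·ₐ-power Λ-·ₐ-cycle) u (leftPower u) (leftPart u) (factorˡ u)

  -- `commutes` brings `Λ` next to `y`, where it collapses `y` into ℚ𝔖ₘ, and then moves it back to
  -- the front. So every element of F is `Λ` times an element of E.
  F-element : ∀ (y : ℚ[𝔖 n ]) → (L *ₐ ιₐ e) *ₐ y ≈ₐ L *ₐ ιₐ (e *ₐ collapse y)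
  F-element y = begin
    (L *ₐ ιₐ e) *ₐ y                  ≈⟨ *ₐ-congˡ y commutes ⟩
    (ιₐ e *ₐ L) *ₐ y                  ≈⟨ *ₐ-assoc (ιₐ e) L y ⟩
    ιₐ e *ₐ (L *ₐ y)                  ≈⟨ *ₐ-congʳ (ιₐ e) (*ₐ-extend L collapse-gen Λ-·ₐ-collapse y) ⟩
    ιₐ e *ₐ (L *ₐ ιₐ (collapse y))    ≈⟨ sym (*ₐ-assoc (ιₐ e) L (ιₐ (collapse y))) ⟩
    (ιₐ e *ₐ L) *ₐ ιₐ (collapse y)    ≈⟨ *ₐ-congˡ (ιₐ (collapse y)) (sym commutes) ⟩
    (L *ₐ ιₐ e) *ₐ ιₐ (collapse y)    ≈⟨ *ₐ-assoc L (ιₐ e) (ιₐ (collapse y)) ⟩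
    L *ₐ (ιₐ e *ₐ ιₐ (collapse y))    ≈⟨ *ₐ-congʳ L (sym (ιₐ-*ₐ e (collapse y))) ⟩
    L *ₐ ιₐ (e *ₐ collapse y) ∎
    where open SetoidReasoning (ℚ𝔖-setoid {n})

  -- Inverse of `v ↦ Λ v` from E to the restriction of F. It is computed from the witness `y`, yet
  -- respects equality in F because Λ v determines v.
  φ : F.Carrierᴹ → E.Carrierᴹ
  φ (x , y , p) = e *ₐ collapse y , collapse y , refl

  φ-section : ∀ f → L *ₐ ιₐ (proj₁ (φ f)) ≈ₐ proj₁ f
  φ-section (x , y , p) = trans (sym (F-element y)) (sym p)

  φ-Hom : Hom F.space E.space φ
  φ-Hom = record
    { cong = λ {f} {f′} p → Λ-ιₐ-injective (trans (φ-section f) (trans p (sym (φ-section f′))))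
    ; +-homo = λ _ _ → refl
    ; *-homo = λ _ _ → refl
    }

  -- The map that Frobenius reciprocity attaches to `v ↦ Λ v`. If `v = e z`, then Λ v g is Λ e times
  -- `z g`, which is the witness of membership in F.
  lift : E.Carrierᴹ → ℚ[𝔖 n ] → F.Carrierᴹ
  lift (v , z , p) g = (L *ₐ ιₐ v) *ₐ g , ιₐ z *ₐ g ,
    trans (*ₐ-congˡ g (trans (*ₐ-congʳ L (trans (ιₐ-cong p) (ιₐ-*ₐ e z))) (sym (*ₐ-assoc L (ιₐ e) (ιₐ z)))))
      (*ₐ-assoc (L *ₐ ιₐ e) (ιₐ z) g)

  lift-Homˡ : ∀ (g : ℚ[𝔖 n ]) → Hom E.space F.space (λ v → lift v g)
  lift-Homˡ g = record
    { cong = λ p → *ₐ-congˡ g (*ₐ-congʳ L (ιₐ-cong p))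
    ; +-homo = λ (v , _) (v′ , _) → *ₐ-+ˡ (L *ₐ ιₐ v) (L *ₐ ιₐ v′) g
    ; *-homo = λ r (v , _) → *ₐ-*ˡ r (L *ₐ ιₐ v) g
    }

  lift-Homʳ : ∀ v → Hom (ℚ𝔖 n) F.space (lift v)
  lift-Homʳ (v , _) = record
    { cong = *ₐ-congʳ (L *ₐ ιₐ v)
    ; +-homo = λ _ _ → refl
    ; *-homo = λ _ _ → refl
    }

  ιₐ-·ₐ : ∀ (x : ℚ[𝔖 m ]) h → L *ₐ ιₐ (x ·ₐ h) ≈ₐ (L *ₐ ιₐ x) ·ₐ ι h
  ιₐ-·ₐ x h = trans (*ₐ-congʳ L (ιₐ-*ₐ x (gen h))) (*ₐ-·ₐ L (ιₐ x) (ι h))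

  lift-balanced : ∀ h v (g : ℚ[𝔖 n ]) → lift (v E.· h) g F.≈ᴹ lift v (gen (ι h) *ₐ g)
  lift-balanced h (v , _) g = trans (*ₐ-congˡ g (ιₐ-·ₐ v h)) (*ₐ-assoc (L *ₐ ιₐ v) (gen (ι h)) g)

  to-last? : ∀ i (u : Perm n) → Dec (u ⟨$⟩ʳ i ≡ last)
  to-last? i u = (u ⟨$⟩ʳ i) Finₚ.≟ last

  -- Projection onto the span of the permutations that send `i` to `last`. These form one coset of
  -- 𝔖ₘ: left multiplication by 𝔖ₘ preserves it (`π-ι`) and right multiplication permutes the cosets
  -- (`π-·ₐ`).
  π : Fin n → ℚ[𝔖 n ] → ℚ[𝔖 n ]
  π i = extend (λ u → indicator (to-last? i u) *ᴱ gen u)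

  π-Hom : ∀ i → Hom (ℚ𝔖 n) (ℚ𝔖 n) (π i)
  π-Hom i = record
    { cong = extend-cong λ { (same u w p) → trans
        (LeftModule.*ₗ-cong (ℚ𝔖 n) (indicator-⇔ (to-last? i u) (to-last? i w) (≡.trans (≡.sym (p i))) (≡.trans (p i))) refl)
        (*-cong _ (gen-cong {u = u} {w} p)) }
    ; +-homo = λ _ _ → refl
    ; *-homo = λ _ _ → refl
    }

  π-ι : ∀ i h g → π i (gen (ι h) *ₐ g) ≈ₐ gen (ι h) *ₐ π i g
  π-ι i h = linear-ext (ℚ𝔖 n)
    (linear-∘-extend (ℚ𝔖 n) (λ w → gen (ι h ∙ w)) (Hom⇒Linear (π-Hom i)))
    (linear-∘-extend (ℚ𝔖 n) (λ u → indicator (to-last? i u) *ᴱ gen u) (*ₐ-linear (gen (ι h))))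
    λ u → LeftModule.*ₗ-cong (ℚ𝔖 n) (indicator-⇔ (to-last? i (ι h ∙ u)) (to-last? i u)
      (λ p → perm-injective (ι h) (≡.trans p (≡.sym (ι-fromℕ h))))
      (λ p → ≡.trans (≡.cong (ι h ⟨$⟩ʳ_) p) (ι-fromℕ h))) refl

  π-·ₐ : ∀ i w g → π i (g ·ₐ w) ≈ₐ π (w ⟨$⟩ʳ i) g ·ₐ w
  π-·ₐ i w = linear-ext (ℚ𝔖 n)
    (linear-∘-extend (ℚ𝔖 n) (λ u → gen (u ∙ w)) (Hom⇒Linear (π-Hom i)))
    (linear-∘-extend (ℚ𝔖 n) (λ u → indicator (to-last? (w ⟨$⟩ʳ i) u) *ᴱ gen u) (·ₐ-linear w))
    λ u → refl

  ∑-π : ∀ g → ∑ (ℚ𝔖 n) (λ i → π i g) ≈ₐ g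
  ∑-π = linear-ext (ℚ𝔖 n) (Hom⇒Linear (Hom-∑ {n = n} π-Hom))
    (record { 0-homo = refl ; +-homo = λ _ _ → refl ; -‿homo = λ _ → refl ; *-homo = λ _ _ → refl })
    λ u → trans (∑-*ᵣ (ℚ𝔖 n) (λ i → indicator (to-last? i u)) (gen u))
      (trans (LeftModule.*ₗ-cong (ℚ𝔖 n) (total u) refl) (*-identity (gen u)))
    where
    total : ∀ u → sum (λ i → indicator (to-last? i u)) ≡ 1ℚ
    total u = ≡.trans (sum-cong-≗ {n} (λ i → ≡.trans
        (indicator-⇔ (to-last? i u) ((u ⟨$⟩ˡ last) Finₚ.≟ i)
          (λ p → ≡.trans (≡.cong (u ⟨$⟩ˡ_) (≡.sym p)) (Perm.inverseˡ u))
          (λ p → ≡.trans (≡.cong (u ⟨$⟩ʳ_) (≡.sym p)) (Perm.inverseʳ u)))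
        (≡.sym (ℚₚ.*-identityʳ _))))
      (sum-indicator-≟ (u ⟨$⟩ˡ last) (λ _ → 1ℚ))

  M-gen : Fin n → E.Carrierᴹ × ℚ[𝔖 n ] → F.Carrierᴹ
  M-gen i (v , g) = lift v (π i g)

  M : Fin n → Ind.Carrierᴹ → F.Carrierᴹ
  M i = fold F.space (M-gen i)

  M-Hom : ∀ i → Hom Ind.space F.space (M i)
  M-Hom i = fold-Hom resp-M
    where
    resp-M : ∀ {x y} → T.Relation x y → fold F.space (M-gen i) x F.≈ᴹ fold F.space (M-gen i) y
    resp-M (T.⊗-cong {a} {a′} {b} {b′} p r) =
      trans (Hom.cong (lift-Homˡ (π i b)) {a} {a′} p) (Hom.cong (lift-Homʳ a′) {π i b} {π i b′} (Hom.cong (π-Hom i) r))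
    resp-M (T.+ˡ a a′ b) = Hom.+-homo (lift-Homˡ (π i b)) a a′
    resp-M (T.+ʳ a b b′) = refl
    resp-M (T.*ˡ r a b) = Hom.*-homo (lift-Homˡ (π i b)) r a
    resp-M (T.*ʳ r a b) = refl
    resp-M (T.balanced h a b) = trans (lift-balanced h a (π i b))
      (Hom.cong (lift-Homʳ a) {gen (ι h) *ₐ π i b} {π i (gen (ι h) *ₐ b)} (sym (π-ι i h b)))

  M-· : ∀ i w b → M i (b Ind.· w) F.≈ᴹ M (w ⟨$⟩ʳ i) b F.· w
  M-· i w = linear-ext F.space
    (linear-∘-extend F.space (λ (a , b) → gen (a , b ·ₐ w)) (Hom⇒Linear {W = F.space} (M-Hom i)))
    (Hom⇒Linear {W = F.space} (Hom-∘ {Ind.space} {F.space} {F.space} ·-Hom (M-Hom (w ⟨$⟩ʳ i))))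
    λ (v , g) → trans (Hom.cong (lift-Homʳ v) {π i (g ·ₐ w)} (π-·ₐ i w g)) (*ₐ-·ₐ (L *ₐ ιₐ (proj₁ v)) (π (w ⟨$⟩ʳ i) g) w)
    where
    ·-Hom : Hom F.space F.space (F._· w)
    ·-Hom = record { cong = ·ₐ-cong w ; +-homo = λ _ _ → refl ; *-homo = λ _ _ → refl }

  representative : Fin n → Perm n
  representative i = c ^ₚ (m ∸ toℕ i)

  ⊗-Homˡ : ∀ (g : ℚ[𝔖 n ]) → Hom E.space Ind.space (λ v → v T.⊗ g)
  ⊗-Homˡ g = record
    { cong = λ p → rel (T.⊗-cong p refl)
    ; +-homo = λ v v′ → rel (T.+ˡ v v′ g)
    ; *-homo = λ r v → rel (T.*ˡ r v g)
    }

  ⊗-Homʳ : ∀ v → Hom (ℚ𝔖 n) Ind.space (λ g → v T.⊗ g)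
  ⊗-Homʳ v = record
    { cong = λ p → rel (T.⊗-cong refl p)
    ; +-homo = λ g g′ → rel (T.+ʳ v g g′)
    ; *-homo = λ r g → rel (T.*ʳ r v g)
    }

  -- Produces the tensor whose only component is `x`, at `i` (`M-R`): with `r` the coset
  -- representative, `x = Λ v r` is solved by `v = φ (x r⁻¹)`.
  R : Fin n → F.Carrierᴹ → Ind.Carrierᴹ
  R i x = φ (x F.· representative i ⁻¹) T.⊗ gen (representative i)

  R-Hom : ∀ i → Hom F.space Ind.space (R i)
  R-Hom i = Hom-∘ {F.space} {E.space} {Ind.space} (⊗-Homˡ (gen (representative i)))
    (Hom-∘ {F.space} {F.space} {E.space} {φ} {λ x → x F.· representative i ⁻¹} φ-Hom
      (record { cong = ·ₐ-cong (representative i ⁻¹) ; +-homo = λ _ _ → refl ; *-homo = λ _ _ → refl }))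

  -- Both `u` and the representative `r` send `i` to `last`, so `u r⁻¹` lies in 𝔖ₘ, and the relation
  -- `balanced` carries it across the tensor sign.
  R-lift : ∀ i v u → u ⟨$⟩ʳ i ≡ last → R i (lift v (gen u)) Ind.≈ᴹ v T.⊗ gen u
  R-lift i v u p = trans (Hom.cong (⊗-Homˡ (gen r)) {φ f} {v E.· h} φ-value)
    (trans (rel (T.balanced h v (gen r))) (Hom.cong (⊗-Homʳ v) {gen (ι h ∙ r)} {gen u} (gen-cong {u = ι h ∙ r} {u} ιh∙r)))
    where
    r : Perm n
    r = representative i

    h : Perm m
    h = restrict (u ∙ r ⁻¹)

    f : F.Carrierᴹ
    f = lift v (gen u) F.· r ⁻¹

    ιh : ι h Perm.≈ (u ∙ r ⁻¹)
    ιh = ι-restrict (u ∙ r ⁻¹)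
      (≡.trans (≡.cong (λ k → u ⟨$⟩ʳ (r ⟨$⟩ˡ k)) (≡.sym (power-to-last i))) (≡.trans (≡.cong (u ⟨$⟩ʳ_) (Perm.inverseˡ r)) p))

    ιh∙r : (ι h ∙ r) Perm.≈ u
    ιh∙r k = ≡.trans (ιh (r ⟨$⟩ʳ k)) (≡.cong (u ⟨$⟩ʳ_) (Perm.inverseˡ r))

    φ-value : φ f E.≈ᴹ v E.· h
    φ-value = Λ-ιₐ-injective (begin
      L *ₐ ιₐ (proj₁ (φ f))                       ≈⟨ φ-section f ⟩
      ((L *ₐ ιₐ (proj₁ v)) ·ₐ u) ·ₐ r ⁻¹          ≈⟨ sym (·ₐ-∙ (L *ₐ ιₐ (proj₁ v)) u (r ⁻¹)) ⟩
      (L *ₐ ιₐ (proj₁ v)) ·ₐ (u ∙ r ⁻¹)           ≈⟨ ·ₐ-congʳ (L *ₐ ιₐ (proj₁ v)) (u ∙ r ⁻¹) (ι h) (≈ₚ-sym {u = ι h} {u ∙ r ⁻¹} ιh) ⟩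
      (L *ₐ ιₐ (proj₁ v)) ·ₐ ι h                  ≈⟨ sym (ιₐ-·ₐ (proj₁ v) h) ⟩
      L *ₐ ιₐ (proj₁ v ·ₐ h) ∎)
      where open SetoidReasoning (ℚ𝔖-setoid {n})

  R-lift-π : ∀ i v g → R i (lift v (π i g)) Ind.≈ᴹ v T.⊗ π i g
  R-lift-π i v = linear-ext Ind.space
    (Hom⇒Linear {R = SamePerm} {W = Ind.space} (Hom-∘ {ℚ𝔖 n} {ℚ𝔖 n} {Ind.space} R∘lift (π-Hom i)))
    (Hom⇒Linear {R = SamePerm} {W = Ind.space} (Hom-∘ {ℚ𝔖 n} {ℚ𝔖 n} {Ind.space} (⊗-Homʳ v) (π-Hom i)))
    λ u → trans (Hom.*-homo R∘lift (indicator (to-last? i u)) (gen u))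
      (trans (indicator-*ₗ-cong Ind.space (to-last? i u) (R-lift i v u))
        (sym (Hom.*-homo (⊗-Homʳ v) (indicator (to-last? i u)) (gen u))))
    where
    R∘lift : Hom (ℚ𝔖 n) Ind.space (λ g → R i (lift v g))
    R∘lift = Hom-∘ {ℚ𝔖 n} {F.space} {Ind.space} (R-Hom i) (lift-Homʳ v)

  assemble : (Fin n → F.Carrierᴹ) → Ind.Carrierᴹ
  assemble x = ∑ Ind.space (λ i → R i (x i))

  -- A left inverse of the family `M`. Injectivity of `M` on the presented tensor product rests on
  -- it, since components alone decide nothing about a generated equality.
  assemble-M : ∀ b → assemble (λ i → M i b) Ind.≈ᴹ b
  assemble-M = linear-ext Ind.space
    (Hom⇒Linear {W = Ind.space} (Hom-∑ {Ind.space} {Ind.space} {n} (λ i → Hom-∘ {Ind.space} {F.space} {Ind.space} (R-Hom i) (M-Hom i))))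
    (record { 0-homo = refl ; +-homo = λ _ _ → refl ; -‿homo = λ _ → refl ; *-homo = λ _ _ → refl })
    λ (v , g) → trans (∑-cong Ind.space {n} (λ i → R-lift-π i v g))
      (trans (sym (Hom.∑-homo (⊗-Homʳ v) {n} (λ i → π i g))) (Hom.cong (⊗-Homʳ v) (∑-π g)))

  M-injective : ∀ {b b′} → (∀ i → M i b F.≈ᴹ M i b′) → b Ind.≈ᴹ b′
  M-injective {b} {b′} p = trans (sym (assemble-M b))
    (trans (∑-cong Ind.space {n} (λ i → Hom.cong (R-Hom i) {M i b} {M i b′} (p i))) (assemble-M b′))

  M-R : ∀ j i x → M j (R i x) F.≈ᴹ δ i j F.*ₗ x
  M-R j i x = trans (*-cong (indicator (to-last? j r)) (trans (·ₐ-cong r (φ-section (x F.· r ⁻¹)))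
      (trans (sym (·ₐ-∙ (proj₁ x) (r ⁻¹) r)) (trans (·ₐ-congʳ (proj₁ x) (r ⁻¹ ∙ r) Perm.id (λ _ → Perm.inverseˡ r)) (·ₐ-id (proj₁ x))))))
    (LeftModule.*ₗ-cong (ℚ𝔖 n) (≡.trans
      (indicator-⇔ (to-last? j r) (i Finₚ.≟ j)
        (λ p → perm-injective r (≡.trans (power-to-last i) (≡.sym p)))
        (λ { ≡.refl → power-to-last i }))
      (indicator-δ i j)) refl)
    where
    r : Perm n
    r = representative i

    indicator-δ : ∀ {k} (i j : Fin k) → indicator (i Finₚ.≟ j) ≡ δ i j
    indicator-δ zero    zero    = ≡.refl
    indicator-δ zero    (suc j) = ≡.refl
    indicator-δ (suc i) zero    = ≡.refl
    indicator-δ (suc i) (suc j) = ≡.trans (indicator-⇔ (suc i Finₚ.≟ suc j) (i Finₚ.≟ j) Finₚ.suc-injective (≡.cong suc)) (indicator-δ i j)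

  M-assemble : ∀ j x → M j (assemble x) F.≈ᴹ x j
  M-assemble j x = trans (Hom.∑-homo (M-Hom j) {n} (λ i → R i (x i)))
    (trans (∑-cong F.space {n} {λ i → M j (R i (x i))} {λ i → δ i j F.*ₗ x i} (λ i → M-R j i (x i))) (∑-δ F.space {n} j x))

  N : Fin n → VF.Carrierᴹ → F.Carrierᴹ
  N i = fold F.space (λ (v , x) → proj₁ v i F.*ₗ x)

  N-Hom : ∀ i → Hom VF.space F.space (N i)
  N-Hom i = fold-Hom resp-N
    where
    resp-N : ∀ {x y} → U.Relation x y → N i x F.≈ᴹ N i y
    resp-N (U.⊗-cong p r) = LeftModule.*ₗ-cong (ℚ𝔖 n) (p i) r
    resp-N (U.+ˡ (a , _) (a′ , _) (x , _)) = *-distribʳ x (a i) (a′ i)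
    resp-N (U.+ʳ (a , _) (x , _) (x′ , _)) = *-distribˡ (a i) x x′
    resp-N (U.*ˡ r (a , _) (x , _)) = *-assoc r (a i) x
    resp-N (U.*ʳ r (a , _) (x , _)) = *ₗ-swap (ℚ𝔖 n) (a i) r x

  N-· : ∀ i w t → N i (t VF.· w) F.≈ᴹ N (w ⟨$⟩ʳ i) t F.· w
  N-· i w = linear-ext F.space
    (linear-∘-extend F.space (λ (v , x) → gen (v V.· w , x F.· w)) (Hom⇒Linear {W = F.space} (N-Hom i)))
    (Hom⇒Linear {W = F.space} (Hom-∘ {VF.space} {F.space} {F.space} ·-Hom (N-Hom (w ⟨$⟩ʳ i))))
    λ _ → refl
    where
    ·-Hom : Hom F.space F.space (F._· w)
    ·-Hom = record { cong = ·ₐ-cong w ; +-homo = λ _ _ → refl ; *-homo = λ _ _ → refl }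

  ∑-N : ∀ t → ∑ F.space (λ i → N i t) F.≈ᴹ F.0ᴹ
  ∑-N = linear-ext F.space (Hom⇒Linear {W = F.space} (Hom-∑ {VF.space} {F.space} {n} N-Hom)) (linear-zero F.space)
    λ ((v , p) , x) → trans (∑-*ᵣ F.space {n} v x) (trans (LeftModule.*ₗ-cong (ℚ𝔖 n) p refl) (*-zeroˡ (proj₁ x)))

  -- The vectors e_i - e_0, including the zero vector at i = 0: a vector of coordinate sum 0 then
  -- expands with its own coordinates as coefficients.
  spanning : Fin n → V.Carrierᴹ
  spanning i = (λ k → δ i k ℚ.- δ zero k)
      , ≡.trans (∑-distrib-+ (δ i) (λ k → ℚ.- δ zero k))
          (≡.cong₂ ℚ._+_ (sum-δ-row i) (≡.trans (sum-neg (δ {n} zero)) (≡.cong ℚ.-_ (sum-δ-row {n} zero))))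

  V-expansion : ∀ v → ∑ V.space (λ i → proj₁ v i V.*ₗ spanning i) V.≈ᴹ v
  V-expansion v k = ≡.trans (Hom.∑-homo coordinate {n} (λ i → proj₁ v i V.*ₗ spanning i))
    (≡.trans (sum-cong-≗ {n} (λ i → ℚₚ.*-comm (proj₁ v i) (δ i k ℚ.- δ zero k)))
      (∑-δ-difference ℚᵥ zero k (proj₁ v) (proj₂ v)))
    where
    coordinate : Hom V.space ℚᵥ (λ v → proj₁ v k)
    coordinate = record { cong = λ p → p k ; +-homo = λ _ _ → ≡.refl ; *-homo = λ _ _ → ≡.refl }

  assembleVF : (Fin n → F.Carrierᴹ) → VF.Carrierᴹ
  assembleVF x = ∑ VF.space (λ i → spanning i U.⊗ x i)

  U-Homˡ : ∀ x → Hom V.space VF.space (λ v → v U.⊗ x)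
  U-Homˡ x = record
    { cong = λ p → rel (U.⊗-cong p refl)
    ; +-homo = λ v v′ → rel (U.+ˡ v v′ x)
    ; *-homo = λ r v → rel (U.*ˡ r v x)
    }

  U-Homʳ : ∀ v → Hom F.space VF.space (λ x → v U.⊗ x)
  U-Homʳ v = record
    { cong = λ p → rel (U.⊗-cong (λ _ → ≡.refl) p)
    ; +-homo = λ x x′ → rel (U.+ʳ v x x′)
    ; *-homo = λ r x → rel (U.*ʳ r v x)
    }

  assembleVF-N : ∀ t → assembleVF (λ i → N i t) VF.≈ᴹ t
  assembleVF-N = linear-ext VF.space
    (Hom⇒Linear {W = VF.space} (Hom-∑ {VF.space} {VF.space} {n} (λ i → Hom-∘ {VF.space} {F.space} {VF.space} (U-Homʳ (spanning i)) (N-Hom i))))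
    (record { 0-homo = refl ; +-homo = λ _ _ → refl ; -‿homo = λ _ → refl ; *-homo = λ _ _ → refl })
    λ (v , x) → trans
      (∑-cong VF.space {n} (λ i → trans (Hom.*-homo (U-Homʳ (spanning i)) (proj₁ v i) x) (sym (Hom.*-homo (U-Homˡ x) (proj₁ v i) (spanning i)))))
      (trans (sym (Hom.∑-homo (U-Homˡ x) {n} (λ i → proj₁ v i V.*ₗ spanning i))) (Hom.cong (U-Homˡ x) (V-expansion v)))

  N-assembleVF : ∀ k x → ∑ F.space x F.≈ᴹ F.0ᴹ → N k (assembleVF x) F.≈ᴹ x k
  N-assembleVF k x p = trans (Hom.∑-homo (N-Hom k) {n} (λ i → spanning i U.⊗ x i)) (∑-δ-difference F.space zero k x p)

  total : Ind.Carrierᴹ → F.Carrierᴹ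
  total = fold F.space (λ (v , g) → lift v g)

  total-Hom : Hom Ind.space F.space total
  total-Hom = fold-Hom resp-total
    where
    resp-total : ∀ {x y} → T.Relation x y → total x F.≈ᴹ total y
    resp-total (T.⊗-cong {a} {a′} {g} {g′} p r) = trans (Hom.cong (lift-Homˡ g) {a} {a′} p) (Hom.cong (lift-Homʳ a′) {g} {g′} r)
    resp-total (T.+ˡ a a′ g) = Hom.+-homo (lift-Homˡ g) a a′
    resp-total (T.+ʳ a g g′) = refl
    resp-total (T.*ˡ r a g) = Hom.*-homo (lift-Homˡ g) r a
    resp-total (T.*ʳ r a g) = refl
    resp-total (T.balanced h a g) = lift-balanced h a g

  -- The cosets exhaust the group (`∑-π`). It follows that the kernel of `total` consists of the
  -- elements whose components sum to 0, which is the image of `N`.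
  total-M : ∀ x → total x F.≈ᴹ ∑ F.space (λ i → M i x)
  total-M = linear-ext F.space (Hom⇒Linear {W = F.space} total-Hom) (Hom⇒Linear {W = F.space} (Hom-∑ {Ind.space} {F.space} {n} M-Hom))
    λ (v , g) → trans (sym (Hom.cong (lift-Homʳ v) {∑ (ℚ𝔖 n) (λ i → π i g)} (∑-π g))) (Hom.∑-homo (lift-Homʳ v) {n} (λ i → π i g))

  -- The sequence 0 → V → ℚⁿ → 1 → 0 tensored with F, where `M` identifies ℚⁿ ⊗ F with the induced
  -- representation. Identities in the middle term are checked on components.
  shortExact : ShortExact (reflection m ⊗ᴿ F e) (induced (E e)) (F e)
  shortExact = record
    { f = f
    ; g = total
    ; f-linear = Hom.isLeftModuleHomomorphism f-Hom
    ; g-linear = Hom.isLeftModuleHomomorphism total-Hom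
    ; f-equivariant = λ t w → M-injective λ i → trans (M-f i (t VF.· w)) (trans (N-· i w t)
        (sym (trans (M-· i w (f t)) (·ₐ-cong w (M-f (w ⟨$⟩ʳ i) t)))))
    ; g-equivariant = λ b w → total-· w b
    ; f-injective = λ {t} {t′} p → trans (sym (assembleVF-N t)) (trans
        (∑-cong VF.space {n} (λ i → Hom.cong (U-Homʳ (spanning i)) {N i t} {N i t′}
          (trans (sym (M-f i t)) (trans (Hom.cong (M-Hom i) p) (M-f i t′)))))
        (assembleVF-N t′))
    -- The preimage has `x` as its component at `zero` and 0 elsewhere, so its components sum to
    -- `x`.
    ; g-surjective = λ x → R zero x , trans (total-M (R zero x)) (trans
        (∑-cong F.space {n} {λ j → M j (R zero x)} {λ j → δ zero j F.*ₗ x} (λ j → M-R j zero x))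
        (trans (∑-*ᵣ F.space {n} (δ zero) x) (trans (LeftModule.*ₗ-cong (ℚ𝔖 n) (sum-δ-row {n} zero) refl) (*-identity (proj₁ x)))))
    ; im⊆ker = λ t → trans (total-M (f t)) (trans (∑-cong F.space {n} {λ i → M i (f t)} {λ i → N i t} (λ i → M-f i t)) (∑-N t))
    ; ker⊆im = λ x p → assembleVF (λ i → M i x) , M-injective λ i →
        trans (M-f i (assembleVF (λ i → M i x))) (N-assembleVF i (λ i → M i x) (trans (sym (total-M x)) p))
    }
    where
    f : VF.Carrierᴹ → Ind.Carrierᴹ
    f t = assemble (λ i → N i t)

    f-Hom : Hom VF.space Ind.space f
    f-Hom = Hom-∑ {VF.space} {Ind.space} {n} (λ i → Hom-∘ {VF.space} {F.space} {Ind.space} (R-Hom i) (N-Hom i))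

    M-f : ∀ i t → M i (f t) F.≈ᴹ N i t
    M-f i t = M-assemble i (λ i → N i t)

    total-· : ∀ w x → total (x Ind.· w) F.≈ᴹ total x F.· w
    total-· w = linear-ext F.space
      (linear-∘-extend F.space (λ (v , g) → gen (v , g ·ₐ w)) (Hom⇒Linear {W = F.space} total-Hom))
      (Hom⇒Linear {W = F.space} (Hom-∘ {Ind.space} {F.space} {F.space} {F._· w} {total}
        (record { cong = ·ₐ-cong w ; +-homo = λ _ _ → refl ; *-homo = λ _ _ → refl }) total-Hom))
      λ (v , g) → *ₐ-·ₐ (L *ₐ ιₐ (proj₁ v)) g w

-- Classes in the representation ring

module _ {n : ℕ} where

  -- Each generator lies in the ideal of the other, so the ideals coincide and `f` is the identity
  -- on underlying elements. The cokernel is the zero module, realised as the ideal of `0ᴱ`.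
  rightIdeal-exact : ∀ {a b : ℚ[𝔖 n ]} → (∃[ y ] a ≈ₐ b *ₐ y) → (∃[ z ] b ≈ₐ a *ₐ z) →
                     ShortExact (rightIdeal a) (rightIdeal b) (rightIdeal 0ᴱ)
  rightIdeal-exact {a} {b} (y , p) (z , r) = record
    { f = λ (x , w , t) → x , y *ₐ w , trans t (trans (*ₐ-congˡ w p) (*ₐ-assoc b y w))
    ; g = λ _ → 0ᴱ , 0ᴱ , refl
    ; f-linear = Hom.isLeftModuleHomomorphism {Rep.space (rightIdeal a)} {Rep.space (rightIdeal b)}
        (record { cong = λ t → t ; +-homo = λ _ _ → refl ; *-homo = λ _ _ → refl })
    ; g-linear = Hom.isLeftModuleHomomorphism {Rep.space (rightIdeal b)} {Rep.space (rightIdeal 0ᴱ)}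
        (record { cong = λ _ → refl ; +-homo = λ _ _ → sym (+-identity 0ᴱ) ; *-homo = λ s _ → sym (*-zeroʳ s) })
    ; f-equivariant = λ _ _ → refl
    ; g-equivariant = λ _ _ → refl
    ; f-injective = λ t → t
    ; g-surjective = λ (x , w , t) → (0ᴱ , 0ᴱ , refl) , sym (trans t (*ₐ-0ˡ w))
    ; im⊆ker = λ _ → refl
    ; ker⊆im = λ (x , w , t) _ → (x , z *ₐ w , trans t (trans (*ₐ-congˡ w r) (*ₐ-assoc a z w))) , refl
    }

  rightIdeal-~ : ∀ {a b : ℚ[𝔖 n ]} → (∃[ y ] a ≈ₐ b *ₐ y) → (∃[ z ] b ≈ₐ a *ₐ z) →
                 [ rightIdeal a ] ~ [ rightIdeal b ]
  rightIdeal-~ {a} {b} p r = sym (trans (exact (rightIdeal-exact p r))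
    (trans (⊕-cong refl zero-class) (trans (⊕-comm _ _) (⊕-identity _))))
    where
    open import Algebra.Properties.Group (CommutativeRing.+-group R[𝔖 n ]) using (identityˡ-unique)

    -- The exact sequence of three zero modules reads [0] = [0] + [0]; cancel.
    zero-class : [ rightIdeal 0ᴱ ] ~ 𝟘
    zero-class = identityˡ-unique [ rightIdeal 0ᴱ ] [ rightIdeal 0ᴱ ]
      (sym (exact (rightIdeal-exact (0ᴱ , refl) (0ᴱ , refl))))

induced-E-class : ∀ {m} (e : ℚ[𝔖 m ]) → Λ m *ₐ ιₐ e ≈ₐ ιₐ e *ₐ Λ m →
                  [ induced (E e) ] ~ [ reflection m ] ⊛ [ F e ] ⊕ [ F e ]
induced-E-class {m} e commutes = trans (exact (Induction.shortExact m e commutes))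
  (⊕-cong (sym (tensor (reflection m) (F e))) refl)

module TopClass (m : ℕ) (e : ℚ[𝔖 suc m ]) (e′ : ℚ[𝔖 m ]) (commutes : Λ m *ₐ ιₐ e′ ≈ₐ ιₐ e′ *ₐ Λ m)
  (e-≈-ε : e ≈ₐ coeff Perm.id e *ᴱ ε) (e-*ₐ-ε : e *ₐ ε ≈ₐ ε)
  (e′-≈-ε : e′ ≈ₐ coeff Perm.id e′ *ᴱ ε) (e′-*ₐ-ε : e′ *ₐ ε ≈ₐ ε) where
  open Cycle m

  private
    n : ℕ
    n = suc m

    z : ℚ[𝔖 n ]
    z = Λ m *ₐ ιₐ e′

    a t k : ℚ
    a = coeff Perm.id e
    t = coeff Perm.id e′
    k = coeff (Perm.id {m}) (ε *ₐ ε)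

  -- Since `t ε ε = e′ ε = ε`, comparing coefficients at the identity shows that `t` is invertible.
  -- Its inverse `k` is m!, the coefficient of the identity in ε ε.
  t*k≡1 : t ℚ.* k ≡ 1ℚ
  t*k≡1 = begin
    t ℚ.* k
      ≡⟨ ≡.sym (coeff-cong (Perm.id {m}) {(t *ᴱ ε) *ₐ ε} {t *ᴱ (ε *ₐ ε)} (*ₐ-*ˡ t ε ε)) ⟩
    coeff (Perm.id {m}) ((t *ᴱ ε) *ₐ ε)
      ≡⟨ ≡.sym (coeff-cong (Perm.id {m}) {e′ *ₐ ε} {(t *ᴱ ε) *ₐ ε} (*ₐ-congˡ ε e′-≈-ε)) ⟩
    coeff (Perm.id {m}) (e′ *ₐ ε)
      ≡⟨ coeff-cong (Perm.id {m}) {e′ *ₐ ε} {ε} e′-*ₐ-ε ⟩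
    coeff (Perm.id {m}) ε
      ≡⟨ coeff-ε (Perm.id {m}) ⟩
    sgn (Perm.id {m})
      ≡⟨ sgn-id {m} ⟩
    1ℚ ∎
    where open ≡.≡-Reasoning

  e′-·ₐ : ∀ h → e′ ·ₐ h ≈ₐ sgn h *ᴱ e′
  e′-·ₐ h = trans (·ₐ-cong h (e′-≈-ε))
    (trans (*-cong t (ε-·ₐ h)) (trans (*ₗ-swap (ℚ𝔖 m) t (sgn h) ε) (*-cong (sgn h) (sym (e′-≈-ε)))))

  z-·ₐ-cycle : z ·ₐ c ≈ₐ q *ᴱ z
  z-·ₐ-cycle = trans (·ₐ-cong c commutes) (trans (sym (*ₐ-·ₐ (ιₐ e′) (Λ m) c))
    (trans (*ₐ-congʳ (ιₐ e′) Λ-·ₐ-cycle) (*-cong q (sym commutes))))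

  z-·ₐ-ι : ∀ h → z ·ₐ ι h ≈ₐ sgn h *ᴱ z
  z-·ₐ-ι h = trans (sym (Induction.ιₐ-·ₐ m e′ commutes e′ h))
    (*ₐ-congʳ (Λ m) (ιₐ-cong (e′-·ₐ h)))

  -- The sign rule holds for `c`, through `Λ`, and for 𝔖ₘ, through `e′`; every permutation is a
  -- product of the two kinds.
  z-·ₐ : ∀ u → z ·ₐ u ≈ₐ sgn u *ᴱ z
  z-·ₐ u = trans (Induction.·ₐ-factor m e′ commutes z (·ₐ-power z-·ₐ-cycle) u i h (factorˡ u))
    (trans (*-cong (q ^ℚ i) (z-·ₐ-ι h)) (trans (sym (*-assoc (q ^ℚ i) (sgn h) z))
      (LeftModule.*ₗ-cong (ℚ𝔖 n) (≡.sym sgn-factor) refl)))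
    where
    i : ℕ
    i = leftPower u

    h : Perm m
    h = leftPart u

    sgn-factor : sgn u ≡ (q ^ℚ i) ℚ.* sgn h
    sgn-factor = ≡.trans (sgn-cong {u = u} {(c ^ₚ i) ∙ ι h} (factorˡ u))
      (≡.trans (sgn-∙ (c ^ₚ i) (ι h)) (≡.cong₂ ℚ._*_ (sgn-^ c i) (sgn-ι h)))

  coeff-z-id : coeff Perm.id z ≡ t
  coeff-z-id = ≡.trans (coeff-resp {u = Perm.id} {ι Perm.id} (≈ₚ-sym {u = ι Perm.id} {Perm.id} ι-id) z) (coeff-Λ-*ₐ-ιₐ Perm.id e′)

  -- Right translation by `u⁻¹` moves the coefficient at `u` to the identity at the cost of a sign,
  -- so the coefficient at the identity determines `z`.
  F-≈-ε : z ≈ₐ t *ᴱ ε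
  F-≈-ε = coeff-ext λ u → begin
    coeff u z                     ≡⟨ coeff-resp {u = u} {Perm.id ∙ (u ⁻¹) ⁻¹} (λ _ → ≡.refl) z ⟩
    coeff (Perm.id ∙ (u ⁻¹) ⁻¹) z ≡⟨ ≡.sym (coeff-·ₐ Perm.id (u ⁻¹) z) ⟩
    coeff Perm.id (z ·ₐ u ⁻¹)     ≡⟨ coeff-cong Perm.id (z-·ₐ (u ⁻¹)) ⟩
    sgn (u ⁻¹) ℚ.* coeff Perm.id z ≡⟨ ≡.cong₂ ℚ._*_ (≡.trans (sgn-⁻¹ u) (≡.sym (coeff-ε u))) coeff-z-id ⟩
    coeff u ε ℚ.* t               ≡⟨ ℚₚ.*-comm (coeff u ε) t ⟩
    t ℚ.* coeff u ε ∎
    where open ≡.≡-Reasoning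

  ε-in-F : ε ≈ₐ k *ᴱ (z *ₐ gen Perm.id)
  ε-in-F = sym (trans (*-cong k (trans (*ₐ-identityʳ z) F-≈-ε)) (trans (sym (*-assoc k t ε))
    (trans (LeftModule.*ₗ-cong (ℚ𝔖 n) (≡.trans (ℚₚ.*-comm k t) t*k≡1) refl) (*-identity ε))))

  class : [ E e ] ~ [ F e′ ]
  -- The first witness comes from `e = a ε` and `ε = k z`, the second from `z = t ε` and `ε = e ε`.
  class = rightIdeal-~
    (a *ᴱ (k *ᴱ gen Perm.id) , trans e-≈-ε (*-cong a ε-in-F))
    (t *ᴱ ε , trans F-≈-ε (*-cong t (sym e-*ₐ-ε)))

-- Power series over a commutative ring and the comparison of coefficients

module Series {r ℓ} (R : CommutativeRing r ℓ) where
  open CommutativeRing R renaming (refl to ≈-refl; sym to ≈-sym; trans to ≈-trans; _-_ to _−_;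
    +-cong to +-congᴿ; *-cong to *-congᴿ; +-assoc to +-assocᴿ; +-comm to +-commᴿ)
  private
    module S = RawRing (R ⟦t⟧)
    module R∑ = MonoidSum +-commutativeMonoid
  open import Algebra.Properties.Group +-group using (∙-cancelʳ)

  sum-single : ∀ {n} (f : Fin n → Carrier) i → (∀ j → j ≢ i → f j ≈ 0#) → R∑.sum f ≈ f i
  sum-single {suc n} f i p = ≈-trans (R∑.sum-remove {n} {i} f)
    (≈-trans (+-congᴿ ≈-refl (≈-trans (R∑.sum-cong-≋ {n} (λ j → p (punchIn i j) (Finₚ.punchInᵢ≢i i j))) (R∑.sum-replicate-zero n)))
      (+-identityʳ (f i)))

  series : ℕ → (ℕ → Carrier) → ℕ → Carrier
  series N x = ∑₁ S.+-rawMonoid N (λ j → x j t^[ R ] (N ∸ j))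

  module _ (N : ℕ) (x : ℕ → Carrier) where

    term : ℕ → Fin N → Carrier
    term k i = monomial R (x (suc (toℕ i))) (N ∸ suc (toℕ i)) k

    series-coeff : ∀ k → series N x k ≈ R∑.sum (term k)
    series-coeff k = pointwise {N} (λ i → monomial R (x (suc (toℕ i))) (N ∸ suc (toℕ i)))
      where
      pointwise : ∀ {l} (f : Fin l → ℕ → Carrier) →
                  RawMonoidDefs.sum S.+-rawMonoid f k ≈ R∑.sum (λ i → f i k)
      pointwise {zero}  f = ≈-refl
      pointwise {suc l} f = +-congᴿ ≈-refl (pointwise (f ∘ suc))

    term-≡ : ∀ k i → k ≡ N ∸ suc (toℕ i) → term k i ≈ x (suc (toℕ i))
    term-≡ k i p = reflexive (≡.cong (if_then x (suc (toℕ i)) else 0#) (dec-true (k ℕₚ.≟ (N ∸ suc (toℕ i))) p))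

    term-≢ : ∀ k i → k ≢ N ∸ suc (toℕ i) → term k i ≈ 0#
    term-≢ k i p = reflexive (≡.cong (if_then x (suc (toℕ i)) else 0#) (dec-false (k ℕₚ.≟ (N ∸ suc (toℕ i))) p))

    series-in : ∀ j → suc j ≤ N → series N x (N ∸ suc j) ≈ x (suc j)
    series-in j j<N = ≈-trans (series-coeff k)
      (≈-trans (sum-single (term k) i (λ i′ i′≢i → term-≢ k i′ λ p → i′≢i (Finₚ.toℕ-injective
          (ℕₚ.suc-injective (ℕₚ.∸-cancelˡ-≡ (Finₚ.toℕ<n i′) (Finₚ.toℕ<n i) (≡.trans (≡.sym p) at-i))))))
        (≈-trans (term-≡ k i at-i) (reflexive (≡.cong (λ l → x (suc l)) (Finₚ.toℕ-fromℕ< j<N)))))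
      where
      k : ℕ
      k = N ∸ suc j

      i : Fin N
      i = Fin.fromℕ< j<N

      at-i : k ≡ N ∸ suc (toℕ i)
      at-i = ≡.cong (λ l → N ∸ suc l) (≡.sym (Finₚ.toℕ-fromℕ< j<N))

    series-out : ∀ k → N ≤ k → series N x k ≈ 0#
    series-out k N≤k = ≈-trans (series-coeff k) (≈-trans
      (R∑.sum-cong-≋ {N} (λ i → term-≢ k i λ p → ℕₚ.<⇒≱ (below i) (≡.subst (N ≤_) p N≤k)))
      (R∑.sum-replicate-zero N))
      where
      below : ∀ i → N ∸ suc (toℕ i) < N
      below i = ℕₚ.∸-monoʳ-< (s≤s z≤n) (Finₚ.toℕ<n i)

  module _ (V : Carrier) (g : ℕ → Carrier) where

    1+tV : ℕ → Carrier
    1+tV = S.1# S.+ (V t^[ R ] 1)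

    product-zero : (1+tV S.* g) 0 ≈ g 0
    product-zero = ≈-trans (+-identityʳ _) (≈-trans (*-congᴿ (+-identityʳ 1#) ≈-refl) (*-identityˡ (g 0)))

    product-suc : ∀ k → (1+tV S.* g) (suc k) ≈ g (suc k) + V * g k
    product-suc k = +-congᴿ (≈-trans (*-congᴿ (+-identityʳ 1#) ≈-refl) (*-identityˡ (g (suc k))))
      (≈-trans (+-congᴿ (*-congᴿ (+-identityˡ V) ≈-refl)
        (≈-trans (R∑.sum-cong-≋ {k} (λ i → ≈-trans (*-congᴿ (+-identityˡ 0#) ≈-refl) (zeroˡ _))) (R∑.sum-replicate-zero k)))
      (+-identityʳ _))

  isolate-subtrahend : ∀ {a v e x} → x ≈ a + ((v + x) − e) → e ≈ a + v
  isolate-subtrahend {a} {v} {e} {x} p = ∙-cancelʳ x e (a + v) (≈-trans (+-commᴿ e x) (≈-trans (+-congᴿ p ≈-refl)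
    (≈-trans (+-assocᴿ a _ e) (≈-trans (+-congᴿ ≈-refl (≈-trans (+-assocᴿ (v + x) (- e) e)
        (≈-trans (+-congᴿ ≈-refl (-‿inverseˡ e)) (+-identityʳ (v + x)))))
      (≈-sym (+-assocᴿ a v x))))))

  isolate-subtrahend⁻¹ : ∀ {a v e x} → e ≈ a + v → x ≈ a + ((v + x) − e)
  isolate-subtrahend⁻¹ {a} {v} {e} {x} p = ≈-sym (≈-trans (≈-sym (+-assocᴿ a (v + x) (- e)))
    (≈-trans (+-congᴿ (≈-trans (≈-sym (+-assocᴿ a v x)) (≈-trans (+-congᴿ (≈-sym p) ≈-refl) (+-commᴿ e x))) ≈-refl)
      (≈-trans (+-assocᴿ x e (- e)) (≈-trans (+-congᴿ ≈-refl (-‿inverseʳ e)) (+-identityʳ x)))))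

  module Equivalence (m : ℕ) (1≤m : 1 ≤ m) (E F A : ℕ → Carrier) (V : Carrier)
    (A≈ : ∀ j → 1 ≤ j → j ≤ m → A j ≈ V * F j + F j) (top : E (suc m) ≈ F m) where

    private
      n : ℕ
      n = suc m

      -- The given family has an arbitrary value at 0, outside the range of the index; the
      -- recurrence and the empty partial sum require 0 there.
      F₀ : ℕ → Carrier
      F₀ zero    = 0#
      F₀ (suc j) = F (suc j)

    partialSum : ℕ → Carrier
    partialSum j = ∑₁ +-rawMonoid j (λ i → A i − E i)

    partialSum-suc : ∀ j → partialSum (suc j) ≈ partialSum j + (A (suc j) − E (suc j))
    partialSum-suc j = ≈-trans (R∑.sum-init-last {j} (λ i → d (suc (toℕ i))))
      (+-congᴿ (reflexive (R∑.sum-cong-≗ {j} (λ i → ≡.cong (λ l → d (suc l)) (Finₚ.toℕ-inject₁ i))))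
        (reflexive (≡.cong (λ l → d (suc l)) (Finₚ.toℕ-fromℕ j))))
      where
      d : ℕ → Carrier
      d i = A i − E i

    Recurrence : Set ℓ
    Recurrence = ∀ j → suc j ≤ m → E (suc j) ≈ F₀ j + V * F (suc j)

    step : ∀ j → suc j ≤ m → F₀ j ≈ partialSum j →
           F₀ j + ((V * F (suc j) + F (suc j)) − E (suc j)) ≈ partialSum (suc j)
    step j j<m p = ≈-trans (+-congᴿ p (+-congᴿ (≈-sym (A≈ (suc j) (s≤s z≤n) j<m)) ≈-refl)) (≈-sym (partialSum-suc j))

    PartialSums : Set ℓ
    PartialSums = ∀ j → 1 ≤ j → j ≤ m → F j ≈ partialSum j

    sums⇒recurrence : PartialSums → Recurrence
    sums⇒recurrence H j j<m = isolate-subtrahend (≈-trans (H (suc j) (s≤s z≤n) j<m) (≈-sym (step j j<m (F₀≈ j j<m))))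
      where
      F₀≈ : ∀ j → suc j ≤ m → F₀ j ≈ partialSum j
      F₀≈ zero    _ = ≈-refl
      F₀≈ (suc j) p = H (suc j) (s≤s z≤n) (ℕₚ.<⇒≤ p)

    recurrence⇒sums : Recurrence → PartialSums
    recurrence⇒sums H (suc j) _ j<m = F₀≈ (suc j) j<m
      where
      F₀≈ : ∀ j → j ≤ m → F₀ j ≈ partialSum j
      F₀≈ zero    _   = ≈-refl
      F₀≈ (suc j) j<m = ≈-trans (isolate-subtrahend⁻¹ (H j j<m)) (step j j<m (F₀≈ j (ℕₚ.<⇒≤ j<m)))

    SeriesIdentity : Set ℓ
    SeriesIdentity = series n E S.≈ 1+tV V (series m F) S.* series m F

    rhs : ∀ j → suc j ≤ m → (1+tV V (series m F) S.* series m F) (n ∸ suc j) ≈ F₀ j + V * F (suc j)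
    -- For j < m the exponent is the successor of m - (j + 1). The 1 therefore picks the coefficient
    -- of index j in the series of F, and tV the one of index j + 1.
    rhs j j<m = ≈-trans (reflexive (≡.cong (1+tV V (series m F) S.* series m F) (ℕₚ.+-∸-assoc 1 j<m)))
      (≈-trans (product-suc V (series m F) (m ∸ suc j))
        (+-congᴿ (≈-trans (reflexive (≡.cong (series m F) (≡.sym (ℕₚ.+-∸-assoc 1 j<m)))) (previous j j<m))
          (*-congᴿ ≈-refl (series-in m F j j<m))))
      where
      previous : ∀ j → suc j ≤ m → series m F (m ∸ j) ≈ F₀ j
      -- The exponent m is one above the highest exponent of the series of F, which produces the 0
      -- of `F₀ zero`.
      previous zero    _ = series-out m F m ℕₚ.≤-refl
      previous (suc j) p = series-in m F j (ℕₚ.<⇒≤ p)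

    series⇒recurrence : SeriesIdentity → Recurrence
    series⇒recurrence H j j<m = ≈-trans (≈-sym (series-in n E j (ℕₚ.m≤n⇒m≤1+n j<m)))
      (≈-trans (H (n ∸ suc j)) (rhs j j<m))

    constant-term : ∀ m → 1 ≤ m → series m F 0 ≈ F m
    constant-term (suc l) _ = ≈-trans (reflexive (≡.cong (series (suc l) F) (≡.sym (ℕₚ.n∸n≡0 l)))) (series-in (suc l) F l ℕₚ.≤-refl)

    recurrence⇒series : Recurrence → SeriesIdentity
    recurrence⇒series H k with k ℕₚ.<? n
    ... | no k≮n = outside k (ℕₚ.≮⇒≥ k≮n)
      where
      outside : ∀ k → n ≤ k → series n E k ≈ (1+tV V (series m F) S.* series m F) k
      outside (suc k) (s≤s m≤k) = ≈-trans (series-out n E (suc k) (s≤s m≤k)) (≈-sym (≈-trans (product-suc V (series m F) k)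
        (≈-trans (+-congᴿ (series-out m F (suc k) (ℕₚ.m≤n⇒m≤1+n m≤k)) (≈-trans (*-congᴿ ≈-refl (series-out m F k m≤k)) (zeroʳ V)))
          (+-identityʳ 0#))))
    ... | yes k<n = ≡.subst (λ l → series n E l ≈ (1+tV V (series m F) S.* series m F) l)
        (ℕₚ.m∸[m∸n]≡n (ℕₚ.≤-pred k<n)) (inside (m ∸ k) (ℕₚ.m∸n≤m m k))
      where
      inside : ∀ j → j ≤ m → series n E (n ∸ suc j) ≈ (1+tV V (series m F) S.* series m F) (n ∸ suc j)
      inside j j≤m with j ℕₚ.≟ m
      ... | no j≢m = ≈-trans (series-in n E j (s≤s j≤m)) (≈-trans (H j j<m) (≈-sym (rhs j j<m)))
        where
        j<m : suc j ≤ m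
        j<m = ℕₚ.≤∧≢⇒< j≤m j≢m
      -- At the exponent 0 the recurrence says nothing, its range ending at j = m; this coefficient
      -- is supplied by `top`.
      ... | yes ≡.refl = ≈-trans (series-in n E m ℕₚ.≤-refl) (≈-trans top (≈-trans (≈-sym (constant-term m 1≤m))
        (≈-trans (≈-sym (product-zero V (series m F)))
          (reflexive (≡.cong (1+tV V (series m F) S.* series m F) (≡.sym (ℕₚ.n∸n≡0 m)))))))

    equivalence : PartialSums ⇔ SeriesIdentity
    equivalence = mk⇔ (λ H → recurrence⇒series (sums⇒recurrence H)) (λ H → recurrence⇒sums (series⇒recurrence H))

-- The equivalence for the Eulerian representations and Whitehouse's lifts

proposition1 :
    (m : ℕ) → let n = suc m in 2 ≤ n →
    (e : ℕ → ℚ[𝔖 n ]) → (∀ j → 1 ≤ j → j ≤ n → IsEulerianIdempotent n j (e j)) →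
    (e′ : ℕ → ℚ[𝔖 m ]) → (∀ j → 1 ≤ j → j ≤ n ∸ 1 → IsEulerianIdempotent m j (e′ j)) →
    let R = R[𝔖 n ]
        module R = CommutativeRing R
        module S = RawRing (R ⟦t⟧)
    in
    (∀ j → 1 ≤ j → j ≤ n ∸ 1 →
       [ F (e′ j) ] R.≈ ∑₁ R.+-rawMonoid j (λ i → [ induced (E (e′ i)) ] R.- [ E (e i) ]))
    ⇔
    (∑₁ S.+-rawMonoid n (λ j → [ E (e j) ] t^[ R ] (n ∸ j))
       S.≈ (S.1# S.+ [ reflection m ] t^[ R ] 1)
           S.* ∑₁ S.+-rawMonoid (n ∸ 1) (λ j → [ F (e′ j) ] t^[ R ] (n ∸ 1 ∸ j)))
proposition1 m (s≤s 1≤m) e idem e′ idem′ = Series.Equivalence.equivalence R[𝔖 suc m ] m 1≤m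
  (λ j → [ E (e j) ]) (λ j → [ F (e′ j) ]) (λ j → [ induced (E (e′ j)) ]) [ reflection m ]
  (λ j 1≤j j≤m → induced-E-class (e′ j) (Λ-commutes-idempotent m 1≤m (idem′ j 1≤j j≤m)))
  (TopClass.class m (e (suc m)) (e′ m) (Λ-commutes-idempotent m 1≤m top′)
    (top-≈-ε (s≤s z≤n) top) (top-*ₐ-ε (s≤s z≤n) top) (top-≈-ε 1≤m top′) (top-*ₐ-ε 1≤m top′))
  where
  top : IsEulerianIdempotent (suc m) (suc m) (e (suc m))
  top = idem (suc m) (s≤s z≤n) ℕₚ.≤-refl

  top′ : IsEulerianIdempotent m m (e′ m)
  top′ = idem′ m 1≤m ℕₚ.≤-refl
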